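{- Assume the $abc$ conjecture. Let $n\ge 5$ be an odd integer with $n\equiv 1 \pmod 4$, and fix $\delta_0>0$. For integers $A>1$, $B>1$, let $\mathcal M_n(A,B)$ be the set of pairs $(a,b)\in\mathbb Z^2$ with $A\le |a|\le 2A$ and $B\le |b|\le 2B$ such that the trinomial $f(t)=t^n+at+b$ is irreducible over $\mathbb Q$ and its discriminant $D_f$ is squarefree. Then there is a constant $c>0$ (depending on $n$ and $\delta_0$) such that for all sufficiently large $A$ and all $B>A^{1+\delta_0}$, $$\#\mathcal M_n(A,B)\ge c\,AB.$$
   Context: The $abc$ conjecture: for every $\epsilon>0$ there is a constant $C_\epsilon$ such that whenever $a,b,c$ are coprime positive integers with $a+b=c$, one has $c\le C_\epsilon\, N(a,b,c)^{1+\epsilon}$, where $N(a,b,c)$ is the product of the distinct primes dividing $abc$. -}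

module Defs where

open import Algebra.Bundles.Raw using (RawSemiring)
import Algebra.Definitions.RawSemiring as RawSemiringDefinitions
import Algebra.Properties.CommutativeMonoid.Sum as Summation
open import Data.Empty using (⊥)
open import Data.Fin.Base using (Fin; zero; suc; toℕ; opposite; punchIn; splitAt)
open import Data.Integer.Base as ℤ using (ℤ; +_; 0ℤ; 1ℤ; -1ℤ; ∣_∣)
import Data.Integer.Properties as ℤ
open import Data.List.Base using (List; []; _∷_; _++_; map; replicate; filter; upTo; applyUpTo; length)
open import Data.List.Relation.Unary.All using (All)
open import Data.List.Relation.Unary.Unique.Propositional using (Unique)
open import Data.Nat.Base using (ℕ; zero; suc; pred; _+_; _*_; _∸_; _^_; _/_; _≤_; _<_)
open import Data.Nat.Coprimality using (Coprime)
open import Data.Nat.Divisibility using (_∣_; _∣?_)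
open import Data.Nat.ListAction using (product)
open import Data.Nat.Primality using (prime?)
open import Data.Product.Base using (_×_; _,_; Σ-syntax; ∃; ∃₂)
open import Data.Rational.Base as ℚ using (ℚ; 0ℚ)
open import Data.Sum.Base using (_⊎_; [_,_]′)
open import Function.Bundles using (_⇔_)
open import Relation.Binary.PropositionalEquality.Core using (_≡_)
open import Relation.Nullary.Decidable.Core using (_×-dec_)

------------------------------------------------------------------------
-- Real numbers

-- Two-sided Dedekind cuts: lower q means q < x, upper q means x < q.

record ℝ : Set₁ where
  field
    lower      : ℚ → Set
    upper      : ℚ → Set
    inhabitedˡ : ∃ λ q → lower q
    inhabitedᵘ : ∃ λ q → upper q
    roundedˡ   : ∀ q → lower q ⇔ (∃ λ r → q ℚ.< r × lower r)
    roundedᵘ   : ∀ q → upper q ⇔ (∃ λ r → r ℚ.< q × upper r)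
    disjoint   : ∀ q → lower q → upper q → ⊥
    located    : ∀ {q r} → q ℚ.< r → lower q ⊎ upper r

open ℝ public

Positive : ℝ → Set
Positive x = lower x 0ℚ

-- Inequalities involving real constants and real exponents are expressed
-- through rational approximations, with denominators cleared so that only
-- powers of natural numbers occur.  Exponents are positive throughout.

-- A ^ (1 + δ) < B for A ≥ 1: by continuity of the power in its exponent,
-- some rational p / (k + 1) > δ satisfies A ^ (1 + p / (k + 1)) < B.

infix 4 _^1+_<_

_^1+_<_ : ℕ → ℝ → ℕ → Set
A ^1+ δ < B =
  ∃₂ λ p k → upper δ (+ p ℚ./ suc k) × A ^ (suc k + p) < B ^ suc k

-- m ≤ C · N ^ (1 + ε) for m, N ≥ 1: equivalently, for all rationals
-- u / (v + 1) > C and p / (k + 1) > ε,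
-- m ≤ (u / (v + 1)) · N ^ (1 + p / (k + 1)).

infix 4 _≤_·_^1+_

_≤_·_^1+_ : ℕ → ℝ → ℕ → ℝ → Set
m ≤ C · N ^1+ ε = ∀ u v p k →
  upper C (+ u ℚ./ suc v) → upper ε (+ p ℚ./ suc k) →
  (suc v * m) ^ suc k ≤ u ^ suc k * N ^ (suc k + p)

-- c · m ≤ # S for c > 0: there are distinct elements of S whose number is
-- at least u · m / (v + 1) for every rational u / (v + 1) < c.

infix 4 _·_≤#_

_·_≤#_ : ∀ {X : Set} → ℝ → ℕ → (X → Set) → Set
_·_≤#_ {X} c m S = Σ[ xs ∈ List X ] Unique xs × All S xs ×
  (∀ u v → lower c (+ u ℚ./ suc v) → u * m ≤ suc v * length xs)

------------------------------------------------------------------------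
-- The abc conjecture

radical : ℕ → ℕ
radical m = product (filter (λ p → prime? p ×-dec (p ∣? m)) (upTo (suc m)))

ABC : Set₁
ABC = (ε : ℝ) → Positive ε → Σ[ C ∈ ℝ ]
  (∀ a b c → 0 < a → 0 < b → 0 < c →
   Coprime a b → Coprime a c → Coprime b c → a + b ≡ c →
   c ≤ C · radical (a * b * c) ^1+ ε)

------------------------------------------------------------------------
-- Univariate polynomials

-- Coefficient lists, constant term first; trailing zeros are allowed and
-- are disregarded by _≈ₚ_.

module Polynomials {c ℓ} (R : RawSemiring c ℓ) where

  open RawSemiring R using (Carrier; _≈_; 0#; 1#)
    renaming (_+_ to _⊕_; _*_ to _⊗_)

  Poly : Set c
  Poly = List Carrier

  coeff : Poly → ℕ → Carrier
  coeff []      _       = 0#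
  coeff (a ∷ _) zero    = a
  coeff (_ ∷ p) (suc i) = coeff p i

  infix  4 _≈ₚ_
  infixl 6 _+ₚ_
  infixl 7 _*ₚ_

  _≈ₚ_ : Poly → Poly → Set ℓ
  p ≈ₚ q = ∀ i → coeff p i ≈ coeff q i

  _+ₚ_ : Poly → Poly → Poly
  []      +ₚ q       = q
  (a ∷ p) +ₚ []      = a ∷ p
  (a ∷ p) +ₚ (b ∷ q) = (a ⊕ b) ∷ (p +ₚ q)

  shift : ℕ → Poly → Poly
  shift k p = replicate k 0# ++ p

  _*ₚ_ : Poly → Poly → Poly
  []      *ₚ q = []
  (a ∷ p) *ₚ q = map (a ⊗_) q +ₚ shift 1 (p *ₚ q)

  monomial : ℕ → Carrier → Poly
  monomial k a = shift k (a ∷ [])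

  rawSemiring : RawSemiring c ℓ
  rawSemiring = record
    { Carrier = Poly
    ; _≈_     = _≈ₚ_
    ; _+_     = _+ₚ_
    ; _*_     = _*ₚ_
    ; 0#      = []
    ; 1#      = 1# ∷ []
    }

module ℤ[t] = Polynomials ℤ.+-*-rawSemiring
module ℚ[t] = Polynomials ℚ.+-*-rawSemiring

IrreducibleOverℚ : ℤ[t].Poly → Set
IrreducibleOverℚ f =
  RawSemiringDefinitions.Irreducible ℚ[t].rawSemiring (map (ℚ._/ 1) f)

------------------------------------------------------------------------
-- Discriminants

open Summation ℤ.+-0-commutativeMonoid using (sum)

det : ∀ {n} → (Fin n → Fin n → ℤ) → ℤ
det {zero}  M = 1ℤ
det {suc n} M = sum λ j →
  (-1ℤ ℤ.^ toℕ j) ℤ.* M zero j ℤ.* det (λ i k → M (suc i) (punchIn j k))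

derivative : ℤ[t].Poly → ℤ[t].Poly
derivative f = applyUpTo (λ i → + suc i ℤ.* ℤ[t].coeff f (suc i)) (pred (length f))

-- For deg f ≤ m and deg g ≤ k, the rows are the coefficient vectors, from
-- degree m + k - 1 down to 0, of t^(k-1) f, …, t f, f, t^(m-1) g, …, t g, g.

sylvester : ∀ m k → ℤ[t].Poly → ℤ[t].Poly → Fin (k + m) → Fin (k + m) → ℤ
sylvester m k f g i j = ℤ[t].coeff
  ([ (λ r → ℤ[t].shift (toℕ (opposite r)) f)
   , (λ r → ℤ[t].shift (toℕ (opposite r)) g)
   ]′ (splitAt k i))
  (toℕ (opposite j))

resultant : ℕ → ℕ → ℤ[t].Poly → ℤ[t].Poly → ℤ
resultant m k f g = det (sylvester m k f g)

-- The discriminant of a monic polynomial f of degree n; monicity is why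
-- there is no division by a leading coefficient.

discriminant : ℕ → ℤ[t].Poly → ℤ
discriminant n f =
  (-1ℤ ℤ.^ (n * (n ∸ 1) / 2)) ℤ.* resultant n (n ∸ 1) f (derivative f)

Squarefree : ℤ → Set
Squarefree D = ∀ d → d * d ∣ ∣ D ∣ → d ≡ 1

------------------------------------------------------------------------
-- Trinomials

trinomial : ℕ → ℤ → ℤ → ℤ[t].Poly
trinomial n a b = monomial n 1ℤ +ₚ monomial 1 a +ₚ monomial 0 b
  where open ℤ[t]

𝓜 : ℕ → ℕ → ℕ → ℤ × ℤ → Set
𝓜 n A B (a , b) =
  (A ≤ ∣ a ∣ × ∣ a ∣ ≤ 2 * A) ×
  (B ≤ ∣ b ∣ × ∣ b ∣ ≤ 2 * B) ×
  IrreducibleOverℚ (trinomial n a b) ×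
  Squarefree (discriminant n (trinomial n a b))

{-# OPTIONS --safe #-}
module Submission where

-- For n = e + 1 ≡ 1 modulo 4 the discriminants of t ^ n ± a t + b are U ± V,
-- where U = n ^ n b ^ e and V = e ^ e a ^ n.  If p² divides U + V and q² divides
-- U - V, then the abc inequality for V² + (U + V)(U - V) = U² bounds p q by
-- about A B ^ (1 + ε), which is o(B²) because B > A ^ (1 + δ).  So a and - a
-- cannot both give a prime above B / Q whose square divides the discriminant,
-- and a sieve by the primes up to B / Q (at most e classes of b modulo p² are
-- bad for each a and sign, by Lagrange and Hensel) leaves half of the pairs in
-- suitable residue classes, each with a good sign.
--
-- Irreducibility is forced by the residue classes: a monic factor g of degree
-- k makes g(0) ^ n ≡ b ^ k modulo every divisor m of a, as both sides are, up to
-- the same sign, norms from ℤ[t]/(g), of t ^ n and of - b.  Here m and b modulo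
-- m are chosen such that b ^ k is no n-th power modulo m for 0 < k < n.

open import Defs
import Algebra.Definitions.RawMagma as RawMagma
open import Algebra.Bundles using (CommutativeRing; Semiring)
open import Algebra.Definitions.RawSemiring ℚ[t].rawSemiring using (mkIrred) renaming (_∣_ to _∣ℚ_)
import Algebra.Properties.CommutativeSemigroup as CommutativeSemigroupProperties
open import Data.Empty using (⊥; ⊥-elim)
open import Data.Fin.Base as Fin using (Fin; zero; suc; toℕ; opposite; punchIn; splitAt)
import Data.Fin.Properties as Fin
open import Data.Integer.Base as ℤ using (ℤ; +_; 0ℤ; 1ℤ; -1ℤ; ∣_∣)
import Data.Integer.Divisibility.Signed as ℤ∣
open import Data.Integer.DivMod using (a≡a%ℕn+[a/ℕn]*n; n%ℕd<d)
import Data.Integer.Properties as ℤ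
open import Data.Integer.Tactic.RingSolver using () renaming (solve-∀ to ℤ-solve)
open import Algebra.Properties.Semiring.Sum ℤ.+-*-semiring using (sum; *-distribˡ-sum; sum-cong-≗; ∑-comm)
open import Data.List.Base using (List; []; _∷_; _++_; applyUpTo; filter; length; map; replicate; tabulate; upTo)
open import Data.List.Membership.Propositional using (_∈_)
open import Data.List.Membership.Propositional.Properties using (∈-∃++; ∈-++⁺ʳ)
import Data.List.Properties as List
open import Data.List.Relation.Binary.Pointwise as PW using (Pointwise; []; _∷_)
open import Data.List.Relation.Unary.All as All using (All; []; _∷_)
import Data.List.Relation.Unary.All.Properties as All
open import Data.List.Relation.Unary.AllPairs as AllPairs using (AllPairs; []; _∷_)
import Data.List.Relation.Unary.AllPairs.Properties as AllPairs
open import Data.List.Relation.Unary.Any using (here; there)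
open import Data.List.Relation.Unary.Unique.Propositional using (Unique)
import Data.List.Relation.Unary.Unique.Propositional.Properties as Unique
open import Data.Nat.Base as ℕ using (ℕ; zero; suc; _+_; _*_; _∸_; _^_; _/_; _%_; _≤_; _<_; z≤n; s≤s; NonZero; >-nonZero; >-nonZero⁻¹)
open import Data.Nat.Coprimality as Coprime using (Coprime; coprime?; coprime-divisor; coprime-Bézout)
open import Data.Nat.Divisibility as ℕ∣ using (_∣_; divides)
open import Data.Nat.DivMod using (m*n/n≡m; m/n*n≤m; m≡m%n+[m/n]*n; m%n<n)
open import Data.Nat.GCD using (gcd[m,n]∣m; gcd[m,n]∣n; gcd-greatest; module Bézout)
open import Data.Nat.Induction using (<-rec)
open import Data.Nat.ListAction using (product)
open import Data.Nat.Primality using (Prime; euclidsLemma; prime?; prime⇒nonZero; prime⇒nonTrivial; prime⇒irreducible; ¬prime[1])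
open import Data.Nat.Primality.Factorisation using (factorise; factorisationHasAllPrimeFactors)
import Data.Nat.Properties as ℕ
open import Data.Nat.Properties using (*-assoc; *-cancelˡ-≤; *-comm; *-distribˡ-+; *-identityˡ;
  *-mono-≤; *-monoʳ-≤; *-monoˡ-≤; *-zeroʳ; +-assoc; +-comm; +-identityʳ; +-mono-≤; +-monoʳ-≤;
  +-monoˡ-≤; +-suc; 0<1+n; <-trans; <-≤-trans; <⇒≢; <⇒≤; <⇒≱; ^-*-assoc; ^-distribˡ-+-*; ^-monoʳ-<;
  ^-monoʳ-≤; ^-monoˡ-≤; m*n≢0; m+[n∸m]≡n; m<n⇒0<n∸m; m<n⇒m<1+n; m^n>0; m^n≢0; m≤m*n; m≤m+n; m≤n+m;
  m≤n⇒m<n∨m≡n; m≤n⇒m≤1+n; n<1+n; n≢0⇒n>0; n≤1+n; ≤-<-trans; ≤-pred; ≤-refl; ≤-reflexive; ≤-trans;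
  ≤⇒≯; ≮⇒≥; ≰⇒>)
open import Data.Nat.Tactic.RingSolver using () renaming (solve-∀ to ℕ-solve)
open import Data.Product.Base using (_×_; _,_; proj₁; proj₂; Σ-syntax; ∃; ∃₂)
open import Data.Rational.Base as ℚ using (ℚ; 0ℚ; 1ℚ; mkℚ)
import Data.Rational.Properties as ℚ
open import Data.Rational.Unnormalised.Base as ℚᵘ using (mkℚᵘ; *≡*)
import Data.Rational.Unnormalised.Properties as ℚᵘ
open import Data.Sum.Base using (_⊎_; inj₁; inj₂; [_,_]′)
open import Data.Sum.Properties using ([,]-map; [,]-∘)
open import Function.Base using (_∘_; id; it)
open import Function.Bundles using (mk⇔; Equivalence)
open import Relation.Binary.Definitions using (tri<; tri≈; tri>)
open import Relation.Binary.PropositionalEquality hiding (J)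
import Relation.Binary.Reasoning.Setoid as ≈ˢ-Reasoning
open import Relation.Nullary.Decidable.Core using (Dec; yes; no; ¬?; _×-dec_)
open import Relation.Nullary.Negation.Core using (¬_; contradiction)

-- Determinants

-- A single discriminant is out of reach. If p² divides D = U + V, the abc inequality for this sum
-- bounds p only by about A B ^ (1 + ε), which is compatible with p > B / Q; and counting fails for
-- such p, since every prime may cost up to e values of b in each row by rounding alone. Both
-- discriminants fit into one abc triple because its other two terms are squares: U² and V² together
-- contribute at most n e a b to the radical, while each of the two square factors saves a prime.
-- Hence p q is compared with (B / Q)², and here a bound near A B ^ (1 + ε) is a contradiction. The
-- triple has to be coprime, and Hensel's lemma needs b prime to p, so the sieve also discards the
-- pairs (a, b) with a common prime. Primes up to z are kept away from the discriminants by the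
-- residue classes, because the sum of 1 / p² over the remaining primes must be small compared with
-- 1 / e. Discriminants and norms are both determinants of shifted coefficient rows, evaluated by
-- row operations; this is why determinants are rewritten below as functions of a list of rows.

det-cong : ∀ {k} {M N : Fin k → Fin k → ℤ} → (∀ i j → M i j ≡ N i j) → det M ≡ det N
det-cong {zero}  _ = refl
det-cong {suc k} {M} {N} h = sum-cong-≗ λ j →
  cong₂ ℤ._*_ (cong ((-1ℤ ℤ.^ toℕ j) ℤ.*_) (h zero j)) (det-cong λ i c → h (suc i) (punchIn j c))

sign-swap : ∀ s t a b d →
  (-1ℤ ℤ.* s) ℤ.* a ℤ.* (t ℤ.* b ℤ.* d) ≡ (-1ℤ ℤ.* t) ℤ.* b ℤ.* (s ℤ.* a ℤ.* d)
sign-swap = ℤ-solve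

-- Every minor of the first-row expansion is expanded along its own first column. Exchanging the two
-- sums and redistributing the signs by `sign-swap` gives the column expansion; the corner entry is
-- common to both.
det-expand-column : ∀ {k} (M : Fin (suc k) → Fin (suc k) → ℤ) →
  det M ≡ sum λ i → (-1ℤ ℤ.^ toℕ i) ℤ.* M i zero ℤ.* det (λ r c → M (punchIn i r) (suc c))
det-expand-column {zero} M = refl
det-expand-column {suc k} M = cong (λ s → (1ℤ ℤ.* M zero zero ℤ.* det (λ r c → M (suc r) (suc c))) ℤ.+ s) (begin
  sum (λ j → row j ℤ.* det (λ r c → M (suc r) (punchIn (suc j) c)))
    ≡⟨ sum-cong-≗ (λ j → trans
         (cong (row j ℤ.*_) (det-expand-column (λ r c → M (suc r) (punchIn (suc j) c))))
         (*-distribˡ-sum (row j) (λ i → column′ i ℤ.* minor i j))) ⟩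
  sum (λ j → sum λ i → row j ℤ.* (column′ i ℤ.* minor i j))
    ≡⟨ ∑-comm (λ j i → row j ℤ.* (column′ i ℤ.* minor i j)) ⟩
  sum (λ i → sum λ j → row j ℤ.* (column′ i ℤ.* minor i j))
    ≡⟨ sum-cong-≗ (λ i → trans
         (sum-cong-≗ λ j → sign-swap (-1ℤ ℤ.^ toℕ j) (-1ℤ ℤ.^ toℕ i) (M zero (suc j)) (M (suc i) zero) (minor i j))
         (sym (*-distribˡ-sum (column i) (λ j → row′ j ℤ.* minor i j)))) ⟩
  sum (λ i → column i ℤ.* det (λ r c → M (punchIn (suc i) r) (suc c))) ∎)
  where
  open ≡-Reasoning
  minor : Fin (suc k) → Fin (suc k) → ℤ
  minor i j = det (λ r c → M (suc (punchIn i r)) (suc (punchIn j c)))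
  row row′ column column′ : Fin (suc k) → ℤ
  row j = (-1ℤ ℤ.^ suc (toℕ j)) ℤ.* M zero (suc j)
  row′ j = (-1ℤ ℤ.^ toℕ j) ℤ.* M zero (suc j)
  column i = (-1ℤ ℤ.^ suc (toℕ i)) ℤ.* M (suc i) zero
  column′ i = (-1ℤ ℤ.^ toℕ i) ℤ.* M (suc i) zero

Row : Set
Row = ℕ → ℤ

-- rowsDet d rs is the determinant of the rows rs in the columns of degrees
-- d - 1, …, 0; it is 0 when rs has more than d rows or fewer.

mutual
  rowsDet : ℕ → List Row → ℤ
  rowsDet zero    []      = 1ℤ
  rowsDet zero    (_ ∷ _) = 0ℤ
  rowsDet (suc d) rs      = expand d [] rs

  -- Expansion along the column of degree `d`. The rows `ps` have been passed already and stay in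
  -- the minors; the subtraction produces the alternating signs.
  expand : ℕ → List Row → List Row → ℤ
  expand d ps []       = 0ℤ
  expand d ps (r ∷ rs) = r d ℤ.* rowsDet d (ps ++ rs) ℤ.- expand d (ps ++ r ∷ []) rs

expand-tabulate : ∀ d ps {k} (f : Fin (suc k) → Row) →
  expand d ps (tabulate f) ≡ sum λ i → (-1ℤ ℤ.^ toℕ i) ℤ.* f i d ℤ.* rowsDet d (ps ++ tabulate (f ∘ punchIn i))
expand-tabulate d ps {zero} f = single (f zero d) (rowsDet d (ps ++ []))
  where
  single : ∀ x y → x ℤ.* y ℤ.- 0ℤ ≡ 1ℤ ℤ.* x ℤ.* y ℤ.+ 0ℤ
  single = ℤ-solve
expand-tabulate d ps {suc k} f = begin
  f zero d ℤ.* rowsDet d (ps ++ tabulate (f ∘ suc)) ℤ.- expand d (ps ++ f zero ∷ []) (tabulate (f ∘ suc))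
    ≡⟨ cong (λ x → f zero d ℤ.* rowsDet d (ps ++ tabulate (f ∘ suc)) ℤ.- x) (expand-tabulate d (ps ++ f zero ∷ []) (f ∘ suc)) ⟩
  f zero d ℤ.* rowsDet d (ps ++ tabulate (f ∘ suc)) ℤ.- sum t
    ≡⟨ rearrange (f zero d) _ (sum t) ⟩
  1ℤ ℤ.* f zero d ℤ.* rowsDet d (ps ++ tabulate (f ∘ suc)) ℤ.+ -1ℤ ℤ.* sum t
    ≡⟨ cong (λ x → 1ℤ ℤ.* f zero d ℤ.* rowsDet d (ps ++ tabulate (f ∘ suc)) ℤ.+ x)
         (trans (*-distribˡ-sum -1ℤ t) (sum-cong-≗ λ i → trans
           (cong (λ x → -1ℤ ℤ.* ((-1ℤ ℤ.^ toℕ i) ℤ.* f (suc i) d ℤ.* rowsDet d x)) (List.++-assoc ps (f zero ∷ []) (tabulate (f ∘ suc ∘ punchIn i))))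
           (assoc (-1ℤ ℤ.^ toℕ i) (f (suc i) d) _))) ⟩
  sum (λ i → (-1ℤ ℤ.^ toℕ i) ℤ.* f i d ℤ.* rowsDet d (ps ++ tabulate (f ∘ punchIn i))) ∎
  where
  open ≡-Reasoning
  t : Fin (suc k) → ℤ
  t i = (-1ℤ ℤ.^ toℕ i) ℤ.* f (suc i) d ℤ.* rowsDet d ((ps ++ f zero ∷ []) ++ tabulate (f ∘ suc ∘ punchIn i))
  rearrange : ∀ x y s → x ℤ.* y ℤ.- s ≡ 1ℤ ℤ.* x ℤ.* y ℤ.+ -1ℤ ℤ.* s
  rearrange = ℤ-solve
  assoc : ∀ s x y → -1ℤ ℤ.* (s ℤ.* x ℤ.* y) ≡ (-1ℤ ℤ.* s) ℤ.* x ℤ.* y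
  assoc = ℤ-solve

det-rows : ∀ k (f : Fin k → Row) → det (λ i j → f i (toℕ (opposite j))) ≡ rowsDet k (tabulate f)
det-rows zero f = refl
det-rows (suc k) f = begin
  det (λ i j → f i (toℕ (opposite j)))
    ≡⟨ det-expand-column (λ i j → f i (toℕ (opposite j))) ⟩
  sum (λ i → (-1ℤ ℤ.^ toℕ i) ℤ.* f i (toℕ (Fin.fromℕ k)) ℤ.* det (λ r c → f (punchIn i r) (toℕ (opposite (suc c)))))
    ≡⟨ sum-cong-≗ (λ i → cong₂ (λ x y → (-1ℤ ℤ.^ toℕ i) ℤ.* f i x ℤ.* y) (Fin.toℕ-fromℕ k)
         (trans (det-cong λ r c → cong (f (punchIn i r)) (Fin.opposite-suc c)) (det-rows k (f ∘ punchIn i)))) ⟩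
  sum (λ i → (-1ℤ ℤ.^ toℕ i) ℤ.* f i k ℤ.* rowsDet k (tabulate (f ∘ punchIn i)))
    ≡⟨ expand-tabulate k [] f ⟨
  rowsDet (suc k) (tabulate f) ∎
  where open ≡-Reasoning

-- Congruences of integers and of determinants

infix 4 _≋_[_]
record _≋_[_] (x y m : ℤ) : Set where
  constructor ≋-intro
  field ≋-elim : m ℤ∣.∣ x ℤ.- y
open _≋_[_] public

≋-reflexive : ∀ {m x y} → x ≡ y → x ≋ y [ m ]
≋-reflexive {m} {x} refl = ≋-intro (subst (m ℤ∣.∣_) (sym (ℤ.+-inverseʳ x)) (ℤ∣.divides 0ℤ refl))

≋-sym : ∀ {m x y} → x ≋ y [ m ] → y ≋ x [ m ]
≋-sym {m} {x} {y} (≋-intro h) = ≋-intro (subst (m ℤ∣.∣_) (flip x y) (ℤ∣.∣m⇒∣-m h))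
  where
  flip : ∀ x y → ℤ.- (x ℤ.- y) ≡ y ℤ.- x
  flip = ℤ-solve

≋-trans : ∀ {m x y z} → x ≋ y [ m ] → y ≋ z [ m ] → x ≋ z [ m ]
≋-trans {m} {x} {y} {z} (≋-intro h) (≋-intro k) = ≋-intro (subst (m ℤ∣.∣_) (telescope x y z) (ℤ∣.∣m∣n⇒∣m+n h k))
  where
  telescope : ∀ x y z → (x ℤ.- y) ℤ.+ (y ℤ.- z) ≡ x ℤ.- z
  telescope = ℤ-solve

≋-+ : ∀ {m x x′ y y′} → x ≋ x′ [ m ] → y ≋ y′ [ m ] → x ℤ.+ y ≋ x′ ℤ.+ y′ [ m ]
≋-+ {m} {x} {x′} {y} {y′} (≋-intro h) (≋-intro k) = ≋-intro (subst (m ℤ∣.∣_) (regroup x x′ y y′) (ℤ∣.∣m∣n⇒∣m+n h k))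
  where
  regroup : ∀ x x′ y y′ → (x ℤ.- x′) ℤ.+ (y ℤ.- y′) ≡ (x ℤ.+ y) ℤ.- (x′ ℤ.+ y′)
  regroup = ℤ-solve

≋-neg : ∀ {m x x′} → x ≋ x′ [ m ] → ℤ.- x ≋ ℤ.- x′ [ m ]
≋-neg {m} {x} {x′} (≋-intro h) = ≋-intro (subst (m ℤ∣.∣_) (distrib x x′) (ℤ∣.∣m⇒∣-m h))
  where
  distrib : ∀ x x′ → ℤ.- (x ℤ.- x′) ≡ (ℤ.- x) ℤ.- (ℤ.- x′)
  distrib = ℤ-solve

≋-* : ∀ {m x x′ y y′} → x ≋ x′ [ m ] → y ≋ y′ [ m ] → x ℤ.* y ≋ x′ ℤ.* y′ [ m ]
≋-* {m} {x} {x′} {y} {y′} (≋-intro h) (≋-intro k) = ≋-intro (subst (m ℤ∣.∣_) (regroup x x′ y y′)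
  (ℤ∣.∣m∣n⇒∣m+n (ℤ∣.∣m⇒∣m*n y h) (ℤ∣.∣n⇒∣m*n x′ k)))
  where
  regroup : ∀ x x′ y y′ → (x ℤ.- x′) ℤ.* y ℤ.+ x′ ℤ.* (y ℤ.- y′) ≡ x ℤ.* y ℤ.- x′ ℤ.* y′
  regroup = ℤ-solve

≋-^ : ∀ {m x x′} k → x ≋ x′ [ m ] → x ℤ.^ k ≋ x′ ℤ.^ k [ m ]
≋-^ zero    h = ≋-reflexive refl
≋-^ (suc k) h = ≋-* h (≋-^ k h)

-- Equality is congruence modulo 0, so rowsDet-cong covers it too.
≋0⇒≡ : ∀ {x y} → x ≋ y [ 0ℤ ] → x ≡ y
≋0⇒≡ {x} {y} (≋-intro h) = ℤ.i-j≡0⇒i≡j x y (ℤ∣.0∣⇒≡0 h)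

mutual
  -- Only the columns below `d` are compared: a row may vanish in them without vanishing in the
  -- columns that have been expanded.
  rowsDet-cong : ∀ {m} d {rs rs′} → Pointwise (λ u v → ∀ e → e < d → u e ≋ v e [ m ]) rs rs′ →
    rowsDet d rs ≋ rowsDet d rs′ [ m ]
  rowsDet-cong zero    []      = ≋-reflexive refl
  rowsDet-cong zero    (_ ∷ _) = ≋-reflexive refl
  rowsDet-cong (suc d) hs      = expand-cong d [] hs

  expand-cong : ∀ {m} d {ps ps′ rs rs′} →
    Pointwise (λ u v → ∀ e → e < suc d → u e ≋ v e [ m ]) ps ps′ →
    Pointwise (λ u v → ∀ e → e < suc d → u e ≋ v e [ m ]) rs rs′ → expand d ps rs ≋ expand d ps′ rs′ [ m ]
  expand-cong d hp []       = ≋-reflexive refl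
  expand-cong d hp (h ∷ hs) = ≋-+
    (≋-* (h d (n<1+n d)) (rowsDet-cong d (PW.map (λ k e e<d → k e (m<n⇒m<1+n e<d)) (PW.++⁺ hp hs))))
    (≋-neg (expand-cong d (PW.++⁺ hp (h ∷ [])) hs))

rowsDet-cong-≡ : ∀ d {rs rs′} → Pointwise (λ u v → ∀ e → e < d → u e ≡ v e) rs rs′ → rowsDet d rs ≡ rowsDet d rs′
rowsDet-cong-≡ d h = ≋0⇒≡ (rowsDet-cong d (PW.map (λ k e e<d → ≋-reflexive (k e e<d)) h))

-- Multilinearity, alternation and row operations

module _ {u v w : Row} {x y : ℤ} (w≗ : ∀ e → w e ≡ x ℤ.* u e ℤ.+ y ℤ.* v e) where

  private
    combine-pair : ∀ x y r a b c d → r ℤ.* (x ℤ.* a ℤ.+ y ℤ.* b) ℤ.- (x ℤ.* c ℤ.+ y ℤ.* d)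
      ≡ x ℤ.* (r ℤ.* a ℤ.- c) ℤ.+ y ℤ.* (r ℤ.* b ℤ.- d)
    combine-pair = ℤ-solve

    combine-head : ∀ x y a b r c d → (x ℤ.* a ℤ.+ y ℤ.* b) ℤ.* r ℤ.- (x ℤ.* c ℤ.+ y ℤ.* d)
      ≡ x ℤ.* (a ℤ.* r ℤ.- c) ℤ.+ y ℤ.* (b ℤ.* r ℤ.- d)
    combine-head = ℤ-solve

    combine-zero : ∀ x y → 0ℤ ≡ x ℤ.* 0ℤ ℤ.+ y ℤ.* 0ℤ
    combine-zero = ℤ-solve

  mutual
    -- The mutual induction has two cases for `expand`, according to whether the distinguished row
    -- is still to be expanded (`ʳ`) or has been passed (`ˡ`).
    rowsDet-linear : ∀ d ps rs →
      rowsDet d (ps ++ w ∷ rs) ≡ x ℤ.* rowsDet d (ps ++ u ∷ rs) ℤ.+ y ℤ.* rowsDet d (ps ++ v ∷ rs)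
    rowsDet-linear zero    []      rs = combine-zero x y
    rowsDet-linear zero    (_ ∷ _) rs = combine-zero x y
    rowsDet-linear (suc d) ps      rs = expand-linearʳ d [] ps rs

    expand-linearʳ : ∀ d os ps rs →
      expand d os (ps ++ w ∷ rs) ≡ x ℤ.* expand d os (ps ++ u ∷ rs) ℤ.+ y ℤ.* expand d os (ps ++ v ∷ rs)
    expand-linearʳ d os [] rs = trans
      (cong₂ (λ a b → a ℤ.* rowsDet d (os ++ rs) ℤ.- b) (w≗ d) (expand-linearˡ d os [] rs))
      (combine-head x y (u d) (v d) _ _ _)
    expand-linearʳ d os (p ∷ ps) rs
      rewrite sym (List.++-assoc os ps (w ∷ rs))
            | sym (List.++-assoc os ps (u ∷ rs))
            | sym (List.++-assoc os ps (v ∷ rs)) = trans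
      (cong₂ (λ a b → p d ℤ.* a ℤ.- b) (rowsDet-linear d (os ++ ps) rs) (expand-linearʳ d (os ++ p ∷ []) ps rs))
      (combine-pair x y (p d) _ _ _ _)

    expand-linearˡ : ∀ d ps qs rs →
      expand d (ps ++ w ∷ qs) rs ≡ x ℤ.* expand d (ps ++ u ∷ qs) rs ℤ.+ y ℤ.* expand d (ps ++ v ∷ qs) rs
    expand-linearˡ d ps qs [] = combine-zero x y
    expand-linearˡ d ps qs (r ∷ rs)
      rewrite List.++-assoc ps (w ∷ qs) rs | List.++-assoc ps (w ∷ qs) (r ∷ [])
            | List.++-assoc ps (u ∷ qs) rs | List.++-assoc ps (u ∷ qs) (r ∷ [])
            | List.++-assoc ps (v ∷ qs) rs | List.++-assoc ps (v ∷ qs) (r ∷ []) = trans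
      (cong₂ (λ a b → r d ℤ.* a ℤ.- b) (rowsDet-linear d ps (qs ++ rs)) (expand-linearˡ d ps (qs ++ r ∷ []) rs))
      (combine-pair x y (r d) _ _ _ _)

module _ (u v : Row) where

  private
    negate-pair : ∀ r a b → r ℤ.* (ℤ.- a) ℤ.- (ℤ.- b) ≡ ℤ.- (r ℤ.* a ℤ.- b)
    negate-pair = ℤ-solve

    negate-swap : ∀ a b x y e → a ℤ.* x ℤ.- (b ℤ.* y ℤ.- (ℤ.- e)) ≡ ℤ.- (b ℤ.* y ℤ.- (a ℤ.* x ℤ.- e))
    negate-swap = ℤ-solve

  mutual
    rowsDet-swap : ∀ d ps rs → rowsDet d (ps ++ u ∷ v ∷ rs) ≡ ℤ.- rowsDet d (ps ++ v ∷ u ∷ rs)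
    rowsDet-swap zero    []      rs = refl
    rowsDet-swap zero    (_ ∷ _) rs = refl
    rowsDet-swap (suc d) ps      rs = expand-swapʳ d [] ps rs

    expand-swapʳ : ∀ d os ps rs → expand d os (ps ++ u ∷ v ∷ rs) ≡ ℤ.- expand d os (ps ++ v ∷ u ∷ rs)
    expand-swapʳ d os [] rs
      rewrite List.++-assoc os (u ∷ []) (v ∷ []) | List.++-assoc os (v ∷ []) (u ∷ [])
            | List.++-assoc os (u ∷ []) rs | List.++-assoc os (v ∷ []) rs = trans
      (cong (λ e → u d ℤ.* rowsDet d (os ++ v ∷ rs) ℤ.- (v d ℤ.* rowsDet d (os ++ u ∷ rs) ℤ.- e))
        (expand-swapˡ d os [] rs))
      (negate-swap (u d) (v d) _ _ _)
    expand-swapʳ d os (p ∷ ps) rs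
      rewrite sym (List.++-assoc os ps (u ∷ v ∷ rs)) | sym (List.++-assoc os ps (v ∷ u ∷ rs)) = trans
      (cong₂ (λ a b → p d ℤ.* a ℤ.- b) (rowsDet-swap d (os ++ ps) rs) (expand-swapʳ d (os ++ p ∷ []) ps rs))
      (negate-pair (p d) _ _)

    expand-swapˡ : ∀ d ps qs rs → expand d (ps ++ u ∷ v ∷ qs) rs ≡ ℤ.- expand d (ps ++ v ∷ u ∷ qs) rs
    expand-swapˡ d ps qs [] = refl
    expand-swapˡ d ps qs (r ∷ rs)
      rewrite List.++-assoc ps (u ∷ v ∷ qs) rs | List.++-assoc ps (u ∷ v ∷ qs) (r ∷ [])
            | List.++-assoc ps (v ∷ u ∷ qs) rs | List.++-assoc ps (v ∷ u ∷ qs) (r ∷ []) = trans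
      (cong₂ (λ a b → r d ℤ.* a ℤ.- b) (rowsDet-swap d ps (qs ++ rs)) (expand-swapˡ d ps (qs ++ r ∷ []) rs))
      (negate-pair (r d) _ _)

i≡-i⇒i≡0 : ∀ {i} → i ≡ ℤ.- i → i ≡ 0ℤ
i≡-i⇒i≡0 {ℤ.+0}       _  = refl
i≡-i⇒i≡0 {ℤ.+[1+ _ ]} ()
i≡-i⇒i≡0 {ℤ.-[1+ _ ]} ()

-- Neighbour swaps bring the first copy of `u` next to the second, where swapping the two shows the
-- determinant to be its own negative.
rowsDet-repeat : ∀ d ps u qs rs → rowsDet d (ps ++ u ∷ qs ++ u ∷ rs) ≡ 0ℤ
rowsDet-repeat d ps u []       rs = i≡-i⇒i≡0 (rowsDet-swap u u d ps rs)
rowsDet-repeat d ps u (q ∷ qs) rs = trans (rowsDet-swap u q d ps (qs ++ u ∷ rs)) (cong ℤ.-_ (begin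
  rowsDet d (ps ++ q ∷ u ∷ qs ++ u ∷ rs)          ≡⟨ cong (rowsDet d) (List.++-assoc ps (q ∷ []) _) ⟨
  rowsDet d ((ps ++ q ∷ []) ++ u ∷ qs ++ u ∷ rs)  ≡⟨ rowsDet-repeat d (ps ++ q ∷ []) u qs rs ⟩
  0ℤ                                              ∎))
  where open ≡-Reasoning

rowsDet-member : ∀ d ps {u rs} → u ∈ rs → rowsDet d (ps ++ u ∷ rs) ≡ 0ℤ
rowsDet-member d ps {u} u∈rs with qs , rs , refl ← ∈-∃++ u∈rs = rowsDet-repeat d ps u qs rs

rowsDet-zero : ∀ d ps {u} rs → (∀ e → e < d → u e ≡ 0ℤ) → rowsDet d (ps ++ u ∷ rs) ≡ 0ℤ
rowsDet-zero d ps {u} rs u≡0 = trans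
  (rowsDet-cong-≡ d (PW.++⁺ (PW.refl (λ {r} _ _ → refl) {ps}) (u≡0 ∷ PW.refl (λ {r} _ _ → refl) {rs})))
  (rowsDet-linear {u = λ _ → 0ℤ} {v = λ _ → 0ℤ} {x = 0ℤ} {y = 0ℤ} (λ _ → refl) d ps rs)

-- Linear combinations, built one summand at a time; the factor `1ℤ` gives the equation the shape
-- that `rowsDet-linear` expects.
data Span (rs : List Row) : Row → Set where
  span-zero : ∀ {u} → (∀ e → u e ≡ 0ℤ) → Span rs u
  span-add  : ∀ {u v w} x → v ∈ rs → Span rs u → (∀ e → w e ≡ x ℤ.* v e ℤ.+ 1ℤ ℤ.* u e) → Span rs w

rowsDet-span : ∀ d ps {u rs} → Span rs u → rowsDet d (ps ++ u ∷ rs) ≡ 0ℤ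
rowsDet-span d ps (span-zero u≗0) = rowsDet-zero d ps _ (λ e _ → u≗0 e)
rowsDet-span d ps {rs = rs} (span-add {u} {v} x v∈rs s w≗) = trans (rowsDet-linear {u = v} {u} {x = x} {1ℤ} w≗ d ps rs)
  (trans (cong₂ (λ a b → x ℤ.* a ℤ.+ 1ℤ ℤ.* b) (rowsDet-member d ps v∈rs) (rowsDet-span d ps s))
    (cong (ℤ._+ 0ℤ) (ℤ.*-zeroʳ x)))

span-++ : ∀ ps {rs u} → Span rs u → Span (ps ++ rs) u
span-++ ps (span-zero h)       = span-zero h
span-++ ps (span-add x v s h) = span-add x (∈-++⁺ʳ ps v) (span-++ ps s) h

record _≈_*_mod_ (w : Row) (x : ℤ) (u : Row) (rs : List Row) : Set where
  constructor by
  field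
    {rest} : Row
    spans  : Span rs rest
    sums   : ∀ e → w e ≡ x ℤ.* u e ℤ.+ 1ℤ ℤ.* rest e

-- A block of row operations: each `w` differs from `x` times `u` by a combination of the rows `rs`,
-- which remain in the determinant, and every replaced row contributes one factor `x`.
rowsDet-reduce : ∀ d x ps {ws us} rs → Pointwise (λ w u → w ≈ x * u mod rs) ws us →
  rowsDet d (ps ++ ws ++ rs) ≡ x ℤ.^ length us ℤ.* rowsDet d (ps ++ us ++ rs)
rowsDet-reduce d x ps rs [] = sym (ℤ.*-identityˡ _)
rowsDet-reduce d x ps {w ∷ ws} {u ∷ us} rs (by {s} spans sums ∷ hs) = begin
  rowsDet d (ps ++ w ∷ ws ++ rs)
    ≡⟨ rowsDet-linear {u = u} {s} {x = x} {1ℤ} sums d ps (ws ++ rs) ⟩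
  x ℤ.* rowsDet d (ps ++ u ∷ ws ++ rs) ℤ.+ 1ℤ ℤ.* rowsDet d (ps ++ s ∷ ws ++ rs)
    ≡⟨ cong (λ z → x ℤ.* rowsDet d (ps ++ u ∷ ws ++ rs) ℤ.+ 1ℤ ℤ.* z) (rowsDet-span d ps (span-++ ws spans)) ⟩
  x ℤ.* rowsDet d (ps ++ u ∷ ws ++ rs) ℤ.+ 0ℤ
    ≡⟨ ℤ.+-identityʳ _ ⟩
  x ℤ.* rowsDet d (ps ++ u ∷ ws ++ rs)
    ≡⟨ cong (λ z → x ℤ.* rowsDet d z) (List.++-assoc ps (u ∷ []) (ws ++ rs)) ⟨
  x ℤ.* rowsDet d ((ps ++ u ∷ []) ++ ws ++ rs)
    ≡⟨ cong (x ℤ.*_) (rowsDet-reduce d x (ps ++ u ∷ []) rs hs) ⟩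
  x ℤ.* (x ℤ.^ length us ℤ.* rowsDet d ((ps ++ u ∷ []) ++ us ++ rs))
    ≡⟨ cong (λ z → x ℤ.* (x ℤ.^ length us ℤ.* rowsDet d z)) (List.++-assoc ps (u ∷ []) (us ++ rs)) ⟩
  x ℤ.* (x ℤ.^ length us ℤ.* rowsDet d (ps ++ u ∷ us ++ rs))
    ≡⟨ ℤ.*-assoc x _ _ ⟨
  x ℤ.* x ℤ.^ length us ℤ.* rowsDet d (ps ++ u ∷ us ++ rs) ∎
  where open ≡-Reasoning

expand-zero-column : ∀ d ps {rs} → All (λ r → r d ≡ 0ℤ) rs → expand d ps rs ≡ 0ℤ
expand-zero-column d ps []       = refl
expand-zero-column d ps {r ∷ rs} (h ∷ hs) =
  cong₂ (λ a b → a ℤ.* rowsDet d (ps ++ rs) ℤ.- b) h (expand-zero-column d (ps ++ r ∷ []) hs)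

expand-single : ∀ d os {ps} r {rs} → All (λ u → u d ≡ 0ℤ) ps → All (λ u → u d ≡ 0ℤ) rs →
  expand d os (ps ++ r ∷ rs) ≡ -1ℤ ℤ.^ length ps ℤ.* (r d ℤ.* rowsDet d (os ++ ps ++ rs))
expand-single d os r {rs} [] hs = trans
  (cong (λ z → r d ℤ.* rowsDet d (os ++ rs) ℤ.- z) (expand-zero-column d (os ++ r ∷ []) hs))
  (trans (ℤ.+-identityʳ _) (sym (ℤ.*-identityˡ _)))
expand-single d os {p ∷ ps} r {rs} (h ∷ hp) hs = begin
  p d ℤ.* rowsDet d (os ++ ps ++ r ∷ rs) ℤ.- expand d (os ++ p ∷ []) (ps ++ r ∷ rs)
    ≡⟨ cong₂ (λ a b → a ℤ.* rowsDet d (os ++ ps ++ r ∷ rs) ℤ.- b) h (expand-single d (os ++ p ∷ []) r hp hs) ⟩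
  0ℤ ℤ.- s ℤ.* (r d ℤ.* rowsDet d ((os ++ p ∷ []) ++ ps ++ rs))
    ≡⟨ negate s _ ⟩
  -1ℤ ℤ.* s ℤ.* (r d ℤ.* rowsDet d ((os ++ p ∷ []) ++ ps ++ rs))
    ≡⟨ cong (λ z → -1ℤ ℤ.* s ℤ.* (r d ℤ.* rowsDet d z)) (List.++-assoc os (p ∷ []) (ps ++ rs)) ⟩
  -1ℤ ℤ.* s ℤ.* (r d ℤ.* rowsDet d (os ++ p ∷ ps ++ rs)) ∎
  where
  open ≡-Reasoning
  s : ℤ
  s = -1ℤ ℤ.^ length ps
  negate : ∀ s x → 0ℤ ℤ.- s ℤ.* x ≡ -1ℤ ℤ.* s ℤ.* x
  negate = ℤ-solve

rowsDet-single : ∀ d {ps} r {rs} → All (λ u → u d ≡ 0ℤ) ps → All (λ u → u d ≡ 0ℤ) rs →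
  rowsDet (suc d) (ps ++ r ∷ rs) ≡ -1ℤ ℤ.^ length ps ℤ.* (r d ℤ.* rowsDet d (ps ++ rs))
rowsDet-single d = expand-single d []

expand-zero-row : ∀ d ps {u} qs rs → (∀ e → e < d → u e ≡ 0ℤ) → expand d (ps ++ u ∷ qs) rs ≡ 0ℤ
expand-zero-row d ps qs []       h = refl
expand-zero-row d ps {u} qs (r ∷ rs) h
  rewrite List.++-assoc ps (u ∷ qs) rs | List.++-assoc ps (u ∷ qs) (r ∷ [])
        | rowsDet-zero d ps (qs ++ rs) h | expand-zero-row d ps (qs ++ r ∷ []) rs h
        | ℤ.*-zeroʳ (r d) = refl

-- In all other terms of the expansion the row `u` survives into the minor and is zero there.
rowsDet-head : ∀ d {u} rs → (∀ e → e < d → u e ≡ 0ℤ) → rowsDet (suc d) (u ∷ rs) ≡ u d ℤ.* rowsDet d rs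
rowsDet-head d {u} rs h = trans
  (cong (λ z → u d ℤ.* rowsDet d rs ℤ.- z) (expand-zero-row d [] [] rs h)) (ℤ.+-identityʳ _)

-- The discriminant of a trinomial

shiftRow : ℕ → Row → Row
shiftRow zero    u e       = u e
shiftRow (suc s) u zero    = 0ℤ
shiftRow (suc s) u (suc e) = shiftRow s u e

shifts : ℕ → Row → List Row
shifts zero    u = []
shifts (suc k) u = shiftRow k u ∷ shifts k u

length-shifts : ∀ k u → length (shifts k u) ≡ k
length-shifts zero    u = refl
length-shifts (suc k) u = cong suc (length-shifts k u)

∈-shifts : ∀ {s k} u → s < k → shiftRow s u ∈ shifts k u
∈-shifts {s} {suc k} u (s≤s s≤k) with m≤n⇒m<n∨m≡n s≤k
... | inj₁ s<k  = there (∈-shifts u s<k)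
... | inj₂ refl = here refl

shiftRow-above : ∀ s {u m e} → (∀ i → m < i → u i ≡ 0ℤ) → s + m < e → shiftRow s u e ≡ 0ℤ
shiftRow-above zero    h s+m<e                 = h _ s+m<e
shiftRow-above (suc s) {e = suc e} h (s≤s s+m<e) = shiftRow-above s h s+m<e

shiftRow-at : ∀ s u e → shiftRow s u (s + e) ≡ u e
shiftRow-at zero    u e = refl
shiftRow-at (suc s) u e = shiftRow-at s u e

shifts-above : ∀ k {u m e} → (∀ i → m < i → u i ≡ 0ℤ) → k + m ≤ e → All (λ r → r e ≡ 0ℤ) (shifts k u)
shifts-above zero    h _ = []
shifts-above (suc k) h k+m<e = shiftRow-above k h k+m<e ∷ shifts-above k h (<⇒≤ k+m<e)

coeff-shift : ∀ s p e → ℤ[t].coeff (ℤ[t].shift s p) e ≡ shiftRow s (ℤ[t].coeff p) e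
coeff-shift zero    p e       = refl
coeff-shift (suc s) p zero    = refl
coeff-shift (suc s) p (suc e) = coeff-shift s p e

tabulate-splitAt : ∀ {A : Set} k {m} (F : Fin k → A) (G : Fin m → A) →
  tabulate (λ i → [ F , G ]′ (splitAt k i)) ≡ tabulate F ++ tabulate G
tabulate-splitAt zero    F G = refl
tabulate-splitAt (suc k) F G = cong (F zero ∷_) (trans
  (List.tabulate-cong λ i → [,]-map (splitAt k i))
  (tabulate-splitAt k (F ∘ suc) G))

tabulate-shifts : ∀ k u (g : Fin k → Row) → (∀ i → g i ≗ shiftRow (toℕ (opposite i)) u) →
  Pointwise _≗_ (tabulate g) (shifts k u)
tabulate-shifts zero    u g h = []
tabulate-shifts (suc k) u g h =
  (λ e → trans (h zero e) (cong (λ s → shiftRow s u e) (Fin.toℕ-fromℕ k))) ∷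
  tabulate-shifts k u (g ∘ suc) (λ i e → trans (h (suc i) e) (cong (λ s → shiftRow s u e) (Fin.opposite-suc i)))

resultant-rows : ∀ m k f g →
  resultant m k f g ≡ rowsDet (k + m) (shifts k (ℤ[t].coeff f) ++ shifts m (ℤ[t].coeff g))
resultant-rows m k f g = begin
  det (sylvester m k f g)
    ≡⟨ det-rows (k + m) (λ i → ℤ[t].coeff ([ shift f , shift g ]′ (splitAt k i))) ⟩
  rowsDet (k + m) (tabulate λ i → ℤ[t].coeff ([ shift f , shift g ]′ (splitAt k i)))
    ≡⟨ cong (rowsDet (k + m)) (trans
         (List.tabulate-cong λ i → [,]-∘ ℤ[t].coeff (splitAt k i))
         (tabulate-splitAt k (ℤ[t].coeff ∘ shift f {k}) (ℤ[t].coeff ∘ shift g {m}))) ⟩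
  rowsDet (k + m) (tabulate (ℤ[t].coeff ∘ shift f {k}) ++ tabulate (ℤ[t].coeff ∘ shift g {m}))
    ≡⟨ rowsDet-cong-≡ (k + m) (PW.++⁺ (rows k f) (rows m g)) ⟩
  rowsDet (k + m) (shifts k (ℤ[t].coeff f) ++ shifts m (ℤ[t].coeff g)) ∎
  where
  open ≡-Reasoning
  shift : ℤ[t].Poly → ∀ {l} → Fin l → ℤ[t].Poly
  shift p r = ℤ[t].shift (toℕ (opposite r)) p
  rows : ∀ l p → Pointwise (λ u v → ∀ e → e < k + m → u e ≡ v e)
    (tabulate (ℤ[t].coeff ∘ shift p {l})) (shifts l (ℤ[t].coeff p))
  rows l p = PW.map (λ h e _ → h e) (tabulate-shifts l (ℤ[t].coeff p) (ℤ[t].coeff ∘ shift p)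
    (λ i → coeff-shift (toℕ (opposite i)) p))

module Coefficients {c ℓ} (R : Semiring c ℓ) where
  open Semiring R using (Carrier; _≈_; 0#) renaming (_+_ to _⊕_; _*_ to _⊗_)
  open Polynomials (Semiring.rawSemiring R)
  private module R = Semiring R

  coeff-+ₚ : ∀ p q i → coeff (p +ₚ q) i ≈ coeff p i ⊕ coeff q i
  coeff-+ₚ []      q       i       = R.sym (R.+-identityˡ _)
  coeff-+ₚ (a ∷ p) []      i       = R.sym (R.+-identityʳ _)
  coeff-+ₚ (a ∷ p) (b ∷ q) zero    = R.refl
  coeff-+ₚ (a ∷ p) (b ∷ q) (suc i) = coeff-+ₚ p q i

  coeff-map-* : ∀ a q i → coeff (map (a ⊗_) q) i ≈ a ⊗ coeff q i
  coeff-map-* a []      i       = R.sym (R.zeroʳ a)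
  coeff-map-* a (b ∷ q) zero    = R.refl
  coeff-map-* a (b ∷ q) (suc i) = coeff-map-* a q i

  coeff-∷-*ₚ : ∀ a p q i → coeff ((a ∷ p) *ₚ q) i ≈ a ⊗ coeff q i ⊕ coeff (0# ∷ (p *ₚ q)) i
  coeff-∷-*ₚ a p q i = R.trans (coeff-+ₚ (map (a ⊗_) q) (0# ∷ (p *ₚ q)) i) (R.+-congʳ (coeff-map-* a q i))

open Coefficients ℤ.+-*-semiring

coeff-monomial-≡ : ∀ k a → ℤ[t].coeff (ℤ[t].monomial k a) k ≡ a
coeff-monomial-≡ zero    a = refl
coeff-monomial-≡ (suc k) a = coeff-monomial-≡ k a

coeff-monomial-≢ : ∀ {k i} a → k ≢ i → ℤ[t].coeff (ℤ[t].monomial k a) i ≡ 0ℤ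
coeff-monomial-≢ {zero}  {zero}  a k≢i = contradiction refl k≢i
coeff-monomial-≢ {zero}  {suc i} a k≢i = refl
coeff-monomial-≢ {suc k} {zero}  a k≢i = refl
coeff-monomial-≢ {suc k} {suc i} a k≢i = coeff-monomial-≢ a (k≢i ∘ cong suc)

coeff-trinomial : ∀ n a b i → ℤ[t].coeff (trinomial n a b) i ≡
  ℤ[t].coeff (ℤ[t].monomial n 1ℤ) i ℤ.+ ℤ[t].coeff (ℤ[t].monomial 1 a) i ℤ.+ ℤ[t].coeff (ℤ[t].monomial 0 b) i
coeff-trinomial n a b i = trans (coeff-+ₚ (monomial n 1ℤ +ₚ monomial 1 a) (monomial 0 b) i)
  (cong (λ x → x ℤ.+ coeff (monomial 0 b) i) (coeff-+ₚ (monomial n 1ℤ) (monomial 1 a) i))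
  where open ℤ[t]

module _ {n : ℕ} (1<n : 1 < n) (a b : ℤ) where

  coeff-trinomial-0 : ℤ[t].coeff (trinomial n a b) 0 ≡ b
  coeff-trinomial-0 = trans (coeff-trinomial n a b 0)
    (trans (cong (λ x → x ℤ.+ 0ℤ ℤ.+ b) (coeff-monomial-≢ 1ℤ (<⇒≢ (<-trans 0<1+n 1<n) ∘ sym))) (ℤ.+-identityˡ b))

  coeff-trinomial-1 : ℤ[t].coeff (trinomial n a b) 1 ≡ a
  coeff-trinomial-1 = trans (coeff-trinomial n a b 1)
    (trans (cong (λ x → x ℤ.+ a ℤ.+ 0ℤ) (coeff-monomial-≢ 1ℤ (<⇒≢ 1<n ∘ sym)))
      (trans (ℤ.+-identityʳ _) (ℤ.+-identityˡ a)))

  coeff-trinomial-n : ℤ[t].coeff (trinomial n a b) n ≡ 1ℤ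
  coeff-trinomial-n = trans (coeff-trinomial n a b n)
    (cong₂ ℤ._+_ (cong₂ ℤ._+_ (coeff-monomial-≡ n 1ℤ) (coeff-monomial-≢ a (<⇒≢ 1<n)))
      (coeff-monomial-≢ b (<⇒≢ (<-trans 0<1+n 1<n))))

  coeff-trinomial-else : ∀ i → 1 < i → i ≢ n → ℤ[t].coeff (trinomial n a b) i ≡ 0ℤ
  coeff-trinomial-else i 1<i i≢n = trans (coeff-trinomial n a b i)
    (cong₂ ℤ._+_ (cong₂ ℤ._+_ (coeff-monomial-≢ 1ℤ (i≢n ∘ sym)) (coeff-monomial-≢ a (<⇒≢ 1<i)))
      (coeff-monomial-≢ b (<⇒≢ (<-trans 0<1+n 1<i))))

coeff-beyond : ∀ p i → length p ≤ i → ℤ[t].coeff p i ≡ 0ℤ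
coeff-beyond []      i       _         = refl
coeff-beyond (_ ∷ p) (suc i) (s≤s p≤i) = coeff-beyond p i p≤i

coeff-applyUpTo : ∀ g k i → i < k → ℤ[t].coeff (applyUpTo g k) i ≡ g i
coeff-applyUpTo g (suc k) zero    _         = refl
coeff-applyUpTo g (suc k) (suc i) (s≤s i<k) = coeff-applyUpTo (g ∘ suc) k i i<k

coeff-derivative : ∀ f i → ℤ[t].coeff (derivative f) i ≡ + suc i ℤ.* ℤ[t].coeff f (suc i)
coeff-derivative f i with i ℕ.<? ℕ.pred (length f)
... | yes i<l = coeff-applyUpTo _ _ i i<l
... | no  i≮l = trans
  (coeff-beyond (derivative f) i (subst (_≤ i) (sym (List.length-applyUpTo _ (ℕ.pred (length f)))) (≮⇒≥ i≮l)))
  (sym (trans (cong (λ x → + suc i ℤ.* x) (coeff-beyond f (suc i) (pred≤⇒≤suc (length f) (≮⇒≥ i≮l)))) (ℤ.*-zeroʳ (+ suc i))))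
  where
  pred≤⇒≤suc : ∀ l → ℕ.pred l ≤ i → l ≤ suc i
  pred≤⇒≤suc zero    _ = z≤n
  pred≤⇒≤suc (suc l) h = s≤s h

^-NonZero : ∀ i .{{_ : ℤ.NonZero i}} k → ℤ.NonZero (i ℤ.^ k)
^-NonZero i zero    = _
^-NonZero i (suc k) = ℤ.i*j≢0 i (i ℤ.^ k) {{it}} {{^-NonZero i k}}

-- Among the columns present, the first row has its only entry in the leading one: the coefficients
-- of `u` below `d` vanish and those above `d` are shifted out of range. The shifts are peeled off
-- one after another.
rowsDet-shifts-below : ∀ k d {u} rs → (∀ e → e < d → u e ≡ 0ℤ) →
  rowsDet (k + d) (shifts k u ++ rs) ≡ u d ℤ.^ k ℤ.* rowsDet d rs
rowsDet-shifts-below zero    d     rs h = sym (ℤ.*-identityˡ _)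
rowsDet-shifts-below (suc k) d {u} rs h = trans
  (rowsDet-head (k + d) {shiftRow k u} (shifts k u ++ rs) (λ e → shiftRow-vanishing k e))
  (trans (cong₂ ℤ._*_ (shiftRow-at k u d) (rowsDet-shifts-below k d rs h)) (sym (ℤ.*-assoc (u d) (u d ℤ.^ k) _)))
  where
  shiftRow-vanishing : ∀ k e → e < k + d → shiftRow k u e ≡ 0ℤ
  shiftRow-vanishing zero    e       e<d         = h e e<d
  shiftRow-vanishing (suc k) zero    _           = refl
  shiftRow-vanishing (suc k) (suc e) (s≤s e<k+d) = shiftRow-vanishing k e e<k+d

rowsDet-triangle : ∀ k u → rowsDet k (shifts k u) ≡ u 0 ℤ.^ k
rowsDet-triangle k u = trans
  (cong₂ rowsDet (sym (+-identityʳ k)) (sym (List.++-identityʳ (shifts k u))))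
  (trans (rowsDet-shifts-below k 0 {u} [] (λ _ ())) (ℤ.*-identityʳ _))

-- In the column of degree k + 1 only the first row and the last have an entry, so the expansion has
-- two terms. The minor belonging to `h` is triangular with diagonal `l 0`.
rowsDet-linear-last : ∀ {l} → (∀ i → 1 < i → l i ≡ 0ℤ) → ∀ h k →
  rowsDet (suc (suc k)) (shifts (suc k) l ++ h ∷ []) ≡
  l 1 ℤ.* rowsDet (suc k) (shifts k l ++ h ∷ []) ℤ.- -1ℤ ℤ.^ k ℤ.* (h (suc k) ℤ.* l 0 ℤ.^ suc k)
rowsDet-linear-last {l} l-linear h k = cong₂ (λ x y → x ℤ.* rowsDet (suc k) (shifts k l ++ h ∷ []) ℤ.- y)
  (trans (cong (shiftRow k l) (+-comm 1 k)) (shiftRow-at k l 1))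
  (begin
    expand (suc k) (shiftRow k l ∷ []) (shifts k l ++ h ∷ [])
      ≡⟨ expand-single (suc k) (shiftRow k l ∷ []) h (shifts-above k l-linear (≤-reflexive (+-comm k 1))) [] ⟩
    -1ℤ ℤ.^ length (shifts k l) ℤ.* (h (suc k) ℤ.* rowsDet (suc k) (shiftRow k l ∷ shifts k l ++ []))
      ≡⟨ cong₂ (λ x y → -1ℤ ℤ.^ x ℤ.* (h (suc k) ℤ.* rowsDet (suc k) (shiftRow k l ∷ y))) (length-shifts k l) (List.++-identityʳ (shifts k l)) ⟩
    -1ℤ ℤ.^ k ℤ.* (h (suc k) ℤ.* rowsDet (suc k) (shifts (suc k) l))
      ≡⟨ cong (λ x → -1ℤ ℤ.^ k ℤ.* (h (suc k) ℤ.* x)) (rowsDet-triangle (suc k) l) ⟩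
    -1ℤ ℤ.^ k ℤ.* (h (suc k) ℤ.* l 0 ℤ.^ suc k) ∎)
  where open ≡-Reasoning

-- n = e + 1 with e even; the identity n f - t f′ = l reduces the Sylvester
-- determinant to the rows t^(e-1) l, …, l, t^e f′, …, f′.
module TrinomialResultant (e : ℕ) (1<e : 1 < e) (even : -1ℤ ℤ.^ e ≡ 1ℤ) (a b : ℤ) where

  private
    n : ℕ
    n = suc e

    1<n : 1 < n
    1<n = m<n⇒m<1+n 1<e

    f f′ l : Row
    f  = ℤ[t].coeff (trinomial n a b)
    f′ = ℤ[t].coeff (derivative (trinomial n a b))
    l i = (+ n ℤ.- + i) ℤ.* f i

    l-linear : ∀ i → 1 < i → l i ≡ 0ℤ
    l-linear i 1<i with i ℕ.≟ n
    ... | yes refl = cong (ℤ._* f n) (ℤ.+-inverseʳ (+ n))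
    ... | no i≢n   = trans (cong (λ x → (+ n ℤ.- + i) ℤ.* x) (coeff-trinomial-else 1<n a b i 1<i i≢n)) (ℤ.*-zeroʳ (+ n ℤ.- + i))

    l-0 : l 0 ≡ + n ℤ.* b
    l-0 = cong₂ ℤ._*_ (ℤ.+-identityʳ (+ n)) (coeff-trinomial-0 1<n a b)

    l-1 : l 1 ≡ + e ℤ.* a
    l-1 = cong₂ ℤ._*_ (cancel (+ e)) (coeff-trinomial-1 1<n a b)
      where
      cancel : ∀ x → (1ℤ ℤ.+ x) ℤ.- 1ℤ ≡ x
      cancel = ℤ-solve

    f′-0 : f′ 0 ≡ a
    f′-0 = trans (coeff-derivative (trinomial n a b) 0)
      (trans (ℤ.*-identityˡ (f 1)) (coeff-trinomial-1 1<n a b))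

    f′-e : f′ e ≡ + n
    f′-e = trans (coeff-derivative (trinomial n a b) e)
      (trans (cong (λ x → + n ℤ.* x) (coeff-trinomial-n 1<n a b)) (ℤ.*-identityʳ (+ n)))

    f′-else : ∀ i → 0 < i → i ≢ e → f′ i ≡ 0ℤ
    f′-else i 0<i i≢e = trans (coeff-derivative (trinomial n a b) i)
      (trans (cong (λ x → + suc i ℤ.* x) (coeff-trinomial-else 1<n a b (suc i) (s≤s 0<i) (i≢e ∘ ℕ.suc-injective)))
        (ℤ.*-zeroʳ (+ suc i)))

    f′-above : ∀ i → e < i → f′ i ≡ 0ℤ
    f′-above i e<i = f′-else i (<-trans 0<1+n (<-trans 1<e e<i)) (<⇒≢ e<i ∘ sym)

    l-combination : ∀ s i → shiftRow s l i ≡ + n ℤ.* shiftRow s f i ℤ.+ 1ℤ ℤ.* (-1ℤ ℤ.* shiftRow (suc s) f′ i ℤ.+ 1ℤ ℤ.* 0ℤ)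
    l-combination zero zero = identity (+ n) (f 0)
      where
      identity : ∀ x y → (x ℤ.- 0ℤ) ℤ.* y ≡ x ℤ.* y ℤ.+ 1ℤ ℤ.* (-1ℤ ℤ.* 0ℤ ℤ.+ 1ℤ ℤ.* 0ℤ)
      identity = ℤ-solve
    l-combination zero (suc i) = trans (identity (+ n) (+ suc i) (f (suc i)))
      (cong (λ x → + n ℤ.* f (suc i) ℤ.+ 1ℤ ℤ.* (-1ℤ ℤ.* x ℤ.+ 1ℤ ℤ.* 0ℤ)) (sym (coeff-derivative (trinomial n a b) i)))
      where
      identity : ∀ x y z → (x ℤ.- y) ℤ.* z ≡ x ℤ.* z ℤ.+ 1ℤ ℤ.* (-1ℤ ℤ.* (y ℤ.* z) ℤ.+ 1ℤ ℤ.* 0ℤ)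
      identity = ℤ-solve
    l-combination (suc s) zero = identity (+ n)
      where
      identity : ∀ x → 0ℤ ≡ x ℤ.* 0ℤ ℤ.+ 1ℤ ℤ.* (-1ℤ ℤ.* 0ℤ ℤ.+ 1ℤ ℤ.* 0ℤ)
      identity = ℤ-solve
    l-combination (suc s) (suc i) = l-combination s i

    reduced : ∀ k → k ≤ e → Pointwise (λ w u → w ≈ + n * u mod shifts n f′) (shifts k l) (shifts k f)
    reduced zero    _   = []
    reduced (suc k) k<e = by (span-add -1ℤ (∈-shifts f′ (s≤s k<e)) (span-zero (λ _ → refl)) (λ _ → refl)) (l-combination k)
      ∷ reduced k (<⇒≤ k<e)

    -- The shifts of `l` have degree at most e, so the leading column has a single entry, the
    -- leading coefficient `n` of the highest shift of `f′`. It stands below `e` rows, and (-1) ^ e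
    -- = 1.
    peel : ∀ s → rowsDet (e + suc s) (shifts e l ++ shifts (suc s) f′) ≡
      (+ n) ℤ.^ s ℤ.* rowsDet (e + 1) (shifts e l ++ shifts 1 f′)
    peel zero    = sym (ℤ.*-identityˡ _)
    peel (suc s) = begin
      rowsDet (e + suc (suc s)) (shifts e l ++ shiftRow (suc s) f′ ∷ shifts (suc s) f′)
        ≡⟨ cong (λ d → rowsDet d (shifts e l ++ shiftRow (suc s) f′ ∷ shifts (suc s) f′)) (+-suc e (suc s)) ⟩
      rowsDet (suc (e + suc s)) (shifts e l ++ shiftRow (suc s) f′ ∷ shifts (suc s) f′)
        ≡⟨ rowsDet-single (e + suc s) (shiftRow (suc s) f′)
             (shifts-above e l-linear (+-monoʳ-≤ e (s≤s z≤n)))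
             (shifts-above (suc s) f′-above (≤-reflexive (+-comm (suc s) e))) ⟩
      -1ℤ ℤ.^ length (shifts e l) ℤ.* (shiftRow (suc s) f′ (e + suc s) ℤ.* rowsDet (e + suc s) (shifts e l ++ shifts (suc s) f′))
        ≡⟨ cong₂ (λ x y → -1ℤ ℤ.^ x ℤ.* (y ℤ.* rowsDet (e + suc s) (shifts e l ++ shifts (suc s) f′)))
             (length-shifts e l) (trans (cong (shiftRow (suc s) f′) (+-comm e (suc s))) (trans (shiftRow-at (suc s) f′ e) f′-e)) ⟩
      -1ℤ ℤ.^ e ℤ.* (+ n ℤ.* rowsDet (e + suc s) (shifts e l ++ shifts (suc s) f′))
        ≡⟨ cong₂ (λ x y → x ℤ.* (+ n ℤ.* y)) even (peel s) ⟩
      1ℤ ℤ.* (+ n ℤ.* ((+ n) ℤ.^ s ℤ.* rowsDet (e + 1) (shifts e l ++ shifts 1 f′)))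
        ≡⟨ trans (ℤ.*-identityˡ _) (sym (ℤ.*-assoc (+ n) ((+ n) ℤ.^ s) _)) ⟩
      (+ n) ℤ.^ suc s ℤ.* rowsDet (e + 1) (shifts e l ++ shifts 1 f′) ∎
      where open ≡-Reasoning

    -- In degrees 1 to e - 1 the coefficients of `f′` vanish, which kills the second term of
    -- `rowsDet-linear-last`. That term survives only at the last step, in `core-e`, and there it
    -- gives the power of b.
    core : ∀ k → k < e → rowsDet (suc k) (shifts k l ++ f′ ∷ []) ≡ l 1 ℤ.^ k ℤ.* a
    core zero    _   = trans (identity (f′ 0)) (cong (λ x → 1ℤ ℤ.* x) f′-0)
      where
      identity : ∀ x → x ℤ.* 1ℤ ℤ.- 0ℤ ≡ 1ℤ ℤ.* x
      identity = ℤ-solve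
    core (suc k) k<e = trans (rowsDet-linear-last l-linear f′ k)
      (trans (cong₂ (λ x y → l 1 ℤ.* x ℤ.- -1ℤ ℤ.^ k ℤ.* (y ℤ.* l 0 ℤ.^ suc k))
          (core k (<⇒≤ k<e)) (f′-else (suc k) 0<1+n (<⇒≢ k<e)))
        (identity (l 1) (l 1 ℤ.^ k) a (-1ℤ ℤ.^ k) (l 0 ℤ.^ suc k)))
      where
      identity : ∀ x y z s w → x ℤ.* (y ℤ.* z) ℤ.- s ℤ.* (0ℤ ℤ.* w) ≡ x ℤ.* y ℤ.* z
      identity = ℤ-solve

    core-e : rowsDet (suc e) (shifts e l ++ f′ ∷ []) ≡ l 1 ℤ.^ e ℤ.* a ℤ.+ + n ℤ.* l 0 ℤ.^ e
    core-e = last-step e refl 1<e even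
      where
      identity : ∀ x y z s w v → x ℤ.* (y ℤ.* z) ℤ.- s ℤ.* (w ℤ.* v) ≡ x ℤ.* y ℤ.* z ℤ.+ -1ℤ ℤ.* s ℤ.* w ℤ.* v
      identity = ℤ-solve
      last-step : ∀ k → k ≡ e → 1 < k → -1ℤ ℤ.^ k ≡ 1ℤ →
        rowsDet (suc k) (shifts k l ++ f′ ∷ []) ≡ l 1 ℤ.^ k ℤ.* a ℤ.+ + n ℤ.* l 0 ℤ.^ k
      last-step (suc k) 1+k≡e _ even = begin
        rowsDet (suc (suc k)) (shifts (suc k) l ++ f′ ∷ [])
          ≡⟨ rowsDet-linear-last l-linear f′ k ⟩
        l 1 ℤ.* rowsDet (suc k) (shifts k l ++ f′ ∷ []) ℤ.- -1ℤ ℤ.^ k ℤ.* (f′ (suc k) ℤ.* l 0 ℤ.^ suc k)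
          ≡⟨ cong₂ (λ x y → l 1 ℤ.* x ℤ.- -1ℤ ℤ.^ k ℤ.* (y ℤ.* l 0 ℤ.^ suc k)) (core k (≤-reflexive 1+k≡e)) (trans (cong f′ 1+k≡e) f′-e) ⟩
        l 1 ℤ.* (l 1 ℤ.^ k ℤ.* a) ℤ.- -1ℤ ℤ.^ k ℤ.* (+ n ℤ.* l 0 ℤ.^ suc k)
          ≡⟨ identity (l 1) (l 1 ℤ.^ k) a (-1ℤ ℤ.^ k) (+ n) (l 0 ℤ.^ suc k) ⟩
        l 1 ℤ.^ suc k ℤ.* a ℤ.+ -1ℤ ℤ.^ suc k ℤ.* + n ℤ.* l 0 ℤ.^ suc k
          ≡⟨ cong (λ x → l 1 ℤ.^ suc k ℤ.* a ℤ.+ x ℤ.* l 0 ℤ.^ suc k) (trans (cong (λ z → z ℤ.* + n) even) (ℤ.*-identityˡ (+ n))) ⟩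
        l 1 ℤ.^ suc k ℤ.* a ℤ.+ + n ℤ.* l 0 ℤ.^ suc k ∎
        where open ≡-Reasoning

  resultant-trinomial : resultant n e (trinomial n a b) (derivative (trinomial n a b)) ≡
    (+ e ℤ.* a) ℤ.^ e ℤ.* a ℤ.+ + n ℤ.* (+ n ℤ.* b) ℤ.^ e
  -- Replacing `e` rows `f` by n f - t f′ multiplies the determinant by n ^ e; peeling the shifts of
  -- `f′` produces the same power on the other side.
  resultant-trinomial = ℤ.*-cancelˡ-≡ ((+ n) ℤ.^ e) _ _ {{^-NonZero (+ n) e}} (begin
    (+ n) ℤ.^ e ℤ.* resultant n e (trinomial n a b) (derivative (trinomial n a b))
      ≡⟨ cong (λ x → (+ n) ℤ.^ e ℤ.* x) (resultant-rows n e (trinomial n a b) (derivative (trinomial n a b))) ⟩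
    (+ n) ℤ.^ e ℤ.* rowsDet (e + n) (shifts e f ++ shifts n f′)
      ≡⟨ cong (λ x → (+ n) ℤ.^ x ℤ.* rowsDet (e + n) (shifts e f ++ shifts n f′)) (length-shifts e f) ⟨
    (+ n) ℤ.^ length (shifts e f) ℤ.* rowsDet (e + n) (shifts e f ++ shifts n f′)
      ≡⟨ rowsDet-reduce (e + n) (+ n) [] (shifts n f′) (reduced e ≤-refl) ⟨
    rowsDet (e + n) (shifts e l ++ shifts n f′)
      ≡⟨ peel e ⟩
    (+ n) ℤ.^ e ℤ.* rowsDet (e + 1) (shifts e l ++ f′ ∷ [])
      ≡⟨ cong (λ d → (+ n) ℤ.^ e ℤ.* rowsDet d (shifts e l ++ f′ ∷ [])) (+-comm e 1) ⟩
    (+ n) ℤ.^ e ℤ.* rowsDet (suc e) (shifts e l ++ f′ ∷ [])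
      ≡⟨ cong (λ x → (+ n) ℤ.^ e ℤ.* x) (trans core-e (cong₂ (λ x y → x ℤ.^ e ℤ.* a ℤ.+ + n ℤ.* y ℤ.^ e) l-1 l-0)) ⟩
    (+ n) ℤ.^ e ℤ.* ((+ e ℤ.* a) ℤ.^ e ℤ.* a ℤ.+ + n ℤ.* (+ n ℤ.* b) ℤ.^ e) ∎)
    where open ≡-Reasoning

^-distribʳ-* : ∀ i j k → (i ℤ.* j) ℤ.^ k ≡ i ℤ.^ k ℤ.* j ℤ.^ k
^-distribʳ-* i j zero    = refl
^-distribʳ-* i j (suc k) = trans (cong (λ x → i ℤ.* j ℤ.* x) (^-distribʳ-* i j k)) (interchange i j (i ℤ.^ k) (j ℤ.^ k))
  where
  interchange : ∀ i j x y → i ℤ.* j ℤ.* (x ℤ.* y) ≡ i ℤ.* x ℤ.* (j ℤ.* y)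
  interchange = ℤ-solve

-1^even : ∀ k → -1ℤ ℤ.^ (2 * k) ≡ 1ℤ
-1^even k = trans (sym (ℤ.^-*-assoc -1ℤ 2 k)) (ℤ.^-zeroˡ k)

-- For n = 4 q + 1 the exponent n (n - 1) / 2 is the even number 2 n q, so the discriminant is the
-- resultant itself.
discriminant-trinomial : ∀ q → 0 < q → ∀ a b → let e = 4 * q ; n = suc e in
  discriminant n (trinomial n a b) ≡ (+ n) ℤ.^ n ℤ.* b ℤ.^ e ℤ.+ (+ e) ℤ.^ e ℤ.* a ℤ.^ n
discriminant-trinomial q 0<q a b = begin
  -1ℤ ℤ.^ (suc (4 * q) * (4 * q) / 2) ℤ.* res
    ≡⟨ cong (λ k → -1ℤ ℤ.^ k ℤ.* res) (trans (cong (_/ 2) (halve q)) (m*n/n≡m (2 * (suc (4 * q) * q)) 2)) ⟩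
  -1ℤ ℤ.^ (2 * (suc (4 * q) * q)) ℤ.* res
    ≡⟨ cong₂ ℤ._*_ (-1^even (suc (4 * q) * q))
         (TrinomialResultant.resultant-trinomial (4 * q) 1<e (trans (cong (-1ℤ ℤ.^_) (double q)) (-1^even (2 * q))) a b) ⟩
  1ℤ ℤ.* ((+ e ℤ.* a) ℤ.^ e ℤ.* a ℤ.+ + n ℤ.* (+ n ℤ.* b) ℤ.^ e)
    ≡⟨ cong₂ (λ x y → 1ℤ ℤ.* (x ℤ.* a ℤ.+ + n ℤ.* y)) (^-distribʳ-* (+ e) a e) (^-distribʳ-* (+ n) b e) ⟩
  1ℤ ℤ.* ((+ e) ℤ.^ e ℤ.* a ℤ.^ e ℤ.* a ℤ.+ + n ℤ.* ((+ n) ℤ.^ e ℤ.* b ℤ.^ e))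
    ≡⟨ rearrange ((+ e) ℤ.^ e) (a ℤ.^ e) a (+ n) ((+ n) ℤ.^ e) (b ℤ.^ e) ⟩
  (+ n) ℤ.^ n ℤ.* b ℤ.^ e ℤ.+ (+ e) ℤ.^ e ℤ.* a ℤ.^ n ∎
  where
  open ≡-Reasoning
  e n : ℕ
  e = 4 * q
  n = suc e
  res : ℤ
  res = resultant n e (trinomial n a b) (derivative (trinomial n a b))
  halve : ∀ q → suc (4 * q) * (4 * q) ≡ 2 * (suc (4 * q) * q) * 2
  halve = ℕ-solve
  double : ∀ q → 4 * q ≡ 2 * (2 * q)
  double = ℕ-solve
  1<e : 1 < e
  1<e = ≤-trans (s≤s (s≤s z≤n)) (*-monoʳ-≤ 4 0<q)
  rearrange : ∀ E x a n N y → 1ℤ ℤ.* (E ℤ.* x ℤ.* a ℤ.+ n ℤ.* (N ℤ.* y)) ≡ (n ℤ.* N) ℤ.* y ℤ.+ E ℤ.* (a ℤ.* x)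
  rearrange = ℤ-solve

-- Norms modulo a divisor of a

shiftRow-0 : ∀ s e → shiftRow s (λ _ → 0ℤ) e ≡ 0ℤ
shiftRow-0 zero    e       = refl
shiftRow-0 (suc s) zero    = refl
shiftRow-0 (suc s) (suc e) = shiftRow-0 s e

shiftRow-cong : ∀ {m} s {u v} → (∀ e → u e ≋ v e [ m ]) → ∀ e → shiftRow s u e ≋ shiftRow s v e [ m ]
shiftRow-cong zero    h e       = h e
shiftRow-cong (suc s) h zero    = ≋-reflexive refl
shiftRow-cong (suc s) h (suc e) = shiftRow-cong s h e

shifts-cong : ∀ {m} d k {u v} → (∀ e → u e ≋ v e [ m ]) →
  Pointwise (λ u v → ∀ e → e < d → u e ≋ v e [ m ]) (shifts k u) (shifts k v)
shifts-cong d zero    h = []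
shifts-cong d (suc k) h = (λ e _ → shiftRow-cong k h e) ∷ shifts-cong d k h

coeff-∷-*ₚ-shift : ∀ a p q i → ℤ[t].coeff ((a ∷ p) ℤ[t].*ₚ q) i ≡
  a ℤ.* ℤ[t].coeff q i ℤ.+ shiftRow 1 (ℤ[t].coeff (p ℤ[t].*ₚ q)) i
coeff-∷-*ₚ-shift a p q i = trans (coeff-∷-*ₚ a p q i)
  (cong (λ x → a ℤ.* ℤ[t].coeff q i ℤ.+ x) (coeff-shift 1 (p ℤ[t].*ₚ q) i))

shiftRow-combine : ∀ s a u v e →
  shiftRow s (λ i → a ℤ.* u i ℤ.+ shiftRow 1 v i) e ≡ a ℤ.* shiftRow s u e ℤ.+ 1ℤ ℤ.* shiftRow (suc s) v e
shiftRow-combine zero    a u v e       = cong (λ x → a ℤ.* u e ℤ.+ x) (sym (ℤ.*-identityˡ _))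
shiftRow-combine (suc s) a u v zero    = sym (trans (ℤ.+-identityʳ _) (ℤ.*-zeroʳ a))
shiftRow-combine (suc s) a u v (suc e) = shiftRow-combine s a u v e

shiftRow-≗ : ∀ s {u v : Row} → u ≗ v → ∀ e → shiftRow s u e ≡ shiftRow s v e
shiftRow-≗ zero    h e       = h e
shiftRow-≗ (suc s) h zero    = refl
shiftRow-≗ (suc s) h (suc e) = shiftRow-≗ s h e

span-product : ∀ p q n s → s + length p ≤ n → Span (shifts n (ℤ[t].coeff q)) (shiftRow s (ℤ[t].coeff (p ℤ[t].*ₚ q)))
span-product []      q n s _ = span-zero (shiftRow-0 s)
span-product (a ∷ p) q n s s+l≤n = span-add a (∈-shifts _ (≤-trans (+-monoʳ-≤ 1 (m≤m+n s (length p))) s+l≤n′))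
  (span-product p q n (suc s) s+l≤n′)
  (λ e → trans (shiftRow-≗ s (coeff-∷-*ₚ-shift a p q) e) (shiftRow-combine s a (ℤ[t].coeff q) (ℤ[t].coeff (p ℤ[t].*ₚ q)) e))
  where
  s+l≤n′ : suc s + length p ≤ n
  s+l≤n′ = subst (_≤ n) (+-suc s (length p)) s+l≤n

-- The norm of the class of t in ℤ[t]/(q), up to sign the constant term of q,
-- read off the resultant of q and t ^ n, where t ^ n ≡ - b modulo (q, m).
module NormCongruence {e k : ℕ} (1<e : 1 < e) (even : -1ℤ ℤ.^ e ≡ 1ℤ) {m a b : ℤ} (m∣a : m ℤ∣.∣ a)
  (p q : ℤ[t].Poly) (product : p ℤ[t].*ₚ q ℤ[t].≈ₚ trinomial (suc e) a b)
  (deg-q : ∀ i → k < i → ℤ[t].coeff q i ≡ 0ℤ) (deg-p : k + length p ≤ suc (suc e)) where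

  private
    n : ℕ
    n = suc e

    1<n : 1 < n
    1<n = m<n⇒m<1+n 1<e

    f g top rest constant : Row
    f   = ℤ[t].coeff (trinomial n a b)
    g   = ℤ[t].coeff q
    top = ℤ[t].coeff (ℤ[t].monomial n 1ℤ)
    rest i = top i ℤ.- f i
    constant = ℤ[t].coeff (ℤ[t].monomial 0 (ℤ.- b))

    top-rest : ∀ s i → shiftRow s top i ≡ 1ℤ ℤ.* shiftRow s rest i ℤ.+ 1ℤ ℤ.* shiftRow s (ℤ[t].coeff (p ℤ[t].*ₚ q)) i
    top-rest zero i = trans (identity (top i) (f i)) (cong (λ x → 1ℤ ℤ.* rest i ℤ.+ 1ℤ ℤ.* x) (sym (product i)))
      where
      identity : ∀ x y → x ≡ 1ℤ ℤ.* (x ℤ.- y) ℤ.+ 1ℤ ℤ.* y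
      identity = ℤ-solve
    top-rest (suc s) zero    = refl
    top-rest (suc s) (suc i) = top-rest s i

    -- The row t ^ l t ^ n is t ^ l `rest` plus t ^ l p q, and the bound on the length of `p` keeps
    -- all multiples t ^ i q involved among the `n` shifts of `q`.
    reduced : ∀ l → l + length p ≤ suc n → Pointwise (λ w u → w ≈ 1ℤ * u mod shifts n g) (shifts l top) (shifts l rest)
    reduced zero    _ = []
    reduced (suc l) (s≤s h) = by (span-product p q n l h) (top-rest l) ∷ reduced l (m≤n⇒m≤1+n h)

    rest≋constant : ∀ i → rest i ≋ constant i [ m ]
    rest≋constant i = ≋-intro (subst (m ℤ∣.∣_) (difference i)
      (ℤ∣.∣m⇒∣-m (ℤ∣.∣m⇒∣m*n (ℤ[t].coeff (ℤ[t].monomial 1 1ℤ) i) m∣a)))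
      where
      monomial-neg : ∀ i → ℤ[t].coeff (ℤ[t].monomial 0 (ℤ.- b)) i ≡ ℤ.- ℤ[t].coeff (ℤ[t].monomial 0 b) i
      monomial-neg zero    = refl
      monomial-neg (suc i) = refl
      monomial-scale : ∀ i → ℤ[t].coeff (ℤ[t].monomial 1 a) i ≡ a ℤ.* ℤ[t].coeff (ℤ[t].monomial 1 1ℤ) i
      monomial-scale zero          = sym (ℤ.*-zeroʳ a)
      monomial-scale (suc zero)    = sym (ℤ.*-identityʳ a)
      monomial-scale (suc (suc i)) = sym (ℤ.*-zeroʳ a)
      identity : ∀ x y z → ℤ.- y ≡ (x ℤ.- (x ℤ.+ y ℤ.+ z)) ℤ.- (ℤ.- z)
      identity = ℤ-solve
      difference : ∀ i → ℤ.- (a ℤ.* ℤ[t].coeff (ℤ[t].monomial 1 1ℤ) i) ≡ rest i ℤ.- constant i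
      difference i = begin
        ℤ.- (a ℤ.* ℤ[t].coeff (ℤ[t].monomial 1 1ℤ) i)
          ≡⟨ cong ℤ.-_ (monomial-scale i) ⟨
        ℤ.- ℤ[t].coeff (ℤ[t].monomial 1 a) i
          ≡⟨ identity (top i) (ℤ[t].coeff (ℤ[t].monomial 1 a) i) (ℤ[t].coeff (ℤ[t].monomial 0 b) i) ⟩
        (top i ℤ.- (top i ℤ.+ ℤ[t].coeff (ℤ[t].monomial 1 a) i ℤ.+ ℤ[t].coeff (ℤ[t].monomial 0 b) i)) ℤ.- (ℤ.- ℤ[t].coeff (ℤ[t].monomial 0 b) i)
          ≡⟨ cong₂ (λ x y → (top i ℤ.- x) ℤ.- y) (coeff-trinomial n a b i) (monomial-neg i) ⟨
        rest i ℤ.- constant i ∎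
        where open ≡-Reasoning

    constant-above : ∀ i → 0 < i → constant i ≡ 0ℤ
    constant-above (suc i) _ = refl

    peel : ∀ s → rowsDet (k + s) (shifts k constant ++ shifts s g) ≡ (-1ℤ ℤ.^ k ℤ.* g k) ℤ.^ s ℤ.* (ℤ.- b) ℤ.^ k
    peel zero = trans (cong₂ rowsDet (+-identityʳ k) (List.++-identityʳ (shifts k constant)))
      (trans (rowsDet-triangle k constant) (sym (ℤ.*-identityˡ _)))
    peel (suc s) = begin
      rowsDet (k + suc s) (shifts k constant ++ shifts (suc s) g)
        ≡⟨ cong (λ d → rowsDet d (shifts k constant ++ shifts (suc s) g)) (+-suc k s) ⟩
      rowsDet (suc (k + s)) (shifts k constant ++ shiftRow s g ∷ shifts s g)
        ≡⟨ rowsDet-single (k + s) (shiftRow s g) (shifts-above k constant-above (+-monoʳ-≤ k z≤n))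
             (shifts-above s deg-q (≤-reflexive (+-comm s k))) ⟩
      -1ℤ ℤ.^ length (shifts k constant) ℤ.* (shiftRow s g (k + s) ℤ.* rowsDet (k + s) (shifts k constant ++ shifts s g))
        ≡⟨ cong₂ (λ x y → -1ℤ ℤ.^ x ℤ.* (y ℤ.* rowsDet (k + s) (shifts k constant ++ shifts s g)))
             (length-shifts k constant) (trans (cong (shiftRow s g) (+-comm k s)) (shiftRow-at s g k)) ⟩
      -1ℤ ℤ.^ k ℤ.* (g k ℤ.* rowsDet (k + s) (shifts k constant ++ shifts s g))
        ≡⟨ cong (λ x → -1ℤ ℤ.^ k ℤ.* (g k ℤ.* x)) (peel s) ⟩
      -1ℤ ℤ.^ k ℤ.* (g k ℤ.* ((-1ℤ ℤ.^ k ℤ.* g k) ℤ.^ s ℤ.* (ℤ.- b) ℤ.^ k))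
        ≡⟨ assoc (-1ℤ ℤ.^ k) (g k) ((-1ℤ ℤ.^ k ℤ.* g k) ℤ.^ s) ((ℤ.- b) ℤ.^ k) ⟩
      (-1ℤ ℤ.^ k ℤ.* g k) ℤ.^ suc s ℤ.* (ℤ.- b) ℤ.^ k ∎
      where
      open ≡-Reasoning
      assoc : ∀ x y z w → x ℤ.* (y ℤ.* (z ℤ.* w)) ≡ x ℤ.* y ℤ.* z ℤ.* w
      assoc = ℤ-solve

    -- The signs combine to (-1) ^ (k (n + 1)), which is 1 because n is odd.
    sign-cancel : ∀ x y → (-1ℤ ℤ.^ k ℤ.* x) ℤ.^ n ℤ.* (ℤ.- y) ℤ.^ k ≡ x ℤ.^ n ℤ.* y ℤ.^ k
    sign-cancel x y = begin
      (-1ℤ ℤ.^ k ℤ.* x) ℤ.^ n ℤ.* (ℤ.- y) ℤ.^ k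
        ≡⟨ cong₂ ℤ._*_ (^-distribʳ-* (-1ℤ ℤ.^ k) x n) (trans (cong (ℤ._^ k) (sym (ℤ.-1*i≡-i y))) (^-distribʳ-* -1ℤ y k)) ⟩
      (-1ℤ ℤ.^ k) ℤ.^ n ℤ.* x ℤ.^ n ℤ.* (-1ℤ ℤ.^ k ℤ.* y ℤ.^ k)
        ≡⟨ regroup ((-1ℤ ℤ.^ k) ℤ.^ n) (x ℤ.^ n) (-1ℤ ℤ.^ k) (y ℤ.^ k) ⟩
      ((-1ℤ ℤ.^ k) ℤ.^ n ℤ.* -1ℤ ℤ.^ k) ℤ.* (x ℤ.^ n ℤ.* y ℤ.^ k)
        ≡⟨ cong (λ z → z ℤ.* (x ℤ.^ n ℤ.* y ℤ.^ k)) sign ⟩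
      1ℤ ℤ.* (x ℤ.^ n ℤ.* y ℤ.^ k)
        ≡⟨ ℤ.*-identityˡ _ ⟩
      x ℤ.^ n ℤ.* y ℤ.^ k ∎
      where
      open ≡-Reasoning
      regroup : ∀ x y z w → x ℤ.* y ℤ.* (z ℤ.* w) ≡ (x ℤ.* z) ℤ.* (y ℤ.* w)
      regroup = ℤ-solve
      sign : (-1ℤ ℤ.^ k) ℤ.^ n ℤ.* -1ℤ ℤ.^ k ≡ 1ℤ
      sign = begin
        (-1ℤ ℤ.^ k) ℤ.^ n ℤ.* -1ℤ ℤ.^ k
          ≡⟨ cong (λ x → x ℤ.* -1ℤ ℤ.^ k) (trans (ℤ.^-*-assoc -1ℤ k n) (trans (cong (-1ℤ ℤ.^_) (*-comm k n)) (sym (ℤ.^-*-assoc -1ℤ n k)))) ⟩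
        (-1ℤ ℤ.^ n) ℤ.^ k ℤ.* -1ℤ ℤ.^ k
          ≡⟨ ^-distribʳ-* (-1ℤ ℤ.^ n) -1ℤ k ⟨
        (-1ℤ ℤ.* -1ℤ ℤ.^ e ℤ.* -1ℤ) ℤ.^ k
          ≡⟨ cong (λ x → (-1ℤ ℤ.* x ℤ.* -1ℤ) ℤ.^ k) even ⟩
        1ℤ ℤ.^ k
          ≡⟨ ℤ.^-zeroˡ k ⟩
        1ℤ ∎

  -- The resultant of t ^ n and `q` is evaluated twice. With the rows of t ^ n it is triangular and
  -- equals `g 0 ℤ.^ n`. Reducing t ^ n by multiples of `q` to t ^ n - f, which is the constant - b
  -- modulo `m`, gives the right-hand side through `peel`.
  norm-congruence : g 0 ℤ.^ n ≋ g k ℤ.^ n ℤ.* b ℤ.^ k [ m ]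
  norm-congruence = ≋-trans (≋-reflexive (begin
      g 0 ℤ.^ n
        ≡⟨ rowsDet-triangle n g ⟨
      rowsDet n (shifts n g)
        ≡⟨ trans (cong (λ x → x ℤ.* rowsDet n (shifts n g)) (trans (cong (ℤ._^ k) (coeff-monomial-≡ n 1ℤ)) (ℤ.^-zeroˡ k))) (ℤ.*-identityˡ _) ⟨
      top n ℤ.^ k ℤ.* rowsDet n (shifts n g)
        ≡⟨ rowsDet-shifts-below k n {top} (shifts n g) (λ i i<n → coeff-monomial-≢ 1ℤ (<⇒≢ i<n ∘ sym)) ⟨
      rowsDet (k + n) (shifts k top ++ shifts n g)
        ≡⟨ rowsDet-reduce (k + n) 1ℤ [] (shifts n g) (reduced k deg-p) ⟩
      1ℤ ℤ.^ length (shifts k rest) ℤ.* rowsDet (k + n) (shifts k rest ++ shifts n g)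
        ≡⟨ trans (cong (λ x → x ℤ.* rowsDet (k + n) (shifts k rest ++ shifts n g)) (ℤ.^-zeroˡ (length (shifts k rest)))) (ℤ.*-identityˡ _) ⟩
      rowsDet (k + n) (shifts k rest ++ shifts n g) ∎))
    (≋-trans (rowsDet-cong (k + n) (PW.++⁺ (shifts-cong (k + n) k rest≋constant) (PW.refl (λ {r} _ _ → ≋-reflexive refl) {shifts n g})))
      (≋-reflexive (trans (peel n) (sign-cancel (g k) b))))
    where open ≡-Reasoning

-- Gauss's lemma

open ℤ[t] using (Poly; coeff; _*ₚ_; _≈ₚ_)

Divides : ℕ → Poly → Set
Divides p f = ∀ i → + p ℤ∣.∣ coeff f i

coeff-*ₚ-∷ : ∀ p b q i → coeff (p *ₚ (b ∷ q)) i ≡ b ℤ.* coeff p i ℤ.+ coeff (0ℤ ∷ (p *ₚ q)) i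
coeff-*ₚ-∷ [] b q i = sym (cong₂ ℤ._+_ (ℤ.*-zeroʳ b) (zero-shift i))
  where
  zero-shift : ∀ i → coeff (0ℤ ∷ []) i ≡ 0ℤ
  zero-shift zero    = refl
  zero-shift (suc i) = refl
coeff-*ₚ-∷ (a ∷ p) b q zero    = cong (ℤ._+ 0ℤ) (ℤ.*-comm a b)
coeff-*ₚ-∷ (a ∷ p) b q (suc i) = begin
  coeff ((a ∷ p) *ₚ (b ∷ q)) (suc i)
    ≡⟨ coeff-∷-*ₚ a p (b ∷ q) (suc i) ⟩
  a ℤ.* coeff q i ℤ.+ coeff (p *ₚ (b ∷ q)) i
    ≡⟨ cong (λ x → a ℤ.* coeff q i ℤ.+ x) (coeff-*ₚ-∷ p b q i) ⟩
  a ℤ.* coeff q i ℤ.+ (b ℤ.* coeff p i ℤ.+ coeff (0ℤ ∷ (p *ₚ q)) i)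
    ≡⟨ exchange (a ℤ.* coeff q i) (b ℤ.* coeff p i) _ ⟩
  b ℤ.* coeff p i ℤ.+ (a ℤ.* coeff q i ℤ.+ coeff (0ℤ ∷ (p *ₚ q)) i)
    ≡⟨ cong (λ x → b ℤ.* coeff p i ℤ.+ x) (coeff-∷-*ₚ a p q i) ⟨
  b ℤ.* coeff p i ℤ.+ coeff ((a ∷ p) *ₚ q) i ∎
  where
  open ≡-Reasoning
  exchange : ∀ x y z → x ℤ.+ (y ℤ.+ z) ≡ y ℤ.+ (x ℤ.+ z)
  exchange = ℤ-solve

euclid-ℤ : ∀ {p} → Prime p → ∀ i j → + p ℤ∣.∣ i ℤ.* j → + p ℤ∣.∣ i ⊎ + p ℤ∣.∣ j
euclid-ℤ pr i j p∣ij with euclidsLemma ∣ i ∣ ∣ j ∣ pr (subst (_ ∣_) (ℤ.abs-* i j) (ℤ∣.∣⇒∣ᵤ p∣ij))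
... | inj₁ p∣i = inj₁ (ℤ∣.∣ᵤ⇒∣ p∣i)
... | inj₂ p∣j = inj₂ (ℤ∣.∣ᵤ⇒∣ p∣j)

-- The constant term of the product is `a` times that of `g`, so `p` divides the latter; without it
-- the remaining product is again divisible by `p`.
gauss-unit-head : ∀ {p} → Prime p → ∀ a f g → ¬ (+ p ℤ∣.∣ a) → Divides p ((a ∷ f) *ₚ g) → Divides p g
gauss-unit-head pr a f []      p∤a p∣fg i = ℤ∣.divides 0ℤ refl
gauss-unit-head {p} pr a f (b ∷ g) p∤a p∣fg = λ { zero → p∣b ; (suc i) → gauss-unit-head pr a f g p∤a p∣rest i }
  where
  p∣b : + p ℤ∣.∣ b
  p∣b with euclid-ℤ pr a b (subst (+ p ℤ∣.∣_) (ℤ.+-identityʳ (a ℤ.* b)) (p∣fg 0))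
  ... | inj₁ p∣a = contradiction p∣a p∤a
  ... | inj₂ p∣b = p∣b
  p∣rest : Divides p ((a ∷ f) *ₚ g)
  p∣rest i = ℤ∣.∣m+n∣m⇒∣n (subst (+ p ℤ∣.∣_) (coeff-*ₚ-∷ (a ∷ f) b g (suc i)) (p∣fg (suc i))) (ℤ∣.∣m⇒∣m*n (coeff f i) p∣b)

-- Constant terms of the first factor that `p` divides contribute nothing modulo `p` and are
-- dropped. Either they exhaust the factor, or one prime to `p` is reached and `gauss-unit-head`
-- applies.
gauss-prime : ∀ {p} → Prime p → ∀ f g → Divides p (f *ₚ g) → Divides p f ⊎ Divides p g
gauss-prime pr []      g p∣fg = inj₁ λ i → ℤ∣.divides 0ℤ refl
gauss-prime {p} pr (a ∷ f) g p∣fg with + p ℤ∣.∣? a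
... | no p∤a  = inj₂ (gauss-unit-head pr a f g p∤a p∣fg)
... | yes p∣a with gauss-prime pr f g (λ i → ℤ∣.∣m+n∣m⇒∣n
                     (subst (+ p ℤ∣.∣_) (coeff-∷-*ₚ a f g (suc i)) (p∣fg (suc i))) (ℤ∣.∣m⇒∣m*n (coeff g (suc i)) p∣a))
...   | inj₁ p∣f = inj₁ λ { zero → p∣a ; (suc i) → p∣f i }
...   | inj₂ p∣g = inj₂ p∣g

-- Used with `id` to take constants out of integer polynomials and with the embedding `ι` to clear
-- denominators of rational ones.
module Scaling {c ℓ} (S : CommutativeRing c ℓ) (φ : ℤ → CommutativeRing.Carrier S)
  (φ-+ : ∀ x y → CommutativeRing._≈_ S (φ (x ℤ.+ y)) (CommutativeRing._+_ S (φ x) (φ y)))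
  (φ-* : ∀ x y → CommutativeRing._≈_ S (φ (x ℤ.* y)) (CommutativeRing._*_ S (φ x) (φ y)))
  (φ-0 : CommutativeRing._≈_ S (φ 0ℤ) (CommutativeRing.0# S)) where

  open CommutativeRing S using () renaming (_≈_ to _≈ˢ_; _+_ to _⊕_; _*_ to _⊗_; 0# to 0ˢ)
  private
    module S = CommutativeRing S
    module S[t] = Polynomials (Semiring.rawSemiring S.semiring)
    module S-coeff = Coefficients S.semiring
    open ≈ˢ-Reasoning S.setoid
    open CommutativeSemigroupProperties S.*-commutativeSemigroup using (interchange)

  Scaled : S.Carrier → Poly → S[t].Poly → Set _
  Scaled d = Pointwise (λ a x → φ a ≈ˢ d ⊗ x)

  scaled-coeff : ∀ d {f g} → Scaled d f g → ∀ i → φ (coeff f i) ≈ˢ d ⊗ S[t].coeff g i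
  scaled-coeff d []       i       = S.trans φ-0 (S.sym (S.zeroʳ d))
  scaled-coeff d (h ∷ hs) zero    = h
  scaled-coeff d (h ∷ hs) (suc i) = scaled-coeff d hs i

  scaled-*ₚ : ∀ d e {f g x y} → Scaled d f x → Scaled e g y →
    ∀ i → φ (coeff (f *ₚ g) i) ≈ˢ (d ⊗ e) ⊗ S[t].coeff (x S[t].*ₚ y) i
  scaled-*ₚ d e [] _ i = S.trans φ-0 (S.sym (S.zeroʳ (d ⊗ e)))
  scaled-*ₚ d e {a ∷ f} {g} {u ∷ x} {y} (h ∷ hs) ks i = begin
    φ (coeff ((a ∷ f) *ₚ g) i)
      ≡⟨ cong φ (coeff-∷-*ₚ a f g i) ⟩
    φ (a ℤ.* coeff g i ℤ.+ coeff (0ℤ ∷ (f *ₚ g)) i)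
      ≈⟨ S.trans (φ-+ (a ℤ.* coeff g i) (coeff (0ℤ ∷ (f *ₚ g)) i)) (S.+-cong (S.trans (φ-* a (coeff g i)) (S.*-cong h (scaled-coeff e ks i))) (shifted i)) ⟩
    (d ⊗ u) ⊗ (e ⊗ S[t].coeff y i) ⊕ (d ⊗ e) ⊗ S[t].coeff (0ˢ ∷ (x S[t].*ₚ y)) i
      ≈⟨ S.+-congʳ (interchange d u e _) ⟩
    (d ⊗ e) ⊗ (u ⊗ S[t].coeff y i) ⊕ (d ⊗ e) ⊗ S[t].coeff (0ˢ ∷ (x S[t].*ₚ y)) i
      ≈⟨ S.distribˡ (d ⊗ e) _ _ ⟨
    (d ⊗ e) ⊗ (u ⊗ S[t].coeff y i ⊕ S[t].coeff (0ˢ ∷ (x S[t].*ₚ y)) i)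
      ≈⟨ S.*-congˡ (S-coeff.coeff-∷-*ₚ u x y i) ⟨
    (d ⊗ e) ⊗ S[t].coeff ((u ∷ x) S[t].*ₚ y) i ∎
    where
    shifted : ∀ i → φ (coeff (0ℤ ∷ (f *ₚ g)) i) ≈ˢ (d ⊗ e) ⊗ S[t].coeff (0ˢ ∷ (x S[t].*ₚ y)) i
    shifted zero    = S.trans φ-0 (S.sym (S.zeroʳ (d ⊗ e)))
    shifted (suc i) = scaled-*ₚ d e hs ks i

module ℤ-scaling = Scaling ℤ.+-*-commutativeRing id (λ _ _ → refl) (λ _ _ → refl) refl
open ℤ-scaling using (Scaled; scaled-coeff; scaled-*ₚ)

scaled-1 : ∀ f → Scaled 1ℤ f f
scaled-1 f = PW.refl (λ {a} → sym (ℤ.*-identityˡ a)) {f}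

scaled-map : ∀ c f → Scaled c (map (c ℤ.*_) f) f
scaled-map c []      = []
scaled-map c (a ∷ f) = refl ∷ scaled-map c f

scaled-trans : ∀ c d {f g h} → Scaled c f g → Scaled d g h → Scaled (c ℤ.* d) f h
scaled-trans c d []       []       = []
scaled-trans c d {h = x ∷ _} (p ∷ ps) (q ∷ qs) =
  trans p (trans (cong (λ y → c ℤ.* y) q) (sym (ℤ.*-assoc c d x))) ∷ scaled-trans c d ps qs

quotients : ∀ {p} f → Divides p f → ∃ λ g → Scaled (+ p) f g
quotients []      p∣f = [] , []
quotients {p} (a ∷ f) p∣f with quotients f (p∣f ∘ suc)
... | g , h = ℤ∣.quotient (p∣f 0) ∷ g , trans (ℤ∣._∣_.equality (p∣f 0)) (ℤ.*-comm _ (+ p)) ∷ h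

prime-divisor : ∀ {m} → 1 < m → ∃ λ p → Prime p × p ∣ m
prime-divisor {m} 1<m with factorise m {{>-nonZero (<-trans 0<1+n 1<m)}}
... | record { factors = [] ; isFactorisation = eq } = contradiction (sym eq) (<⇒≢ 1<m)
... | record { factors = p ∷ ps ; isFactorisation = eq ; factorsPrime = pr ∷ _ } =
  p , pr , divides (product ps) (trans eq (*-comm p (product ps)))

record PrimitiveFactors (f g h : Poly) : Set where
  field
    {c d}    : ℤ
    {g′ h′}  : Poly
    c≢0      : c ≢ 0ℤ
    d≢0      : d ≢ 0ℤ
    scaled-g : Scaled c g g′
    scaled-h : Scaled d h h′
    factors  : g′ *ₚ h′ ≈ₚ f

-- Strong induction on `D`: a prime factor p of `D` divides all coefficients of one of the two
-- polynomials by `gauss-prime`, and dividing that polynomial by p leaves D / p.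
gauss-ℕ : ∀ D → 0 < D → ∀ f g h → (∀ i → coeff (g *ₚ h) i ≡ + D ℤ.* coeff f i) → PrimitiveFactors f g h
gauss-ℕ D 0<D f = <-rec _ step D 0<D
  where
  step : ∀ D → (∀ {E} → E < D → 0 < E → ∀ g h → (∀ i → coeff (g *ₚ h) i ≡ + E ℤ.* coeff f i) → PrimitiveFactors f g h) →
    0 < D → ∀ g h → (∀ i → coeff (g *ₚ h) i ≡ + D ℤ.* coeff f i) → PrimitiveFactors f g h
  step (suc zero) rec _ g h eq = record
    { c = 1ℤ ; d = 1ℤ ; c≢0 = λ () ; d≢0 = λ () ; scaled-g = scaled-1 g ; scaled-h = scaled-1 h
    ; factors = λ i → trans (eq i) (ℤ.*-identityˡ _) }
  step D@(suc (suc _)) rec _ g h eq with prime-divisor {D} (s≤s (s≤s z≤n))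
  ... | p , pr , divides E D≡E*p = split (gauss-prime pr g h (λ i → subst (+ p ℤ∣.∣_) (sym (eq i))
          (ℤ∣.∣m⇒∣m*n (coeff f i) (ℤ∣.divides (+ E) (trans (cong +_ D≡E*p) (ℤ.pos-* E p))))))
    where
    instance
      p≢0 : NonZero p
      p≢0 = prime⇒nonZero pr
    E≢0 : E ≢ 0
    E≢0 E≡0 = contradiction (trans D≡E*p (cong (_* p) E≡0)) λ ()
    0<E : 0 < E
    0<E = n≢0⇒n>0 E≢0
    E<D : E < D
    E<D = subst (E <_) (sym D≡E*p) (ℕ.m<m*n E p {{>-nonZero 0<E}} (ℕ.nonTrivial⇒n>1 p {{prime⇒nonTrivial pr}}))
    +p≢0 : + p ≢ 0ℤ
    +p≢0 p≡0 = ℕ.≢-nonZero⁻¹ p (ℤ.+-injective p≡0)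
    product≢0 : ∀ {c} → c ≢ 0ℤ → + p ℤ.* c ≢ 0ℤ
    product≢0 {c} c≢0 pc≡0 with ℤ.i*j≡0⇒i≡0∨j≡0 (+ p) pc≡0
    ... | inj₁ p≡0 = +p≢0 p≡0
    ... | inj₂ c≡0 = c≢0 c≡0
    cancel : ∀ x y → + p ℤ.* x ≡ + D ℤ.* y → x ≡ + E ℤ.* y
    cancel x y px≡Dy = ℤ.*-cancelˡ-≡ (+ p) x (+ E ℤ.* y) (trans px≡Dy
      (trans (cong (λ z → z ℤ.* y) (trans (cong +_ D≡E*p) (trans (ℤ.pos-* E p) (ℤ.*-comm (+ E) (+ p)))))
        (ℤ.*-assoc (+ p) (+ E) y)))
    split : Divides p g ⊎ Divides p h → PrimitiveFactors f g h
    split (inj₁ p∣g) with quotients g p∣g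
    ... | g₁ , scaled with rec E<D 0<E g₁ h (λ i → cancel _ (coeff f i) (trans
            (sym (trans (scaled-*ₚ (+ p) 1ℤ scaled (scaled-1 h) i) (cong (λ z → z ℤ.* coeff (g₁ *ₚ h) i) (ℤ.*-identityʳ (+ p))))) (eq i)))
    ...   | r = record { c≢0 = product≢0 (PrimitiveFactors.c≢0 r) ; d≢0 = PrimitiveFactors.d≢0 r
                       ; scaled-g = scaled-trans (+ p) (PrimitiveFactors.c r) scaled (PrimitiveFactors.scaled-g r)
                       ; scaled-h = PrimitiveFactors.scaled-h r ; factors = PrimitiveFactors.factors r }
    split (inj₂ p∣h) with quotients h p∣h
    ... | h₁ , scaled with rec E<D 0<E g h₁ (λ i → cancel _ (coeff f i) (trans
            (sym (trans (scaled-*ₚ 1ℤ (+ p) (scaled-1 g) scaled i) (cong (λ z → z ℤ.* coeff (g *ₚ h₁) i) (ℤ.*-identityˡ (+ p))))) (eq i)))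
    ...   | r = record { c≢0 = PrimitiveFactors.c≢0 r ; d≢0 = product≢0 (PrimitiveFactors.d≢0 r)
                       ; scaled-g = PrimitiveFactors.scaled-g r
                       ; scaled-h = scaled-trans (+ p) (PrimitiveFactors.d r) scaled (PrimitiveFactors.scaled-h r) ; factors = PrimitiveFactors.factors r }

gauss : ∀ D → D ≢ 0ℤ → ∀ f g h → (∀ i → coeff (g *ₚ h) i ≡ D ℤ.* coeff f i) → PrimitiveFactors f g h
gauss (+ zero)    D≢0 f g h eq = contradiction refl D≢0
gauss (ℤ.+[1+ D ]) D≢0 f g h eq = gauss-ℕ (suc D) (s≤s z≤n) f g h eq
gauss (ℤ.-[1+ D ]) D≢0 f g h eq with gauss-ℕ (suc D) (s≤s z≤n) f (map (-1ℤ ℤ.*_) g) h negated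
  where
  negated : ∀ i → coeff (map (-1ℤ ℤ.*_) g *ₚ h) i ≡ + suc D ℤ.* coeff f i
  negated i = begin
    coeff (map (-1ℤ ℤ.*_) g *ₚ h) i       ≡⟨ scaled-*ₚ -1ℤ 1ℤ (scaled-map -1ℤ g) (scaled-1 h) i ⟩
    -1ℤ ℤ.* 1ℤ ℤ.* coeff (g *ₚ h) i       ≡⟨ cong (λ z → -1ℤ ℤ.* 1ℤ ℤ.* z) (eq i) ⟩
    -1ℤ ℤ.* 1ℤ ℤ.* (ℤ.-[1+ D ] ℤ.* coeff f i) ≡⟨ ℤ.*-assoc (-1ℤ ℤ.* 1ℤ) ℤ.-[1+ D ] (coeff f i) ⟨
    -1ℤ ℤ.* 1ℤ ℤ.* ℤ.-[1+ D ] ℤ.* coeff f i   ≡⟨ cong (λ z → z ℤ.* coeff f i) (ℤ.-1*i≡-i ℤ.-[1+ D ]) ⟩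
    + suc D ℤ.* coeff f i                 ∎
    where open ≡-Reasoning
... | r = record { c≢0 = λ z → c≢0 (trans (sym (ℤ.neg-involutive c)) (cong ℤ.-_ (trans (sym (ℤ.-1*i≡-i c)) z)))
                 ; d≢0 = d≢0 ; scaled-g = scaled-trans -1ℤ c (scaled-map′ g) scaled-g ; scaled-h = scaled-h ; factors = factors }
  where
  open PrimitiveFactors r
  scaled-map′ : ∀ g → Scaled -1ℤ g (map (-1ℤ ℤ.*_) g)
  scaled-map′ []      = []
  scaled-map′ (a ∷ g) = sym (trans (ℤ.-1*i≡-i (-1ℤ ℤ.* a)) (trans (cong ℤ.-_ (ℤ.-1*i≡-i a)) (ℤ.neg-involutive a))) ∷ scaled-map′ g

record HasDegree (f : Poly) (k : ℕ) : Set where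
  constructor degree
  field
    leading≢0 : coeff f k ≢ 0ℤ
    above≡0   : ∀ i → k < i → coeff f i ≡ 0ℤ
open HasDegree

degree? : ∀ f → (∀ i → coeff f i ≡ 0ℤ) ⊎ ∃ (HasDegree f)
degree? []      = inj₁ λ _ → refl
degree? (a ∷ f) with degree? f
... | inj₂ (k , degree l h) = inj₂ (suc k , degree l λ { (suc i) (s≤s k<i) → h i k<i })
... | inj₁ f≡0 with a ℤ.≟ 0ℤ
...   | yes a≡0 = inj₁ λ { zero → a≡0 ; (suc i) → f≡0 i }
...   | no a≢0  = inj₂ (0 , degree a≢0 λ { (suc i) _ → f≡0 i })

*ₚ-zeroˡ : ∀ f g → (∀ i → coeff f i ≡ 0ℤ) → ∀ i → coeff (f *ₚ g) i ≡ 0ℤ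
*ₚ-zeroˡ []      g h i = refl
*ₚ-zeroˡ (a ∷ f) g h i = trans (coeff-∷-*ₚ a f g i) (cong₂ (λ x y → x ℤ.* coeff g i ℤ.+ y) (h 0) (shifted i))
  where
  shifted : ∀ i → coeff (0ℤ ∷ (f *ₚ g)) i ≡ 0ℤ
  shifted zero    = refl
  shifted (suc i) = *ₚ-zeroˡ f g (h ∘ suc) i

*ₚ-zeroʳ : ∀ f g → (∀ i → coeff g i ≡ 0ℤ) → ∀ i → coeff (f *ₚ g) i ≡ 0ℤ
*ₚ-zeroʳ []      g h i = refl
*ₚ-zeroʳ (a ∷ f) g h i = trans (coeff-∷-*ₚ a f g i)
  (cong₂ ℤ._+_ (trans (cong (λ x → a ℤ.* x) (h i)) (ℤ.*-zeroʳ a)) (shifted i))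
  where
  shifted : ∀ i → coeff (0ℤ ∷ (f *ₚ g)) i ≡ 0ℤ
  shifted zero    = refl
  shifted (suc i) = *ₚ-zeroʳ f g h i

*ₚ-top : ∀ f g i j → (∀ l → i < l → coeff f l ≡ 0ℤ) → (∀ l → j < l → coeff g l ≡ 0ℤ) →
  coeff (f *ₚ g) (i + j) ≡ coeff f i ℤ.* coeff g j × (∀ l → i + j < l → coeff (f *ₚ g) l ≡ 0ℤ)
*ₚ-top []      g i j hf hg = refl , λ _ _ → refl
*ₚ-top (a ∷ f) g zero j hf hg = trans (shape j) refl , λ l j<l → trans (shape l) (trans (cong (λ x → a ℤ.* x) (hg l j<l)) (ℤ.*-zeroʳ a))
  where
  shifted : ∀ i → coeff (0ℤ ∷ (f *ₚ g)) i ≡ 0ℤ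
  shifted zero    = refl
  shifted (suc i) = *ₚ-zeroˡ f g (λ l → hf (suc l) (s≤s z≤n)) i
  shape : ∀ i → coeff ((a ∷ f) *ₚ g) i ≡ a ℤ.* coeff g i
  shape i = trans (coeff-∷-*ₚ a f g i) (trans (cong (λ x → a ℤ.* coeff g i ℤ.+ x) (shifted i)) (ℤ.+-identityʳ _))
*ₚ-top (a ∷ f) g (suc i) j hf hg with *ₚ-top f g i j (λ l i<l → hf (suc l) (s≤s i<l)) hg
... | top , above = trans (shape (i + j) (s≤s (m≤n+m j i))) top , λ { (suc l) (s≤s i+j<l) →
    trans (shape l (s≤s (≤-trans (m≤n+m j i) (<⇒≤ i+j<l)))) (above l i+j<l) }
  where
  shape : ∀ l → j < suc l → coeff ((a ∷ f) *ₚ g) (suc l) ≡ coeff (f *ₚ g) l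
  shape l j<1+l = trans (coeff-∷-*ₚ a f g (suc l))
    (trans (cong (λ x → a ℤ.* x ℤ.+ coeff (f *ₚ g) l) (hg (suc l) j<1+l))
      (trans (cong (ℤ._+ coeff (f *ₚ g) l) (ℤ.*-zeroʳ a)) (ℤ.+-identityˡ _)))

degree-*ₚ : ∀ {f g i j} → HasDegree f i → HasDegree g j → HasDegree (f *ₚ g) (i + j)
degree-*ₚ {f} {g} {i} {j} df dg with *ₚ-top f g i j (above≡0 df) (above≡0 dg)
... | top , above = degree (λ z → [ leading≢0 df , leading≢0 dg ]′ (ℤ.i*j≡0⇒i≡0∨j≡0 (coeff f i) (trans (sym top) z))) above

degree-unique : ∀ {f g i j} → f ≈ₚ g → HasDegree f i → HasDegree g j → i ≡ j
degree-unique {i = i} {j} f≈g df dg with ℕ.<-cmp i j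
... | tri< i<j _ _ = contradiction (trans (sym (f≈g j)) (above≡0 df j i<j)) (leading≢0 dg)
... | tri≈ _ i≡j _ = i≡j
... | tri> _ _ j<i = contradiction (trans (f≈g i) (above≡0 dg i j<i)) (leading≢0 df)

-- Trailing zeros have to go because the hypothesis `deg-p` of `NormCongruence` bounds the length of
-- the list and not the degree.
trim : ∀ {f k} → HasDegree f k → ∃ λ g → f ≈ₚ g × length g ≤ suc k
trim {[]}    (degree l h) = contradiction refl l
trim {a ∷ f} {zero}  (degree l h) = a ∷ [] , (λ { zero → refl ; (suc i) → h (suc i) (s≤s z≤n) }) , ≤-refl
trim {a ∷ f} {suc k} (degree l h) with trim {f} {k} (degree l λ i k<i → h (suc i) (s≤s k<i))
... | g , f≈g , g≤ = a ∷ g , (λ { zero → refl ; (suc i) → f≈g i }) , s≤s g≤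

*ₚ-congˡ : ∀ f f′ g → f ≈ₚ f′ → f *ₚ g ≈ₚ f′ *ₚ g
*ₚ-congˡ []      f′        g h i = sym (*ₚ-zeroˡ f′ g (sym ∘ h) i)
*ₚ-congˡ (a ∷ f) []        g h i = *ₚ-zeroˡ (a ∷ f) g h i
*ₚ-congˡ (a ∷ f) (a′ ∷ f′) g h i = trans (coeff-∷-*ₚ a f g i)
  (trans (cong₂ (λ x y → x ℤ.* coeff g i ℤ.+ y) (h 0) (shifted i)) (sym (coeff-∷-*ₚ a′ f′ g i)))
  where
  shifted : ∀ i → coeff (0ℤ ∷ (f *ₚ g)) i ≡ coeff (0ℤ ∷ (f′ *ₚ g)) i
  shifted zero    = refl
  shifted (suc i) = *ₚ-congˡ f f′ g (h ∘ suc) i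

-- Irreducibility over ℚ

ι : ℤ → ℚ
ι i = i ℚ./ 1

ι-injective : ∀ {i j} → ι i ≡ ι j → i ≡ j
ι-injective {i} {j} eq with *≡* h ← ℚ.fromℚᵘ-injective {mkℚᵘ i 0} {mkℚᵘ j 0} eq =
  trans (sym (ℤ.*-identityʳ i)) (trans h (ℤ.*-identityʳ j))

ι-+ : ∀ i j → ι (i ℤ.+ j) ≡ ι i ℚ.+ ι j
ι-+ i j = ℚ.toℚᵘ-injective (begin
  ℚ.toℚᵘ (ι (i ℤ.+ j))              ≈⟨ ℚ.toℚᵘ-fromℚᵘ (mkℚᵘ (i ℤ.+ j) 0) ⟩
  mkℚᵘ (i ℤ.+ j) 0                  ≈⟨ *≡* (identity i j) ⟩
  mkℚᵘ i 0 ℚᵘ.+ mkℚᵘ j 0            ≈⟨ ℚᵘ.+-cong (ℚ.toℚᵘ-fromℚᵘ (mkℚᵘ i 0)) (ℚ.toℚᵘ-fromℚᵘ (mkℚᵘ j 0)) ⟨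
  ℚ.toℚᵘ (ι i) ℚᵘ.+ ℚ.toℚᵘ (ι j)    ≈⟨ ℚ.toℚᵘ-homo-+ (ι i) (ι j) ⟨
  ℚ.toℚᵘ (ι i ℚ.+ ι j)              ∎)
  where
  open ℚᵘ.≃-Reasoning
  identity : ∀ i j → (i ℤ.+ j) ℤ.* 1ℤ ≡ (i ℤ.* 1ℤ ℤ.+ j ℤ.* 1ℤ) ℤ.* 1ℤ
  identity = ℤ-solve

ι-* : ∀ i j → ι (i ℤ.* j) ≡ ι i ℚ.* ι j
ι-* i j = ℚ.toℚᵘ-injective (begin
  ℚ.toℚᵘ (ι (i ℤ.* j))              ≈⟨ ℚ.toℚᵘ-fromℚᵘ (mkℚᵘ (i ℤ.* j) 0) ⟩
  mkℚᵘ i 0 ℚᵘ.* mkℚᵘ j 0            ≈⟨ ℚᵘ.*-cong (ℚ.toℚᵘ-fromℚᵘ (mkℚᵘ i 0)) (ℚ.toℚᵘ-fromℚᵘ (mkℚᵘ j 0)) ⟨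
  ℚ.toℚᵘ (ι i) ℚᵘ.* ℚ.toℚᵘ (ι j)    ≈⟨ ℚ.toℚᵘ-homo-* (ι i) (ι j) ⟨
  ℚ.toℚᵘ (ι i ℚ.* ι j)              ∎)
  where open ℚᵘ.≃-Reasoning

↥≡↧* : ∀ q → ι (ℚ.↥ q) ≡ ι (ℚ.↧ q) ℚ.* q
↥≡↧* q@record{} = ℚ.toℚᵘ-injective (begin
  ℚ.toℚᵘ (ι (ℚ.↥ q))                 ≈⟨ ℚ.toℚᵘ-fromℚᵘ (mkℚᵘ (ℚ.↥ q) 0) ⟩
  mkℚᵘ (ℚ.↥ q) 0                     ≈⟨ *≡* (identity (ℚ.↥ q) (ℚ.↧ q)) ⟩
  mkℚᵘ (ℚ.↧ q) 0 ℚᵘ.* ℚ.toℚᵘ q       ≈⟨ ℚᵘ.*-congʳ {ℚ.toℚᵘ q} (ℚ.toℚᵘ-fromℚᵘ (mkℚᵘ (ℚ.↧ q) 0)) ⟨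
  ℚ.toℚᵘ (ι (ℚ.↧ q)) ℚᵘ.* ℚ.toℚᵘ q   ≈⟨ ℚ.toℚᵘ-homo-* (ι (ℚ.↧ q)) q ⟨
  ℚ.toℚᵘ (ι (ℚ.↧ q) ℚ.* q)           ∎)
  where
  open ℚᵘ.≃-Reasoning
  identity : ∀ x y → x ℤ.* (1ℤ ℤ.* y) ≡ (y ℤ.* x) ℤ.* 1ℤ
  identity = ℤ-solve

module ℚ-scaling = Scaling ℚ.+-*-commutativeRing ι ι-+ ι-* refl
module ℚ-coeff = Coefficients (CommutativeRing.semiring ℚ.+-*-commutativeRing)

clear-denominators : ∀ x → ∃₂ λ D f → D ≢ 0ℤ × ℚ-scaling.Scaled (ι D) f x
clear-denominators []      = 1ℤ , [] , (λ ()) , []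
clear-denominators (q ∷ x) with clear-denominators x
... | D , f , D≢0 , scaled = ℚ.↧ q ℤ.* D , ℚ.↥ q ℤ.* D ∷ map (ℚ.↧ q ℤ.*_) f , nonzero , head ∷ tail scaled
  where
  nonzero : ℚ.↧ q ℤ.* D ≢ 0ℤ
  nonzero eq with ℤ.i*j≡0⇒i≡0∨j≡0 (ℚ.↧ q) eq
  ... | inj₁ ()
  ... | inj₂ D≡0 = D≢0 D≡0
  open ≡-Reasoning
  head : ι (ℚ.↥ q ℤ.* D) ≡ ι (ℚ.↧ q ℤ.* D) ℚ.* q
  head = begin
    ι (ℚ.↥ q ℤ.* D)              ≡⟨ ι-* (ℚ.↥ q) D ⟩
    ι (ℚ.↥ q) ℚ.* ι D            ≡⟨ cong (ℚ._* ι D) (↥≡↧* q) ⟩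
    ι (ℚ.↧ q) ℚ.* q ℚ.* ι D      ≡⟨ ℚ.*-assoc (ι (ℚ.↧ q)) q (ι D) ⟩
    ι (ℚ.↧ q) ℚ.* (q ℚ.* ι D)    ≡⟨ cong (ι (ℚ.↧ q) ℚ.*_) (ℚ.*-comm q (ι D)) ⟩
    ι (ℚ.↧ q) ℚ.* (ι D ℚ.* q)    ≡⟨ ℚ.*-assoc (ι (ℚ.↧ q)) (ι D) q ⟨
    ι (ℚ.↧ q) ℚ.* ι D ℚ.* q      ≡⟨ cong (ℚ._* q) (ι-* (ℚ.↧ q) D) ⟨
    ι (ℚ.↧ q ℤ.* D) ℚ.* q        ∎
  tail : ∀ {f x} → ℚ-scaling.Scaled (ι D) f x → ℚ-scaling.Scaled (ι (ℚ.↧ q ℤ.* D)) (map (ℚ.↧ q ℤ.*_) f) x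
  tail [] = []
  tail {a ∷ _} {u ∷ _} (h ∷ hs) = (begin
    ι (ℚ.↧ q ℤ.* a)              ≡⟨ ι-* (ℚ.↧ q) a ⟩
    ι (ℚ.↧ q) ℚ.* ι a            ≡⟨ cong (ι (ℚ.↧ q) ℚ.*_) h ⟩
    ι (ℚ.↧ q) ℚ.* (ι D ℚ.* u)    ≡⟨ ℚ.*-assoc (ι (ℚ.↧ q)) (ι D) u ⟨
    ι (ℚ.↧ q) ℚ.* ι D ℚ.* u      ≡⟨ cong (ℚ._* u) (ι-* (ℚ.↧ q) D) ⟨
    ι (ℚ.↧ q ℤ.* D) ℚ.* u        ∎) ∷ tail hs

coeff-ι : ∀ f i → ℚ[t].coeff (map ι f) i ≡ ι (coeff f i)
coeff-ι []      i       = refl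
coeff-ι (a ∷ f) zero    = refl
coeff-ι (a ∷ f) (suc i) = coeff-ι f i

scaled-ι : ∀ f → ℚ-scaling.Scaled 1ℚ f (map ι f)
scaled-ι []      = []
scaled-ι (a ∷ f) = sym (ℚ.*-identityˡ (ι a)) ∷ scaled-ι f

ι-zero-product : ∀ {D} → D ≢ 0ℤ → ∀ x → ι D ℚ.* x ≡ 0ℚ → x ≡ 0ℚ
ι-zero-product {D} D≢0 x Dx≡0 = begin
  x                             ≡⟨ ℚ.*-identityˡ x ⟨
  1ℚ ℚ.* x                      ≡⟨ cong (ℚ._* x) (ℚ.*-inverseˡ (ι D)) ⟨
  ℚ.1/ ι D ℚ.* ι D ℚ.* x        ≡⟨ ℚ.*-assoc (ℚ.1/ ι D) (ι D) x ⟩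
  ℚ.1/ ι D ℚ.* (ι D ℚ.* x)      ≡⟨ cong (ℚ.1/ ι D ℚ.*_) Dx≡0 ⟩
  ℚ.1/ ι D ℚ.* 0ℚ               ≡⟨ ℚ.*-zeroʳ (ℚ.1/ ι D) ⟩
  0ℚ                            ∎
  where
  open ≡-Reasoning
  instance
    ιD≢0 : ℚ.NonZero (ι D)
    ιD≢0 = ℚ.≢-nonZero (D≢0 ∘ ι-injective)

constant-unit : ∀ {D c f g x} → D ≢ 0ℤ → ℚ-scaling.Scaled (ι D) f x → c ≢ 0ℤ → Scaled c f g → HasDegree g 0 → x ∣ℚ (1ℚ ∷ [])
constant-unit {D} {c} {f} {g} {x} D≢0 f≈Dx c≢0 f≈cg dg = (ℚ.1/ x₀ ∷ []) RawMagma., λ i → trans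
  (ℚ-coeff.coeff-∷-*ₚ (ℚ.1/ x₀) [] x i) (inverse i)
  where
  x₀ : ℚ
  x₀ = ℚ[t].coeff x 0
  f₀≢0 : coeff f 0 ≢ 0ℤ
  f₀≢0 f₀≡0 = [ c≢0 , leading≢0 dg ]′ (ℤ.i*j≡0⇒i≡0∨j≡0 c (trans (sym (scaled-coeff c f≈cg 0)) f₀≡0))
  x₀≢0 : x₀ ≢ 0ℚ
  x₀≢0 x₀≡0 = f₀≢0 (ι-injective (trans (ℚ-scaling.scaled-coeff (ι D) f≈Dx 0)
    (trans (cong (ι D ℚ.*_) x₀≡0) (ℚ.*-zeroʳ (ι D)))))
  instance
    x₀-nonZero : ℚ.NonZero x₀
    x₀-nonZero = ℚ.≢-nonZero x₀≢0
  x-above : ∀ i → ℚ[t].coeff x (suc i) ≡ 0ℚ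
  x-above i = ι-zero-product D≢0 _ (trans (sym (ℚ-scaling.scaled-coeff (ι D) f≈Dx (suc i)))
    (cong ι (trans (scaled-coeff c f≈cg (suc i)) (trans (cong (λ z → c ℤ.* z) (above≡0 dg (suc i) (s≤s z≤n))) (ℤ.*-zeroʳ c)))))
  inverse : ∀ i → ℚ.1/ x₀ ℚ.* ℚ[t].coeff x i ℚ.+ ℚ[t].coeff (0ℚ ∷ []) i ≡ ℚ[t].coeff (1ℚ ∷ []) i
  inverse zero    = trans (ℚ.+-identityʳ _) (ℚ.*-inverseˡ x₀)
  inverse (suc i) = trans (ℚ.+-identityʳ _) (trans (cong (ℚ.1/ x₀ ℚ.*_) (x-above i)) (ℚ.*-zeroʳ (ℚ.1/ x₀)))

unit-square : ∀ i j → i ℤ.* j ≡ 1ℤ → j ℤ.* j ≡ 1ℤ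
unit-square i j ij≡1 with ℕ.m*n≡1⇒n≡1 ∣ i ∣ ∣ j ∣ (trans (sym (ℤ.abs-* i j)) (cong ∣_∣ ij≡1))
unit-square i (+ .1)       ij≡1 | refl = refl
unit-square i ℤ.-[1+ .0 ] ij≡1 | refl = refl

module _ {e : ℕ} (1<e : 1 < e) (even : -1ℤ ℤ.^ e ≡ 1ℤ) {m a b : ℤ} (m∣a : m ℤ∣.∣ a)
  (nonresidue : ∀ k γ → 0 < k → k < suc e → ¬ (γ ℤ.^ suc e ≋ b ℤ.^ k [ m ])) where

  private
    n : ℕ
    n = suc e
    f : Poly
    f = trinomial n a b
    1<n : 1 < n
    1<n = m<n⇒m<1+n 1<e
    degree-f : HasDegree f n
    degree-f = degree (λ fₙ≡0 → contradiction (trans (sym (coeff-trinomial-n 1<n a b)) fₙ≡0) λ ())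
      (λ i n<i → coeff-trinomial-else 1<n a b i (<-trans 1<n n<i) (<⇒≢ n<i ∘ sym))

  factor-degree : ∀ {g h i j} → g *ₚ h ≈ₚ f → HasDegree g i → HasDegree h j → i ≡ 0 ⊎ j ≡ 0
  factor-degree {g} {h} {zero} _ _ _ = inj₁ refl
  factor-degree {g} {h} {suc i} {zero} _ _ _ = inj₂ refl
  factor-degree {g} {h} {i@(suc i′)} {j@(suc _)} gh≈f dg dh = ⊥-elim (nonresidue j γ (s≤s z≤n) j<n γⁿ≋bʲ)
    where
    i+j≡n : i + j ≡ n
    i+j≡n = degree-unique gh≈f (degree-*ₚ dg dh) degree-f
    j<n : j < n
    j<n = subst (j <_) i+j≡n (s≤s (m≤n+m j i′))
    c γ : ℤ
    c = coeff h j
    -- The leading coefficient `c` is 1 or -1. The norm congruence reads h(0) ^ n ≡ c ^ n b ^ j, so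
    -- the factor `c` in `γ` removes c ^ n through c² = 1.
    γ = c ℤ.* coeff h 0
    c²≡1 : c ℤ.* c ≡ 1ℤ
    c²≡1 = unit-square (coeff g i) c (trans (sym (proj₁ (*ₚ-top g h i j (above≡0 dg) (above≡0 dh))))
      (trans (gh≈f (i + j)) (trans (cong (coeff f) i+j≡n) (coeff-trinomial-n 1<n a b))))
    γⁿ≋bʲ : γ ℤ.^ n ≋ b ℤ.^ j [ m ]
    γⁿ≋bʲ with trim dg
    ... | g′ , g≈g′ , g′≤ = ≋-trans (≋-reflexive (^-distribʳ-* c (coeff h 0) n))
      (≋-trans (≋-* (≋-reflexive {x = c ℤ.^ n} refl)
        (NormCongruence.norm-congruence 1<e even {m} {a} {b} m∣a g′ h
          (λ l → trans (sym (*ₚ-congˡ g g′ h g≈g′ l)) (gh≈f l)) (above≡0 dh)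
          (≤-trans (+-monoʳ-≤ j g′≤) (≤-reflexive (trans (+-suc j i) (cong suc (trans (+-comm j i) i+j≡n)))))))
        (≋-reflexive (trans (sym (ℤ.*-assoc (c ℤ.^ n) (c ℤ.^ n) (b ℤ.^ j)))
          (trans (cong (λ z → z ℤ.* b ℤ.^ j) (trans (sym (^-distribʳ-* c c n)) (trans (cong (ℤ._^ n) c²≡1) (ℤ.^-zeroˡ n))))
            (ℤ.*-identityˡ (b ℤ.^ j))))))

  trinomial-irreducible : IrreducibleOverℚ f
  trinomial-irreducible = mkIrred not-unit split
    where
    not-unit : ¬ (map ι f ∣ℚ (1ℚ ∷ []))
    not-unit (x RawMagma., xf≈1) with clear-denominators x
    ... | D , g , D≢0 , g≈Dx = [ zero-case , degree-case ]′ (degree? g)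
      where
      ι-coeff : ∀ i → ι (coeff (g *ₚ f) i) ≡ ι D ℚ.* ℚ[t].coeff (1ℚ ∷ []) i
      ι-coeff i = trans (ℚ-scaling.scaled-*ₚ (ι D) 1ℚ g≈Dx (scaled-ι f) i)
        (cong₂ ℚ._*_ (ℚ.*-identityʳ (ι D)) (xf≈1 i))
      coeff-0 : coeff (g *ₚ f) 0 ≡ D
      coeff-0 = ι-injective (trans (ι-coeff 0) (ℚ.*-identityʳ (ι D)))
      coeff-suc : ∀ i → coeff (g *ₚ f) (suc i) ≡ 0ℤ
      coeff-suc i = ι-injective (trans (ι-coeff (suc i)) (ℚ.*-zeroʳ (ι D)))
      zero-case : (∀ i → coeff g i ≡ 0ℤ) → ⊥
      zero-case g≡0 = D≢0 (trans (sym coeff-0) (*ₚ-zeroˡ g f g≡0 0))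
      degree-case : ∃ (HasDegree g) → ⊥
      degree-case (i , dg) = leading≢0 (degree-*ₚ dg degree-f)
        (trans (cong (coeff (g *ₚ f)) (+-suc i e)) (coeff-suc (i + e)))

    split : ∀ {x y} → map ι f ℚ[t].≈ₚ (x ℚ[t].*ₚ y) → x ∣ℚ (1ℚ ∷ []) ⊎ y ∣ℚ (1ℚ ∷ [])
    split {x} {y} f≈xy with clear-denominators x | clear-denominators y
    ... | D , g , D≢0 , g≈Dx | E , h , E≢0 , h≈Ey = cases (degree? g′) (degree? h′)
      where
      gh≡DEf : ∀ i → coeff (g *ₚ h) i ≡ (D ℤ.* E) ℤ.* coeff f i
      gh≡DEf i = ι-injective (begin
        ι (coeff (g *ₚ h) i)
          ≡⟨ ℚ-scaling.scaled-*ₚ (ι D) (ι E) g≈Dx h≈Ey i ⟩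
        ι D ℚ.* ι E ℚ.* ℚ[t].coeff (x ℚ[t].*ₚ y) i
          ≡⟨ cong₂ ℚ._*_ (ι-* D E) (trans (sym (coeff-ι f i)) (f≈xy i)) ⟨
        ι (D ℤ.* E) ℚ.* ι (coeff f i)
          ≡⟨ ι-* (D ℤ.* E) (coeff f i) ⟨
        ι ((D ℤ.* E) ℤ.* coeff f i) ∎)
        where open ≡-Reasoning
      DE≢0 : D ℤ.* E ≢ 0ℤ
      DE≢0 eq = [ D≢0 , E≢0 ]′ (ℤ.i*j≡0⇒i≡0∨j≡0 D eq)
      open PrimitiveFactors (gauss (D ℤ.* E) DE≢0 f g h gh≡DEf)
      nonzero : ¬ (∀ i → coeff f i ≡ 0ℤ)
      nonzero f≡0 = leading≢0 degree-f (f≡0 n)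
      cases : (∀ i → coeff g′ i ≡ 0ℤ) ⊎ ∃ (HasDegree g′) → (∀ i → coeff h′ i ≡ 0ℤ) ⊎ ∃ (HasDegree h′) →
        x ∣ℚ (1ℚ ∷ []) ⊎ y ∣ℚ (1ℚ ∷ [])
      cases (inj₁ g′≡0) _ = ⊥-elim (nonzero λ i → trans (sym (factors i)) (*ₚ-zeroˡ g′ h′ g′≡0 i))
      cases (inj₂ _) (inj₁ h′≡0) = ⊥-elim (nonzero λ i → trans (sym (factors i)) (*ₚ-zeroʳ g′ h′ h′≡0 i))
      cases (inj₂ (i , dg)) (inj₂ (j , dh)) with factor-degree factors dg dh
      ... | inj₁ refl = inj₁ (constant-unit D≢0 g≈Dx c≢0 scaled-g dg)
      ... | inj₂ refl = inj₂ (constant-unit E≢0 h≈Ey d≢0 scaled-h dh)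

-- Power nonresidues

pos-^ : ∀ x k → + (x ^ k) ≡ (+ x) ℤ.^ k
pos-^ x zero    = refl
pos-^ x (suc k) = trans (ℤ.pos-* x (x ^ k)) (cong (λ y → + x ℤ.* y) (pos-^ x k))

≋-divisor : ∀ {d m x y} → d ℤ∣.∣ m → x ≋ y [ m ] → x ≋ y [ d ]
≋-divisor d∣m (≋-intro h) = ≋-intro (ℤ∣.∣-trans d∣m h)

≋0⇒∣ : ∀ {m x} → x ≋ 0ℤ [ m ] → m ℤ∣.∣ x
≋0⇒∣ {m} {x} (≋-intro h) = subst (m ℤ∣.∣_) (ℤ.+-identityʳ x) h

∣⇒≋0 : ∀ {m x} → m ℤ∣.∣ x → x ≋ 0ℤ [ m ]
∣⇒≋0 {m} {x} h = ≋-intro (subst (m ℤ∣.∣_) (sym (ℤ.+-identityʳ x)) h)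

≋-%ℕ : ∀ x m .{{_ : NonZero m}} → x ≋ + (x ℤ.%ℕ m) [ + m ]
≋-%ℕ x m = ≋-intro (ℤ∣.divides (x ℤ./ℕ m) (trans (cong (λ z → z ℤ.- r) (a≡a%ℕn+[a/ℕn]*n x m)) (cancel r _)))
  where
  r : ℤ
  r = + (x ℤ.%ℕ m)
  cancel : ∀ r q → (r ℤ.+ q) ℤ.- r ≡ q
  cancel = ℤ-solve

infix 4 _≋?_[_]
_≋?_[_] : ∀ x y m → Dec (x ≋ y [ m ])
x ≋? y [ m ] with m ℤ∣.∣? (x ℤ.- y)
... | yes h = yes (≋-intro h)
... | no ¬h = no (¬h ∘ ≋-elim)

≋-common-divisor : ∀ {m d} x y → + x ≋ + y [ + m ] → d ∣ m → d ∣ x → d ∣ y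
≋-common-divisor {m} {d} x y (≋-intro h) d∣m d∣x = ℤ∣.∣⇒∣ᵤ {+ d} {+ y}
  (subst (+ d ℤ∣.∣_) (cancel (+ x) (+ y)) (ℤ∣.∣m∣n⇒∣m-n {+ d} {+ x} (ℤ∣.∣ᵤ⇒∣ d∣x) (ℤ∣.∣-trans (ℤ∣.∣ᵤ⇒∣ d∣m) h)))
  where
  cancel : ∀ x y → x ℤ.- (x ℤ.- y) ≡ y
  cancel = ℤ-solve

coprime-≋ : ∀ {m x y} → + x ≋ + y [ + m ] → Coprime y m → Coprime x m
coprime-≋ {m} {x} {y} h c (d∣x , d∣m) = c (≋-common-divisor x y h d∣m d∣x , d∣m)

coprime-*ʳ : ∀ {x m n} → Coprime x m → Coprime x n → Coprime x (m * n)
coprime-*ʳ {x} {m} {n} cm cn {d} (d∣x , d∣mn) =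
  cn (d∣x , coprime-divisor {d} {m} {n} (λ { (i∣d , i∣m) → cm (ℕ∣.∣-trans i∣d d∣x , i∣m) }) d∣mn)

coprime-∣ʳ : ∀ {x m n} → m ∣ n → Coprime x n → Coprime x m
coprime-∣ʳ m∣n c (d∣x , d∣m) = c (d∣x , ℕ∣.∣-trans d∣m m∣n)

prime∤⇒coprime : ∀ {p n} → Prime p → ¬ (p ∣ n) → Coprime p n
prime∤⇒coprime pr p∤n (d∣p , d∣n) with prime⇒irreducible pr d∣p
... | inj₁ d≡1  = d≡1
... | inj₂ refl = contradiction d∣n p∤n

chinese-remainder : ∀ {m n} .{{_ : NonZero m}} .{{_ : NonZero n}} → Coprime m n → ∀ x y →
  ∃ λ z → z < m * n × + z ≋ + x [ + m ] × + z ≋ + y [ + n ]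
chinese-remainder {m} {n} c x y = z , n%ℕd<d z′ (m * n) , to-m , to-n
  where
  u-exists : ∃ λ u → + m ℤ∣.∣ u × u ≋ 1ℤ [ + n ]
  u-exists with coprime-Bézout c
  ... | Bézout.+- s t eq = + s ℤ.* + m , ℤ∣.divides (+ s) refl , ≋-intro (ℤ∣.divides (+ t)
          (trans (cong (λ w → w ℤ.- 1ℤ) (trans (sym (ℤ.pos-* s m)) (trans (cong +_ (sym eq)) (cong (λ w → 1ℤ ℤ.+ w) (ℤ.pos-* t n)))))
            (cancel (+ t ℤ.* + n))))
    where
    cancel : ∀ w → (1ℤ ℤ.+ w) ℤ.- 1ℤ ≡ w
    cancel = ℤ-solve
  ... | Bézout.-+ s t eq = ℤ.- (+ s) ℤ.* + m , ℤ∣.divides (ℤ.- (+ s)) refl , ≋-intro (ℤ∣.divides (ℤ.- (+ t))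
          (trans (negate (+ s) (+ m)) (trans (cong ℤ.-_ (trans (cong (λ w → 1ℤ ℤ.+ w) (sym (ℤ.pos-* s m))) (trans (cong +_ eq) (ℤ.pos-* t n))))
            (ℤ.neg-distribˡ-* (+ t) (+ n)))))
    where
    negate : ∀ s m → (ℤ.- s) ℤ.* m ℤ.- 1ℤ ≡ ℤ.- (1ℤ ℤ.+ s ℤ.* m)
    negate = ℤ-solve
  u z′ : ℤ
  u = proj₁ u-exists
  z′ = + x ℤ.+ u ℤ.* (+ y ℤ.- + x)
  instance
    mn≢0 : NonZero (m * n)
    mn≢0 = m*n≢0 m n
  z : ℕ
  z = z′ ℤ.%ℕ (m * n)
  to-m : + z ≋ + x [ + m ]
  to-m = ≋-trans (≋-divisor (ℤ∣.∣ᵤ⇒∣ (ℕ∣.m∣m*n n)) (≋-sym (≋-%ℕ z′ (m * n))))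
    (≋-trans (≋-+ {x = + x} (≋-reflexive refl) (≋-* (∣⇒≋0 (proj₁ (proj₂ u-exists))) (≋-reflexive refl)))
      (≋-reflexive (ℤ.+-identityʳ (+ x))))
  to-n : + z ≋ + y [ + n ]
  to-n = ≋-trans (≋-divisor (ℤ∣.∣ᵤ⇒∣ (ℕ∣.n∣m*n m)) (≋-sym (≋-%ℕ z′ (m * n))))
    (≋-trans (≋-+ {x = + x} (≋-reflexive refl) (≋-* (proj₂ (proj₂ u-exists)) (≋-reflexive refl)))
      (≋-reflexive (cancel (+ x) (+ y))))
    where
    cancel : ∀ x y → x ℤ.+ 1ℤ ℤ.* (y ℤ.- x) ≡ y
    cancel = ℤ-solve

maximal-power : ∀ l → 1 < l → ∀ d → 0 < d → ∃₂ λ f d′ → d ≡ l ^ f * d′ × ¬ (l ∣ d′)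
maximal-power l 1<l = <-rec _ step
  where
  step : ∀ d → (∀ {c} → c < d → 0 < c → ∃₂ λ f d′ → c ≡ l ^ f * d′ × ¬ (l ∣ d′)) →
    0 < d → ∃₂ λ f d′ → d ≡ l ^ f * d′ × ¬ (l ∣ d′)
  step d rec 0<d with l ℕ∣.∣? d
  ... | no l∤d = 0 , d , sym (+-identityʳ d) , l∤d
  ... | yes (divides c d≡cl) with rec c<d 0<c
    where
    0<c : 0 < c
    0<c = n≢0⇒n>0 λ c≡0 → <⇒≢ 0<d (sym (trans d≡cl (cong (_* l) c≡0)))
    c<d : c < d
    c<d = subst (c <_) (sym d≡cl) (ℕ.m<m*n c l {{>-nonZero 0<c}} 1<l)
  ...   | f , d′ , c≡ , l∤d′ = suc f , d′ ,
          trans d≡cl (trans (*-comm c l) (trans (cong (l *_) c≡) (sym (*-assoc l (l ^ f) d′)))) , l∤d′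

^-^ : ∀ (x : ℤ) a b {c} → a * b ≡ c → (x ℤ.^ a) ℤ.^ b ≡ x ℤ.^ c
^-^ x a b refl = ℤ.^-*-assoc x a b

≋-power-one : ∀ {m x} k → x ≋ 1ℤ [ m ] → x ℤ.^ k ≋ 1ℤ [ m ]
≋-power-one k h = ≋-trans (≋-^ k h) (≋-reflexive (ℤ.^-zeroˡ k))

power-combination : ∀ {m} x s t l k → 1 + t * k ≡ s * l → x ℤ.^ k ≋ 1ℤ [ m ] → x ℤ.^ l ≋ 1ℤ [ m ] → x ≋ 1ℤ [ m ]
power-combination x s t l k eq xᵏ≋1 xˡ≋1 = ≋-trans (≋-sym (≋-trans
    (≋-* {x = x} (≋-reflexive refl) (≋-trans (≋-reflexive (sym (^-^ x k t (*-comm k t)))) (≋-power-one t xᵏ≋1)))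
    (≋-reflexive (ℤ.*-identityʳ x))))
  (≋-trans (≋-reflexive (trans (cong (x ℤ.^_) eq) (sym (^-^ x l s (*-comm l s))))) (≋-power-one s xˡ≋1))

coprime-powers : ∀ {m x l k} → Coprime l k → x ℤ.^ l ≋ 1ℤ [ m ] → x ℤ.^ k ≋ 1ℤ [ m ] → x ≋ 1ℤ [ m ]
coprime-powers {x = x} {l} {k} c xˡ≋1 xᵏ≋1 with coprime-Bézout c
... | Bézout.+- s t eq = power-combination x s t l k eq xᵏ≋1 xˡ≋1
... | Bézout.-+ s t eq = power-combination x t s k l eq xˡ≋1 xᵏ≋1

-- Modulo m = N ^ (l ^ (f + 1)) - 1 the class of N has order l ^ (f + 1).
-- As long as b ^ k is an n-th power γ ^ n, an element b of order l ^ (s + 1)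
-- can be replaced by γ ^ n′ of order l ^ (s + 2); this stops because orders
-- are bounded.
module PrimePowerOrder {l f k′ n′ N : ℕ} (l-prime : Prime l) (l∤k′ : ¬ (l ∣ k′)) (1<N : 1 < N) where

  private
    n k m : ℕ
    n = l ^ suc f * n′
    k = l ^ f * k′
    m = N ^ (l ^ suc f) ∸ 1

    1<l : 1 < l
    1<l = ℕ.nonTrivial⇒n>1 l {{prime⇒nonTrivial l-prime}}

    instance
      N≢0 : NonZero N
      N≢0 = >-nonZero (<-trans 0<1+n 1<N)
      l≢0 : NonZero l
      l≢0 = >-nonZero (<-trans 0<1+n 1<l)

    1<N^ : ∀ j → 1 < N ^ (l ^ j)
    1<N^ j = ^-monoʳ-< N 1<N (m^n>0 l j)

    0<m : 0 < m
    0<m = m<n⇒0<n∸m (1<N^ (suc f))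

    instance
      m≢0 : NonZero m
      m≢0 = >-nonZero 0<m

    N^≡1+m : N ^ (l ^ suc f) ≡ 1 + m
    N^≡1+m = sym (m+[n∸m]≡n (<⇒≤ (1<N^ (suc f))))

    -- As l is prime, the two fields say that the order of `b` modulo `m` is exactly l ^ (s + 1).
    record Order (s b : ℕ) : Set where
      constructor order
      field
        one  : (+ b) ℤ.^ (l ^ suc s) ≋ 1ℤ [ + m ]
        ¬one : ¬ ((+ b) ℤ.^ (l ^ s) ≋ 1ℤ [ + m ])
    open Order

    start : Order f N
    start .one = ≋-intro (ℤ∣.divides 1ℤ (trans (cong (λ z → z ℤ.- 1ℤ) (trans (sym (pos-^ N (l ^ suc f))) (cong +_ N^≡1+m))) (cancel (+ m))))
      where
      cancel : ∀ z → (1ℤ ℤ.+ z) ℤ.- 1ℤ ≡ 1ℤ ℤ.* z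
      cancel = ℤ-solve
    -- The number N ^ (l ^ f) - 1 is positive and smaller than `m`, hence no multiple of it.
    start .¬one (≋-intro h) = <⇒≱ smaller (ℕ∣.∣⇒≤ {{>-nonZero (m<n⇒0<n∸m (1<N^ f))}} (subst (m ∣_) abs-value (ℤ∣.∣⇒∣ᵤ h)))
      where
      smaller : N ^ (l ^ f) ∸ 1 < m
      smaller = ℕ.∸-monoˡ-< (^-monoʳ-< N 1<N (^-monoʳ-< l 1<l (n<1+n f))) (<⇒≤ (1<N^ f))
      abs-value : ∣ (+ N) ℤ.^ (l ^ f) ℤ.- 1ℤ ∣ ≡ N ^ (l ^ f) ∸ 1
      abs-value = cong ∣_∣ (trans (cong (λ z → z ℤ.- 1ℤ) (sym (pos-^ N (l ^ f))))
        (trans (ℤ.m-n≡m⊖n (N ^ (l ^ f)) 1) (ℤ.⊖-≥ (<⇒≤ (1<N^ f)))))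

    coprime-m : ∀ {s b} → Order s b → Coprime b m
    coprime-m {s} {b} o {d} (d∣b , d∣m) = ℕ∣.∣1⇒≡1 (≋-common-divisor (b ^ (l ^ suc s)) 1
      (≋-trans (≋-reflexive (pos-^ b (l ^ suc s))) (one o)) d∣m
      (ℕ∣.∣-trans d∣b (divides-power b (l ^ suc s) (m^n>0 l (suc s)))))
      where
      divides-power : ∀ b k → 0 < k → b ∣ b ^ k
      divides-power b (suc k) _ = ℕ∣.m∣m*n (b ^ k)

    -- Otherwise two of the powers b ^ (l ^ i), 0 ≤ i ≤ s, would agree.
    bounded : ∀ {s b} → Order s b → s < m
    bounded {s} {b} o with s ℕ.<? m
    ... | yes s<m = s<m
    ... | no s≮m with Fin.pigeonhole (n<1+n m) (λ i → Fin.fromℕ< (n%ℕd<d ((+ b) ℤ.^ (l ^ toℕ i)) m))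
    ...   | i , j , i<j , eq = contradiction collapse (¬one o)
      where
      i≤s : toℕ i ≤ s
      i≤s = ≤-trans (<⇒≤ (<-≤-trans i<j (≤-pred (Fin.toℕ<n j)))) (≮⇒≥ s≮m)
      t : ℕ
      t = s ∸ toℕ i
      i+t≡s : toℕ i + t ≡ s
      i+t≡s = m+[n∸m]≡n i≤s
      s<j+t : suc s ≤ toℕ j + t
      s<j+t = subst (λ z → suc z ≤ toℕ j + t) i+t≡s (+-monoˡ-≤ t i<j)
      agree : (+ b) ℤ.^ (l ^ toℕ i) ≋ (+ b) ℤ.^ (l ^ toℕ j) [ + m ]
      agree = ≋-trans (≋-%ℕ _ m) (≋-trans (≋-reflexive (cong +_ (Fin.fromℕ<-injective _ _ _ _ eq))) (≋-sym (≋-%ℕ _ m)))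
      -- Raised to the power l ^ (s - i), the left side of `agree` becomes b ^ (l ^ s), while the
      -- exponent on the right becomes a multiple of l ^ (s + 1), at which `b` gives 1.
      collapse : (+ b) ℤ.^ (l ^ s) ≋ 1ℤ [ + m ]
      collapse = ≋-trans (≋-reflexive (sym (^-^ (+ b) (l ^ toℕ i) (l ^ t) (trans (sym (^-distribˡ-+-* l (toℕ i) t)) (cong (l ^_) i+t≡s)))))
        (≋-trans (≋-^ (l ^ t) agree)
          (≋-trans (≋-reflexive (trans (ℤ.^-*-assoc (+ b) (l ^ toℕ j) (l ^ t))
              (sym (^-^ (+ b) (l ^ suc s) (l ^ (toℕ j + t ∸ suc s)) (trans (sym (^-distribˡ-+-* l (suc s) _))
                (trans (cong (l ^_) (m+[n∸m]≡n s<j+t)) (^-distribˡ-+-* l (toℕ j) t)))))))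
            (≋-power-one (l ^ (toℕ j + t ∸ suc s)) (one o))))

    -- With c = γ ^ n′ the hypothesis yields c ^ (l ^ (f + 1 + t)) ≡ (b ^ (l ^ (f + t))) ^ k′ for
    -- every t. At t = r + 1 the right side is 1. At t = r its base has order l, and l does not
    -- divide k′, so it is not 1: the order of c has one more factor l than that of `b`.
    advance : ∀ r {b γ} → Order (f + r) b → (+ γ) ℤ.^ n ≋ (+ b) ℤ.^ k [ + m ] → Order (f + suc r) (γ ^ n′)
    advance r {b} {γ} o γⁿ≋bᵏ = order
      (≋-trans (raise (suc r) refl (sym (+-suc f r))) (≋-power-one k′ (one o)))
      (λ h → ¬one o (coprime-powers (prime∤⇒coprime l-prime l∤k′)
        (≋-trans (≋-reflexive (^-^ (+ b) (l ^ (f + r)) l (*-comm (l ^ (f + r)) l))) (one o))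
        (≋-trans (≋-sym (raise r (+-suc f r) refl)) h)))
      where
      c : ℤ
      c = + (γ ^ n′)
      c^≋ : c ℤ.^ (l ^ suc f) ≋ (+ b) ℤ.^ k [ + m ]
      c^≋ = ≋-trans (≋-reflexive (trans (cong (ℤ._^ (l ^ suc f)) (pos-^ γ n′)) (^-^ (+ γ) n′ (l ^ suc f) (*-comm n′ (l ^ suc f))))) γⁿ≋bᵏ
      raise : ∀ t {u v} → u ≡ suc f + t → v ≡ f + t → c ℤ.^ (l ^ u) ≋ ((+ b) ℤ.^ (l ^ v)) ℤ.^ k′ [ + m ]
      raise t refl refl = ≋-trans (≋-reflexive (sym (^-^ c (l ^ suc f) (l ^ t) (sym (^-distribˡ-+-* l (suc f) t)))))
        (≋-trans (≋-^ (l ^ t) c^≋) (≋-reflexive (trans (^-^ (+ b) k (l ^ t) exponent) (sym (^-^ (+ b) (l ^ (f + t)) k′ refl)))))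
        where
        regroup : ∀ x y z → x * y * z ≡ x * z * y
        regroup = ℕ-solve
        exponent : k * l ^ t ≡ l ^ (f + t) * k′
        exponent = trans (regroup (l ^ f) k′ (l ^ t)) (cong (_* k′) (sym (^-distribˡ-+-* l f t)))

    Nonresidue : Set
    Nonresidue = ∃ λ b → Coprime b m × (∀ γ → ¬ (γ ℤ.^ n ≋ (+ b) ℤ.^ k [ + m ]))

    -- The exponent f + r grows with each replacement and stays below `m` by `bounded`, so starting
    -- with fuel `m` is enough.
    search : ∀ fuel r b → Order (f + r) b → m ≤ fuel + (f + r) → Nonresidue
    search zero       r b o m≤ = contradiction m≤ (<⇒≱ (bounded o))
    search (suc fuel) r b o m≤ with Fin.any? {m} (λ γ → (+ toℕ γ) ℤ.^ n ≋? (+ b) ℤ.^ k [ + m ])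
    ... | yes (γ , h) = search fuel (suc r) (toℕ γ ^ n′) (advance r o h)
            (≤-trans m≤ (≤-reflexive (trans (sym (+-suc fuel (f + r))) (cong (λ z → fuel + z) (sym (+-suc f r))))))
    ... | no none = b , coprime-m o , λ γ h → none (Fin.fromℕ< (n%ℕd<d γ m) ,
            ≋-trans (≋-^ n (≋-trans (≋-reflexive (cong +_ (Fin.toℕ-fromℕ< (n%ℕd<d γ m)))) (≋-sym (≋-%ℕ γ m)))) h)

  nonresidue : ∃ λ m → 0 < m × Coprime m N × (∃ λ b → Coprime b m × (∀ γ → ¬ (γ ℤ.^ (l ^ suc f * n′) ≋ (+ b) ℤ.^ (l ^ f * k′) [ + m ])))
  nonresidue = m , 0<m , Coprime.sym (coprime-m start) ,
    search m 0 N (subst (λ s → Order s N) (sym (+-identityʳ f)) start) (m≤m+n m (f + 0))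

NonresidueModulo : (n N k : ℕ) → Set
NonresidueModulo n N k =
  ∃ λ m → 0 < m × Coprime m N × (∃ λ b → Coprime b m × (∀ γ → ¬ (γ ℤ.^ n ≋ (+ b) ℤ.^ k [ + m ])))

-- With d = gcd(k, n), l a prime factor of n / d and l ^ f the exact power of l
-- in d, the power l ^ (f + 1) divides n but not k.
module GCDNonresidue (n N d k₁ c : ℕ) (k₁d<n : k₁ * d < n) (0<k₁d : 0 < k₁ * d) (n≡ : n ≡ c * d) (1<N : 1 < N)
  (greatest : ∀ {i} → i ∣ k₁ * d → i ∣ n → i ∣ d) where

  private
    0<d : 0 < d
    0<d = n≢0⇒n>0 λ d≡0 → <⇒≢ 0<k₁d (sym (trans (cong (k₁ *_) d≡0) (*-zeroʳ k₁)))

    d<n : d < n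
    d<n = ≤-<-trans (ℕ∣.∣⇒≤ {{>-nonZero 0<k₁d}} (ℕ∣.n∣m*n k₁)) k₁d<n

    1<c : 1 < c
    1<c = ≰⇒> λ c≤1 → <⇒≱ d<n (≤-trans (≤-reflexive n≡) (≤-trans (*-monoˡ-≤ d c≤1) (≤-reflexive (*-identityˡ d))))

    at-power : ∀ l → Prime l → ∀ c′ → c ≡ c′ * l → ∀ f d′ → d ≡ l ^ f * d′ → ¬ (l ∣ d′) → NonresidueModulo n N (k₁ * d)
    at-power l l-prime c′ c≡ f d′ d≡ l∤d′ = subst₂ (λ x y → NonresidueModulo x N y) (sym n-shape) (sym k-shape)
      (PrimePowerOrder.nonresidue {l} {f} {k₁ * d′} {c′ * d′} {N} l-prime l∤k′ 1<N)
      where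
      instance
        l≢0 : NonZero l
        l≢0 = prime⇒nonZero l-prime
        l^f≢0 : NonZero (l ^ f)
        l^f≢0 = m^n≢0 l f
      n-shape : n ≡ l ^ suc f * (c′ * d′)
      n-shape = trans n≡ (trans (cong₂ _*_ c≡ d≡) (regroup c′ l (l ^ f) d′))
        where
        regroup : ∀ c l x d → c * l * (x * d) ≡ l * x * (c * d)
        regroup = ℕ-solve
      k-shape : k₁ * d ≡ l ^ f * (k₁ * d′)
      k-shape = trans (cong (k₁ *_) d≡) (regroup k₁ (l ^ f) d′)
        where
        regroup : ∀ k x d → k * (x * d) ≡ x * (k * d)
        regroup = ℕ-solve
      -- Otherwise l ^ (f + 1) would divide both k₁ d and n, hence also d = l ^ f d′, and l would
      -- divide d′.
      l∤k′ : ¬ (l ∣ k₁ * d′)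
      l∤k′ l∣k′ = l∤d′ (ℕ∣.*-cancelˡ-∣ (l ^ f) (subst₂ _∣_ (*-comm l (l ^ f)) d≡ (greatest
        (subst₂ _∣_ (*-comm (l ^ f) l) (sym k-shape) (ℕ∣.*-monoʳ-∣ (l ^ f) l∣k′))
        (subst (l ^ suc f ∣_) (sym n-shape) (ℕ∣.m∣m*n (c′ * d′))))))

    at-prime : (∃ λ l → Prime l × l ∣ c) → NonresidueModulo n N (k₁ * d)
    at-prime (l , l-prime , divides c′ c≡) = use (maximal-power l (ℕ.nonTrivial⇒n>1 l {{prime⇒nonTrivial l-prime}}) d 0<d)
      where
      use : (∃₂ λ f d′ → d ≡ l ^ f * d′ × ¬ (l ∣ d′)) → NonresidueModulo n N (k₁ * d)
      use (f , d′ , d≡ , l∤d′) = at-power l l-prime c′ c≡ f d′ d≡ l∤d′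

  nonresidue : NonresidueModulo n N (k₁ * d)
  nonresidue = at-prime (prime-divisor {c} 1<c)

power-nonresidue : ∀ n N k → 0 < k → k < n → 1 < N → NonresidueModulo n N k
power-nonresidue n N k 0<k k<n 1<N = from-quotients (gcd[m,n]∣m k n) (gcd[m,n]∣n k n) gcd-greatest
  where
  from-quotients : ∀ {d} → d ∣ k → d ∣ n → (∀ {i} → i ∣ k → i ∣ n → i ∣ d) → NonresidueModulo n N k
  from-quotients {d} (divides k₁ refl) (divides c n≡) greatest = GCDNonresidue.nonresidue n N d k₁ c k<n 0<k n≡ 1<N greatest

-- Besides irreducibility, `m` serves the discriminant. Since a will be a multiple of `m`, the field
-- `pred∣m` puts all primes of n - 1 into a, while `m⊥n` leaves the primes of n free to be put into
-- b.
record PowerNonresidues (n : ℕ) : Set where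
  field
    m β        : ℕ
    0<m        : 0 < m
    m⊥n        : Coprime m n
    pred∣m     : ℕ.pred n ∣ m
    β⊥m        : Coprime β m
    nonresidue : ∀ k γ → 0 < k → k < n → ¬ (γ ℤ.^ n ≋ (+ β) ℤ.^ k [ + m ])

module _ (e : ℕ) (1<n : 1 < suc e) where
  private
    n : ℕ
    n = suc e

    record Upto (K : ℕ) : Set where
      field
        m β        : ℕ
        0<m        : 0 < m
        m⊥n        : Coprime m n
        e∣m        : e ∣ m
        β⊥m        : Coprime β m
        nonresidue : ∀ k γ → 0 < k → k ≤ K → ¬ (γ ℤ.^ n ≋ (+ β) ℤ.^ k [ + m ])

    start : Upto 0
    start = record { m = e ; β = 1 ; 0<m = ≤-pred 1<n ; m⊥n = coprime-e ; e∣m = ℕ∣.∣-refl ; β⊥m = λ (d∣1 , _) → ℕ∣.∣1⇒≡1 d∣1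
                   ; nonresidue = λ k γ 0<k k≤0 → contradiction 0<k (≤⇒≯ k≤0) }
      where
      coprime-e : Coprime e n
      coprime-e {d} (d∣e , d∣n) = ℕ∣.∣1⇒≡1 (ℕ∣.∣m+n∣m⇒∣n (subst (d ∣_) (+-comm 1 e) d∣n) d∣e)

    module _ {K : ℕ} (K<e : K < e) (u : Upto K) where
      open Upto u

      extend : NonresidueModulo n (n * m) (suc K) → Upto (suc K)
      extend (m₁ , 0<m₁ , m₁⊥nm , β₁ , β₁⊥m₁ , new) = combine (chinese-remainder {m} {m₁} {{>-nonZero 0<m}} {{>-nonZero 0<m₁}}
          (Coprime.sym (coprime-∣ʳ {m₁} (ℕ∣.n∣m*n n) m₁⊥nm)) β β₁)
        where
        combine : (∃ λ z → z < m * m₁ × + z ≋ + β [ + m ] × + z ≋ + β₁ [ + m₁ ]) → Upto (suc K)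
        combine (z , _ , z≋β , z≋β₁) = record
          { m = m * m₁ ; β = z ; 0<m = *-mono-≤ 0<m 0<m₁
          ; m⊥n = Coprime.sym (coprime-*ʳ {n} (Coprime.sym m⊥n) (Coprime.sym (coprime-∣ʳ {m₁} (ℕ∣.m∣m*n m) m₁⊥nm)))
          ; e∣m = ℕ∣.∣-trans e∣m (ℕ∣.m∣m*n m₁)
          ; β⊥m = coprime-*ʳ {z} (coprime-≋ {m} {z} {β} z≋β β⊥m) (coprime-≋ {m₁} {z} {β₁} z≋β₁ β₁⊥m₁)
          ; nonresidue = λ k γ 0<k k≤1+K h → cases k γ 0<k (m≤n⇒m<n∨m≡n k≤1+K) h }
          where
          cases : ∀ k γ → 0 < k → k < suc K ⊎ k ≡ suc K → ¬ (γ ℤ.^ n ≋ (+ z) ℤ.^ k [ + (m * m₁) ])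
          cases k γ 0<k (inj₁ k<1+K) h = nonresidue k γ 0<k (≤-pred k<1+K) (≋-trans (≋-divisor (ℤ∣.∣ᵤ⇒∣ (ℕ∣.m∣m*n m₁)) h) (≋-^ k z≋β))
          cases k γ 0<k (inj₂ refl)  h = new γ (≋-trans (≋-divisor (ℤ∣.∣ᵤ⇒∣ (ℕ∣.n∣m*n m)) h) (≋-^ k z≋β₁))

      next : Upto (suc K)
      -- A new modulus coprime to n m preserves coprimality with n, and the Chinese remainder
      -- theorem can join it to the old one without disturbing the exponents already treated.
      next = extend (power-nonresidue n (n * m) (suc K) (s≤s z≤n) (s≤s K<e) (<-≤-trans 1<n (m≤m*n n m {{>-nonZero 0<m}})))

    iterate : ∀ K → K ≤ e → Upto K
    iterate zero    _   = start
    iterate (suc K) K<e = next K<e (iterate K (<⇒≤ K<e))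

  power-nonresidues : PowerNonresidues (suc e)
  power-nonresidues = record
    { m = m ; β = β ; 0<m = 0<m ; m⊥n = m⊥n ; pred∣m = e∣m ; β⊥m = β⊥m
    ; nonresidue = λ k γ 0<k k<n → nonresidue k γ 0<k (≤-pred k<n) }
    where open Upto (iterate e ≤-refl)

-- Counting and sieving

∑ : ℕ → (ℕ → ℕ) → ℕ
∑ zero    f = 0
∑ (suc k) f = f k + ∑ k f

∑-mono : ∀ k {f g} → (∀ i → i < k → f i ≤ g i) → ∑ k f ≤ ∑ k g
∑-mono zero    h = z≤n
∑-mono (suc k) h = +-mono-≤ (h k (n<1+n k)) (∑-mono k λ i i<k → h i (m<n⇒m<1+n i<k))

∑-cong : ∀ k {f g} → (∀ i → f i ≡ g i) → ∑ k f ≡ ∑ k g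
∑-cong zero    h = refl
∑-cong (suc k) h = cong₂ _+_ (h k) (∑-cong k h)

∑-+ : ∀ k f g → ∑ k (λ i → f i + g i) ≡ ∑ k f + ∑ k g
∑-+ zero    f g = refl
∑-+ (suc k) f g = trans (cong (λ x → f k + g k + x) (∑-+ k f g)) (interchange (f k) (g k) (∑ k f) (∑ k g))
  where
  interchange : ∀ a b c d → a + b + (c + d) ≡ a + c + (b + d)
  interchange = ℕ-solve

∑-* : ∀ k c f → ∑ k (λ i → c * f i) ≡ c * ∑ k f
∑-* zero    c f = sym (*-zeroʳ c)
∑-* (suc k) c f = trans (cong (λ x → c * f k + x) (∑-* k c f)) (sym (*-distribˡ-+ c (f k) (∑ k f)))

∑-const : ∀ k c → ∑ k (λ _ → c) ≡ k * c
∑-const zero    c = refl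
∑-const (suc k) c = cong (λ x → c + x) (∑-const k c)

∑-swap : ∀ k l (f : ℕ → ℕ → ℕ) → ∑ k (λ i → ∑ l (f i)) ≡ ∑ l (λ j → ∑ k (λ i → f i j))
∑-swap zero    l f = sym (trans (∑-const l 0) (*-zeroʳ l))
∑-swap (suc k) l f = trans (cong (λ x → ∑ l (f k) + x) (∑-swap k l f)) (sym (∑-+ l (f k) _))

∑-term : ∀ k f {i} → i < k → f i ≤ ∑ k f
∑-term (suc k) f {i} i<1+k with m≤n⇒m<n∨m≡n (≤-pred i<1+k)
... | inj₁ i<k  = ≤-trans (∑-term k f i<k) (m≤n+m _ (f k))
... | inj₂ refl = m≤m+n (f k) _

∑-split : ∀ k l f → ∑ (k + l) f ≡ ∑ k f + ∑ l (λ i → f (k + i))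
∑-split k zero    f = trans (cong (λ x → ∑ x f) (+-identityʳ k)) (sym (+-identityʳ _))
∑-split k (suc l) f = trans (cong (λ x → ∑ x f) (+-suc k l))
  (trans (cong (λ x → f (k + l) + x) (∑-split k l f)) (exchange (f (k + l)) (∑ k f) _))
  where
  exchange : ∀ a b c → a + (b + c) ≡ b + (a + c)
  exchange = ℕ-solve

∑-monoˡ : ∀ {k l} f → k ≤ l → ∑ k f ≤ ∑ l f
∑-monoˡ {k} {l} f k≤l = ≤-trans (m≤m+n _ _)
  (≤-reflexive (trans (sym (∑-split k (l ∸ k) f)) (cong (λ x → ∑ x f) (m+[n∸m]≡n k≤l))))

infixl 7 _div_
-- Total, with value 0 for the divisor 0, so that sums over all p may contain quotients by p * p.
_div_ : ℕ → ℕ → ℕ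
m div zero  = 0
m div suc d = m / suc d

div-* : ∀ m d → m div d * d ≤ m
div-* m zero    = z≤n
div-* m (suc d) = m/n*n≤m m (suc d)

<-suc-div : ∀ m d → 0 < d → m < suc (m div d) * d
<-suc-div m (suc d) _ = <-≤-trans (≤-<-trans (≤-reflexive (m≡m%n+[m/n]*n m (suc d)))
  (ℕ.+-monoˡ-< (m / suc d * suc d) (m%n<n m (suc d)))) ≤-refl

*≤⇒≤div : ∀ m d q → 0 < d → q * d ≤ m → q ≤ m div d
*≤⇒≤div m d q 0<d qd≤m = ≤-pred (ℕ.*-cancelʳ-< d q (suc (m div d)) (≤-<-trans qd≤m (<-suc-div m d 0<d)))

-- The first `J` indices are covered by J div L + 1 consecutive windows. The extra window is the
-- source of the rounding terms in the sieve.
∑-windows : ∀ L w f → 0 < L → (∀ t → ∑ L (λ i → f (t + i)) ≤ w) → ∀ J → ∑ J f ≤ w * suc (J div L)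
∑-windows L w f 0<L h J = ≤-trans (∑-monoˡ f (<⇒≤ (<-suc-div J L 0<L)))
  (≤-trans (blocks (suc (J div L)) 0) (≤-reflexive (*-comm (suc (J div L)) w)))
  where
  blocks : ∀ q t → ∑ (q * L) (λ i → f (t + i)) ≤ q * w
  blocks zero    t = z≤n
  blocks (suc q) t = ≤-trans (≤-reflexive (∑-split L (q * L) (λ i → f (t + i))))
    (+-mono-≤ (h t) (≤-trans (≤-reflexive (∑-cong (q * L) λ i → cong f (sym (+-assoc t L i)))) (blocks q (t + L))))

𝟙 : ∀ {P : Set} → Dec P → ℕ
𝟙 (yes _) = 1
𝟙 (no _)  = 0

𝟙-yes : ∀ {P : Set} (d : Dec P) → P → 1 ≤ 𝟙 d
𝟙-yes (yes _) _ = s≤s z≤n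
𝟙-yes (no ¬p) p = contradiction p ¬p

elements : ∀ {P : ℕ → Set} (P? : ∀ i → Dec (P i)) k →
  ∃ λ xs → All (λ i → P i × i < k) xs × AllPairs (λ i j → j < i) xs × ∑ k (λ i → 𝟙 (P? i)) ≡ length xs
elements P? zero = [] , [] , [] , refl
elements P? (suc k) with elements P? k | P? k
... | xs , ps , distinct , eq | yes p = k ∷ xs ,
        (p , n<1+n k) ∷ All.map (λ (q , i<k) → q , m<n⇒m<1+n i<k) ps , All.map proj₂ ps ∷ distinct , cong suc eq
... | xs , ps , distinct , eq | no _  = xs , All.map (λ (q , i<k) → q , m<n⇒m<1+n i<k) ps , distinct , eq

∑-𝟙-bound : ∀ {P : ℕ → Set} (P? : ∀ i → Dec (P i)) k w →
  (∀ xs → All (λ i → P i × i < k) xs → AllPairs (λ i j → j < i) xs → length xs ≤ w) → ∑ k (λ i → 𝟙 (P? i)) ≤ w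
∑-𝟙-bound P? k w h with xs , ps , distinct , eq ← elements P? k = ≤-trans (≤-reflexive eq) (h xs ps distinct)

progression-difference : ∀ s N {i j} → j ≤ i → + (s + N * i) ℤ.- + (s + N * j) ≡ + (N * (i ∸ j))
progression-difference s N {i} {j} j≤i = begin
  + (s + N * i) ℤ.- + (s + N * j)
    ≡⟨ cong (λ x → + (s + N * x) ℤ.- + (s + N * j)) (sym (m+[n∸m]≡n j≤i)) ⟩
  + (s + N * (j + (i ∸ j))) ℤ.- + (s + N * j)
    ≡⟨ cong (λ x → + x ℤ.- + (s + N * j)) (regroup s N j (i ∸ j)) ⟩
  (+ (s + N * j) ℤ.+ + (N * (i ∸ j))) ℤ.- + (s + N * j)
    ≡⟨ cancel (+ (s + N * j)) (+ (N * (i ∸ j))) ⟩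
  + (N * (i ∸ j)) ∎
  where
  open ≡-Reasoning
  regroup : ∀ s N j d → s + N * (j + d) ≡ s + N * j + N * d
  regroup = ℕ-solve
  cancel : ∀ x y → (x ℤ.+ y) ℤ.- x ≡ y
  cancel = ℤ-solve

progression-injective : ∀ s N L → Coprime L N → ∀ {i j} → i < L → j < i →
  ¬ (+ L ℤ∣.∣ + (s + N * i) ℤ.- + (s + N * j))
progression-injective s N L L⊥N {i} {j} i<L j<i h = <⇒≱ (≤-<-trans (ℕ.m∸n≤m i j) i<L)
  (ℕ∣.∣⇒≤ {{>-nonZero (m<n⇒0<n∸m j<i)}}
    (coprime-divisor {L} {N} L⊥N (ℤ∣.∣⇒∣ᵤ (subst (+ L ℤ∣.∣_) (progression-difference s N (<⇒≤ j<i)) h))))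

count-multiples : ∀ s N p → 0 < p → Coprime p N → ∀ J → ∑ J (λ j → 𝟙 (p ℕ∣.∣? (s + N * j))) ≤ suc (J div p)
count-multiples s N p 0<p p⊥N J = ≤-trans
  (∑-windows p 1 _ 0<p (λ t → ∑-𝟙-bound (λ i → p ℕ∣.∣? (s + N * (t + i))) p 1 (at-most-one t)) J)
  (≤-reflexive (*-identityˡ _))
  where
  shift : ∀ t i → s + N * (t + i) ≡ s + N * t + N * i
  shift t i = trans (cong (λ x → s + x) (*-distribˡ-+ N t i)) (sym (+-assoc s (N * t) (N * i)))
  at-most-one : ∀ t xs → All (λ i → p ∣ s + N * (t + i) × i < p) xs → AllPairs (λ i j → j < i) xs → length xs ≤ 1
  at-most-one t []            _ _ = z≤n
  at-most-one t (_ ∷ [])      _ _ = s≤s z≤n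
  at-most-one t (i ∷ j ∷ _) ((p∣i , i<p) ∷ (p∣j , _) ∷ _) ((j<i ∷ _) ∷ _) = contradiction
    (ℤ∣.∣m∣n⇒∣m-n {+ p} {+ (s + N * t + N * i)} {+ (s + N * t + N * j)}
      (ℤ∣.∣ᵤ⇒∣ (subst (p ∣_) (shift t i) p∣i)) (ℤ∣.∣ᵤ⇒∣ (subst (p ∣_) (shift t j) p∣j)))
    (progression-injective (s + N * t) N p p⊥N i<p j<i)

-- Roots modulo p and modulo p²

-- The monic polynomial of degree length cs with lower coefficients cs.
monic : List ℤ → ℤ → ℤ
monic []       x = 1ℤ
monic (c ∷ cs) x = c ℤ.+ x ℤ.* monic cs x

divide-root : ∀ c cs r → ∃ λ qs → length qs ≡ length cs ×
  (∀ x → monic (c ∷ cs) x ℤ.- monic (c ∷ cs) r ≡ (x ℤ.- r) ℤ.* monic qs x)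
divide-root c []        r = [] , refl , λ x → identity c x r
  where
  identity : ∀ c x r → (c ℤ.+ x ℤ.* 1ℤ) ℤ.- (c ℤ.+ r ℤ.* 1ℤ) ≡ (x ℤ.- r) ℤ.* 1ℤ
  identity = ℤ-solve
divide-root c (d ∷ cs) r with divide-root d cs r
... | qs , length-qs , eq = monic (d ∷ cs) r ∷ qs , cong suc length-qs , λ x →
    trans (telescope c x r (monic (d ∷ cs) x) (monic (d ∷ cs) r))
      (trans (cong (λ z → (x ℤ.- r) ℤ.* monic (d ∷ cs) r ℤ.+ x ℤ.* z) (eq x)) (factor (x ℤ.- r) (monic (d ∷ cs) r) x (monic qs x)))
  where
  telescope : ∀ c x r u v → (c ℤ.+ x ℤ.* u) ℤ.- (c ℤ.+ r ℤ.* v) ≡ (x ℤ.- r) ℤ.* v ℤ.+ x ℤ.* (u ℤ.- v)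
  telescope = ℤ-solve
  factor : ∀ y v x q → y ℤ.* v ℤ.+ x ℤ.* (y ℤ.* q) ≡ y ℤ.* (v ℤ.+ x ℤ.* q)
  factor = ℤ-solve

lagrange : ∀ {p} → Prime p → ∀ cs xs → All (λ x → + p ℤ∣.∣ monic cs x) xs →
  AllPairs (λ x y → ¬ (+ p ℤ∣.∣ y ℤ.- x)) xs → length xs ≤ length cs
lagrange pr cs       []       _        _            = z≤n
lagrange pr []       (x ∷ xs) (h ∷ _) _             = contradiction (subst Prime (ℕ∣.∣1⇒≡1 (ℤ∣.∣⇒∣ᵤ h)) pr) ¬prime[1]
lagrange {p} pr (c ∷ cs) (x ∷ xs) (h ∷ hs) (d ∷ ds) with divide-root c cs x
... | qs , length-qs , eq = s≤s (subst (length xs ≤_) length-qs (lagrange pr qs xs (All.zipWith quotient-root (hs , d)) ds))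
  where
  quotient-root : ∀ {y} → (+ p ℤ∣.∣ monic (c ∷ cs) y) × ¬ (+ p ℤ∣.∣ y ℤ.- x) → + p ℤ∣.∣ monic qs y
  quotient-root {y} (hy , p∤) with euclid-ℤ pr (y ℤ.- x) (monic qs y) (subst (+ p ℤ∣.∣_) (eq y) (ℤ∣.∣m∣n⇒∣m-n {+ p} {monic (c ∷ cs) y} hy h))
  ... | inj₁ p∣ = contradiction p∣ p∤
  ... | inj₂ p∣ = p∣

geometric : ℕ → ℤ → ℤ → ℤ
geometric zero    x y = 0ℤ
geometric (suc k) x y = x ℤ.^ k ℤ.+ y ℤ.* geometric k x y

difference-of-powers : ∀ k x y → x ℤ.^ k ℤ.- y ℤ.^ k ≡ (x ℤ.- y) ℤ.* geometric k x y
difference-of-powers zero    x y = sym (ℤ.*-zeroʳ (x ℤ.- y))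
difference-of-powers (suc k) x y = trans (telescope x y (x ℤ.^ k) (y ℤ.^ k))
  (trans (cong (λ z → (x ℤ.- y) ℤ.* x ℤ.^ k ℤ.+ y ℤ.* z) (difference-of-powers k x y)) (factor (x ℤ.- y) (x ℤ.^ k) y (geometric k x y)))
  where
  telescope : ∀ x y u v → x ℤ.* u ℤ.- y ℤ.* v ≡ (x ℤ.- y) ℤ.* u ℤ.+ y ℤ.* (u ℤ.- v)
  telescope = ℤ-solve
  factor : ∀ d u y g → d ℤ.* u ℤ.+ y ℤ.* (d ℤ.* g) ≡ d ℤ.* (u ℤ.+ y ℤ.* g)
  factor = ℤ-solve

-- On the diagonal the sum is the derivative k y ^ (k - 1); the extra factor `y` avoids the exponent
-- k - 1.
geometric-≋ : ∀ {m} k x y → x ≋ y [ m ] → y ℤ.* geometric k x y ≋ + k ℤ.* y ℤ.^ k [ m ]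
geometric-≋ zero    x y h = ≋-reflexive (ℤ.*-zeroʳ y)
geometric-≋ (suc k) x y h = ≋-trans (≋-reflexive (ℤ.*-distribˡ-+ y (x ℤ.^ k) (y ℤ.* geometric k x y)))
  (≋-trans (≋-+ (≋-* {x = y} (≋-reflexive refl) (≋-^ k h)) (≋-* {x = y} (≋-reflexive refl) (geometric-≋ k x y h)))
    (≋-reflexive (collect y (y ℤ.^ k) (+ k))))
  where
  collect : ∀ y u k → y ℤ.* u ℤ.+ y ℤ.* (k ℤ.* u) ≡ (1ℤ ℤ.+ k) ℤ.* (y ℤ.* u)
  collect = ℤ-solve

prime∤^ : ∀ {p} → Prime p → ∀ y k → ¬ (+ p ℤ∣.∣ y) → ¬ (+ p ℤ∣.∣ y ℤ.^ k)
prime∤^ pr y zero    p∤y h = ¬prime[1] (subst Prime (ℕ∣.∣1⇒≡1 (ℤ∣.∣⇒∣ᵤ h)) pr)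
prime∤^ pr y (suc k) p∤y h = [ p∤y , prime∤^ pr y k p∤y ]′ (euclid-ℤ pr y (y ℤ.^ k) h)

square-coprime-divisor : ∀ {p} → Prime p → ∀ x y → ¬ (+ p ℤ∣.∣ x) → + (p * p) ℤ∣.∣ x ℤ.* y → + (p * p) ℤ∣.∣ y
square-coprime-divisor {p} pr x y p∤x h = ℤ∣.∣ᵤ⇒∣ (coprime-divisor {p * p} {∣ x ∣} pp⊥x
  (subst (p * p ∣_) (ℤ.abs-* x y) (ℤ∣.∣⇒∣ᵤ h)))
  where
  x⊥p : Coprime ∣ x ∣ p
  x⊥p = Coprime.sym (prime∤⇒coprime pr (p∤x ∘ ℤ∣.∣ᵤ⇒∣))
  pp⊥x : Coprime (p * p) ∣ x ∣
  pp⊥x = Coprime.sym (coprime-*ʳ {∣ x ∣} x⊥p x⊥p)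

-- Uniqueness of the Hensel lift: x ^ k - y ^ k is x - y times `geometric k x y`, and the latter is
-- prime to p, because y times it is congruent to k y ^ k. Therefore p² divides the factor x - y.
hensel-unique : ∀ {p} → Prime p → ∀ k x y → ¬ (p ∣ k) → ¬ (+ p ℤ∣.∣ y) → + p ℤ∣.∣ x ℤ.- y →
  + (p * p) ℤ∣.∣ x ℤ.^ k ℤ.- y ℤ.^ k → + (p * p) ℤ∣.∣ x ℤ.- y
hensel-unique {p} pr k x y p∤k p∤y p∣x-y h = square-coprime-divisor pr (geometric k x y) (x ℤ.- y) p∤geometric
  (subst (+ (p * p) ℤ∣.∣_) (trans (difference-of-powers k x y) (ℤ.*-comm (x ℤ.- y) (geometric k x y))) h)
  where
  p∤geometric : ¬ (+ p ℤ∣.∣ geometric k x y)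
  p∤geometric p∣g = [ (λ p∣k → p∤k (ℤ∣.∣⇒∣ᵤ p∣k)) , prime∤^ pr y k p∤y ]′ (euclid-ℤ pr (+ k) (y ℤ.^ k) p∣kyᵏ)
    where
    p∣kyᵏ : + p ℤ∣.∣ + k ℤ.* y ℤ.^ k
    p∣kyᵏ = ≋0⇒∣ (≋-trans {y = y ℤ.* geometric k x y} (≋-sym (geometric-≋ k x y (≋-intro p∣x-y))) (∣⇒≋0 (ℤ∣.∣n⇒∣m*n y p∣g)))

-- The condition that p does not divide `b` makes `b` a simple root modulo p. For the pairs that
-- survive the sieve, primes dividing the discriminant satisfy it by `discriminant-prime`.
SquareDivides : ℕ → ℤ → ℕ → ℤ → ℕ → Set
SquareDivides k c p v b = ¬ (p ∣ b) × p * p ∣ ∣ c ℤ.* (+ b) ℤ.^ k ℤ.+ v ∣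

squareDivides? : ∀ k c p v b → Dec (SquareDivides k c p v b)
squareDivides? k c p v b = ¬? (p ℕ∣.∣? b) ×-dec (p * p ℕ∣.∣? ∣ c ℤ.* (+ b) ℤ.^ k ℤ.+ v ∣)

-- Inside a window of p² indices all bad values have the same k-th power modulo p². By
-- `hensel-unique` two of them that agree modulo p agree modulo p², which their indices forbid. So
-- they are distinct roots modulo p of one polynomial of degree k, and `lagrange` bounds their
-- number.
count-square-divisors : ∀ {p} → Prime p → ∀ k c v s N → ¬ (p ∣ k) → ¬ (+ p ℤ∣.∣ c) → ¬ (p ∣ N) → ∀ J →
  ∑ J (λ j → 𝟙 (squareDivides? k c p v (s + N * j))) ≤ k * suc (J div (p * p))
count-square-divisors {p} pr zero c v s N p∤k p∤c p∤N J = contradiction (p ℕ∣.∣0) p∤k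
count-square-divisors {p} pr k@(suc k′) c v s N p∤k p∤c p∤N J = ∑-windows (p * p) k _ (*-mono-≤ 0<p 0<p)
  (λ t → ∑-𝟙-bound (λ i → squareDivides? k c p v (s + N * (t + i))) (p * p) k (window t)) J
  where
  0<p : 0 < p
  0<p = >-nonZero⁻¹ p {{prime⇒nonZero pr}}
  N⊥p : Coprime N p
  N⊥p = Coprime.sym (prime∤⇒coprime pr p∤N)
  value : ℕ → ℕ → ℤ
  value t i = + (s + N * t + N * i)
  shift : ∀ t i → + (s + N * (t + i)) ≡ value t i
  shift t i = cong +_ (trans (cong (λ x → s + x) (*-distribˡ-+ N t i)) (sym (+-assoc s (N * t) (N * i))))

  P : ℕ → ℕ → Set
  P t i = SquareDivides k c p v (s + N * (t + i)) × i < p * p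

  same-power : ∀ t {i j} → P t i → P t j → + (p * p) ℤ∣.∣ value t i ℤ.^ k ℤ.- value t j ℤ.^ k
  same-power t {i} {j} ((_ , hi) , _) ((_ , hj) , _) = square-coprime-divisor pr c _ p∤c
    (subst (+ (p * p) ℤ∣.∣_) (trans (cancel c ((+ (s + N * (t + i))) ℤ.^ k) ((+ (s + N * (t + j))) ℤ.^ k) v)
        (cong₂ (λ x y → c ℤ.* (x ℤ.^ k ℤ.- y ℤ.^ k)) (shift t i) (shift t j)))
      (ℤ∣.∣m∣n⇒∣m-n {+ (p * p)} {c ℤ.* (+ (s + N * (t + i))) ℤ.^ k ℤ.+ v} (ℤ∣.∣ᵤ⇒∣ hi) (ℤ∣.∣ᵤ⇒∣ hj)))
    where
    cancel : ∀ c x y v → (c ℤ.* x ℤ.+ v) ℤ.- (c ℤ.* y ℤ.+ v) ≡ c ℤ.* (x ℤ.- y)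
    cancel = ℤ-solve

  incongruent : ∀ t {i j} → P t i → P t j → j < i → ¬ (+ p ℤ∣.∣ value t j ℤ.- value t i)
  incongruent t {i} {j} Pi Pj j<i h = progression-injective (s + N * t) N (p * p) (Coprime.sym (coprime-*ʳ {N} N⊥p N⊥p)) (proj₂ Pi) j<i
    (hensel-unique pr k (value t i) (value t j) p∤k
      (λ p∣ → proj₁ (proj₁ Pj) (ℤ∣.∣⇒∣ᵤ (subst (+ p ℤ∣.∣_) (sym (shift t j)) p∣)))
      (≋-elim (≋-sym {x = value t j} {value t i} (≋-intro h))) (same-power t Pi Pj))

  root-coefficients : ℤ → List ℤ
  root-coefficients y = ℤ.- (y ℤ.^ k) ∷ replicate k′ 0ℤ

  monic-power : ∀ l x → monic (replicate l 0ℤ) x ≡ x ℤ.^ l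
  monic-power zero    x = refl
  monic-power (suc l) x = trans (ℤ.+-identityˡ _) (cong (λ z → x ℤ.* z) (monic-power l x))

  window : ∀ t xs → All (P t) xs → AllPairs (λ i j → j < i) xs → length xs ≤ k
  window t []          _         _        = z≤n
  window t xs@(i ∷ is) (Pi ∷ Ps) distinct = subst₂ _≤_ (List.length-map (value t) xs) (cong suc (List.length-replicate k′))
    (lagrange pr (root-coefficients (value t i)) (map (value t) xs)
      (All.map⁺ (All.map root (Pi ∷ Ps))) (AllPairs.map⁺ (pairs (Pi ∷ Ps) distinct)))
    where
    root : ∀ {j} → P t j → + p ℤ∣.∣ monic (root-coefficients (value t i)) (value t j)
    root {j} Pj = ℤ∣.∣-trans (ℤ∣.∣ᵤ⇒∣ (ℕ∣.m∣m*n p)) (subst (+ (p * p) ℤ∣.∣_)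
      (trans (ℤ.+-comm _ (ℤ.- (value t i ℤ.^ k))) (cong (λ z → ℤ.- (value t i ℤ.^ k) ℤ.+ value t j ℤ.* z) (sym (monic-power k′ (value t j)))))
      (same-power t Pj Pi))
    pairs : ∀ {xs} → All (P t) xs → AllPairs (λ i j → j < i) xs → AllPairs (λ i j → ¬ (+ p ℤ∣.∣ value t j ℤ.- value t i)) xs
    pairs [] [] = []
    pairs (Pi ∷ Ps) (d ∷ ds) = All.zipWith (λ (Pj , j<i) → incongruent t Pi Pj j<i) (Ps , d) ∷ pairs Ps ds

unique-pairs : ∀ {P : ℕ → ℕ → Set} (P? : ∀ i j → Dec (P i j)) I J →
  ∃ λ xs → Unique xs × All (λ (i , j) → P i j × i < I × j < J) xs × ∑ I (λ i → ∑ J (λ j → 𝟙 (P? i j))) ≡ length xs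
unique-pairs P? zero    J = [] , [] , [] , refl
unique-pairs P? (suc I) J with unique-pairs P? I J | elements (P? I) J
... | xs , unique , ps , eq | js , qs , distinct , eq′ = map (I ,_) js ++ xs ,
  AllPairs.++⁺ (AllPairs.map⁺ (AllPairs.map (λ j<i eq → <⇒≢ j<i (sym (cong proj₂ eq))) distinct)) unique
    (All.map⁺ (All.universal (λ j → All.map (λ (_ , i<I , _) eq → <⇒≢ i<I (sym (cong proj₁ eq))) ps) js)) ,
  All.++⁺ (All.map⁺ (All.map (λ (p , j<J) → p , n<1+n I , j<J) qs))
    (All.map (λ (p , i<I , j<J) → p , m<n⇒m<1+n i<I , j<J) ps) ,
  trans (cong₂ _+_ (trans eq′ (sym (List.length-map (I ,_) js))) eq) (sym (List.length-++ (map (I ,_) js)))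

-- The sieve over pairs of progressions

large? : ∀ z p → Dec (Prime p × z < p)
large? z p = prime? p ×-dec (z ℕ.<? p)

large : ℕ → ℕ → ℕ
large z p = 𝟙 (large? z p)

𝟙≤1 : ∀ {P : Set} (d : Dec P) → 𝟙 d ≤ 1
𝟙≤1 (yes _) = ≤-refl
𝟙≤1 (no _)  = z≤n

large-≤ : ∀ z p → p ≤ z → large z p ≡ 0
large-≤ z p p≤z with large? z p
... | yes (_ , z<p) = contradiction z<p (≤⇒≯ p≤z)
... | no _          = refl

-- Telescoping 1 / p ^ 2 ≤ 1 / (p - 1) - 1 / p.
∑-inverse-squares : ∀ z → 0 < z → ∀ M T → z * ∑ T (λ p → large z p * (M div (p * p))) ≤ M
∑-inverse-squares z 0<z M T = ≤-trans (*-monoʳ-≤ z (∑-monoˡ f (≤-trans (m≤n+m T (suc z)) ≤-refl)))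
  (*-cancelˡ-≤ (z + T) {{>-nonZero (<-≤-trans 0<z (m≤m+n z T))}} (≤-trans
    (≤-reflexive (regroup (z + T) z (∑ (suc (z + T)) f)))
    (≤-trans (telescope T) (≤-trans (*-monoʳ-≤ M (m≤n+m T z)) (≤-reflexive (*-comm M (z + T)))))))
  where
  f : ℕ → ℕ
  f p = large z p * (M div (p * p))
  regroup : ∀ q z s → q * (z * s) ≡ z * q * s
  regroup = ℕ-solve
  f-zero : ∀ k → k ≤ suc z → ∑ k f ≡ 0
  f-zero zero    _     = refl
  f-zero (suc k) k≤z = cong₂ _+_ (cong (_* (M div (k * k))) (large-≤ z k (≤-pred k≤z))) (f-zero k (m≤n⇒m≤1+n (≤-pred k≤z)))
  f-≤ : ∀ p → f p * (p * p) ≤ M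
  f-≤ p = ≤-trans (*-monoˡ-≤ (p * p) (≤-trans (*-monoˡ-≤ (M div (p * p)) (𝟙≤1 (large? z p))) (≤-reflexive (*-identityˡ _))))
    (div-* M (p * p))
  -- In fractions: the sum over p up to z + d is at most M (1 / z - 1 / (z + d)).
  telescope : ∀ d → z * (z + d) * ∑ (suc (z + d)) f ≤ M * d
  telescope zero = ≤-reflexive (trans (cong (z * (z + 0) *_) (f-zero (suc (z + 0)) (s≤s (≤-reflexive (+-identityʳ z)))))
    (trans (*-zeroʳ (z * (z + 0))) (sym (*-zeroʳ M))))
  telescope (suc d) rewrite +-suc z d = *-cancelˡ-≤ q {{>-nonZero (<-≤-trans 0<z (m≤m+n z d))}} (begin
    q * (z * suc q * (t + S))                  ≡⟨ distribute q z t S ⟩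
    z * (t * (q * suc q)) + suc q * (z * q * S) ≤⟨ +-mono-≤ (*-monoʳ-≤ z (≤-trans (*-monoʳ-≤ t (*-monoˡ-≤ (suc q) (n≤1+n q))) (f-≤ (suc q))))
                                                   (*-monoʳ-≤ (suc q) (telescope d)) ⟩
    z * M + suc q * (M * d)                    ≡⟨ collect z d M ⟩
    q * (M * suc d)                            ∎)
    where
    open ℕ.≤-Reasoning
    q t S : ℕ
    q = z + d
    t = f (suc q)
    S = ∑ (suc q) f
    distribute : ∀ q z t S → q * (z * suc q * (t + S)) ≡ z * (t * (q * suc q)) + suc q * (z * q * S)
    distribute = ℕ-solve
    collect : ∀ z d M → z * M + suc (z + d) * (M * d) ≡ (z + d) * (M * suc d)
    collect = ℕ-solve

-- Four error terms are each held to an eighth of I J, so half of the pairs survive. The conditions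
-- `32≤z` and `16e≤z` control the sums of 1 / p² for common primes and for squares; `24K≤I` and
-- `16eY≤J` control the corresponding rounding terms. Both signs of `v` are sieved at once, whence 2
-- e classes for each p.
module Sieve
  (e N z α β I J Y T K : ℕ) (c : ℤ) (v : ℕ → ℤ)
  (p∤e : ∀ p → Prime p → z < p → ¬ (p ∣ e))
  (p∤c : ∀ p → Prime p → z < p → ¬ (+ p ℤ∣.∣ c))
  (p∤N : ∀ p → Prime p → z < p → ¬ (p ∣ N))
  (32≤z : 32 ≤ z) (16e≤z : 16 * e ≤ z) (0<I : 0 < I) (I≤J : I ≤ J)
  (T≤ : T ≤ K * suc I) (24K≤I : 24 * K ≤ I) (16eY≤J : 16 * e * Y ≤ J) where

  a b : ℕ → ℕ
  a i = α + N * i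
  b j = β + N * j

  common : ℕ → ℕ → ℕ → ℕ
  common p i j = large z p * (𝟙 (p ℕ∣.∣? a i) * 𝟙 (p ℕ∣.∣? b j))

  square : ℕ → ℕ → ℕ → ℕ
  square p i j = large z p * (𝟙 (squareDivides? e c p (v i) (b j)) + 𝟙 (squareDivides? e c p (ℤ.- v i) (b j)))

  weight : ℕ → ℕ → ℕ
  weight i j = ∑ T (λ p → common p i j) + ∑ Y (λ p → square p i j)

  private
    0<z : 0 < z
    0<z = <-≤-trans (s≤s z≤n) 32≤z

    large-cases : ∀ p {x y : ℕ} → (Prime p → z < p → x ≤ y) → large z p * x ≤ large z p * y
    large-cases p h with large? z p
    ... | yes (pr , z<p) = *-monoʳ-≤ 1 (h pr z<p)
    ... | no _           = z≤n

    -- For p ≤ I, rounding up costs at most a factor 2 in each count. For p > I at most one `a i` is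
    -- a multiple of p, and the multiples among the `b j` number at most J / (I + 1) + 1. This bound
    -- does not depend on p and is affordable because T is of the order of I.
    common-bound : ∀ p → ∑ I (λ i → ∑ J (common p i)) ≤ 4 * (large z p * ((I * J) div (p * p))) + suc (J div suc I)
    common-bound p = begin
      ∑ I (λ i → ∑ J (common p i))
        ≡⟨ ∑-cong I (λ i → trans (∑-* J (large z p) (λ j → 𝟙 (p ℕ∣.∣? a i) * 𝟙 (p ℕ∣.∣? b j)))
             (trans (cong (large z p *_) (trans (∑-* J (𝟙 (p ℕ∣.∣? a i)) (λ j → 𝟙 (p ℕ∣.∣? b j))) (*-comm (𝟙 (p ℕ∣.∣? a i)) multiples-b)))
               (sym (*-assoc (large z p) multiples-b (𝟙 (p ℕ∣.∣? a i)))))) ⟩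
      ∑ I (λ i → large z p * multiples-b * 𝟙 (p ℕ∣.∣? a i))
        ≡⟨ ∑-* I (large z p * multiples-b) (λ i → 𝟙 (p ℕ∣.∣? a i)) ⟩
      large z p * multiples-b * ∑ I (λ i → 𝟙 (p ℕ∣.∣? a i))
        ≡⟨ *-assoc (large z p) multiples-b _ ⟩
      large z p * (multiples-b * ∑ I (λ i → 𝟙 (p ℕ∣.∣? a i)))
        ≤⟨ large-cases p (λ pr z<p → let 0<p = >-nonZero⁻¹ p {{prime⇒nonZero pr}} ; p⊥N = prime∤⇒coprime pr (p∤N p pr z<p) in
             *-mono-≤ (count-multiples β N p 0<p p⊥N J) (count-multiples α N p 0<p p⊥N I)) ⟩
      large z p * (suc (J div p) * suc (I div p))
        ≤⟨ arithmetic ⟩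
      4 * (large z p * ((I * J) div (p * p))) + suc (J div suc I) ∎
      where
      open ℕ.≤-Reasoning
      multiples-b : ℕ
      multiples-b = ∑ J (λ j → 𝟙 (p ℕ∣.∣? b j))
      double : ∀ x → 1 ≤ x → suc x ≤ 2 * x
      double x 1≤x = +-mono-≤ 1≤x (m≤m+n x 0)
      arithmetic : large z p * (suc (J div p) * suc (I div p)) ≤ 4 * (large z p * ((I * J) div (p * p))) + suc (J div suc I)
      arithmetic with large? z p
      ... | no _ = z≤n
      ... | yes (pr , _) with p ℕ.≤? I
      ...   | yes p≤I = ≤-trans (begin
                1 * (suc (J div p) * suc (I div p))    ≡⟨ *-identityˡ _ ⟩
                suc (J div p) * suc (I div p)          ≤⟨ *-mono-≤ (double _ (1≤div (≤-trans p≤I I≤J))) (double _ (1≤div p≤I)) ⟩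
                2 * (J div p) * (2 * (I div p))        ≡⟨ four (J div p) (I div p) ⟩
                4 * (1 * (I div p * (J div p)))        ≤⟨ *-monoʳ-≤ 4 (*-monoʳ-≤ 1 (*≤⇒≤div (I * J) (p * p) (I div p * (J div p)) (*-mono-≤ 0<p 0<p)
                                                            (≤-trans (≤-reflexive (pair (I div p) (J div p) p)) (*-mono-≤ (div-* I p) (div-* J p))))) ⟩
                4 * (1 * ((I * J) div (p * p)))        ∎) (m≤m+n _ _)
        where
        0<p : 0 < p
        0<p = >-nonZero⁻¹ p {{prime⇒nonZero pr}}
        1≤div : ∀ {M} → p ≤ M → 1 ≤ M div p
        1≤div {M} p≤M = *≤⇒≤div M p 1 0<p (≤-trans (≤-reflexive (*-identityˡ p)) p≤M)
        four : ∀ x y → 2 * x * (2 * y) ≡ 4 * (1 * (y * x))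
        four = ℕ-solve
        pair : ∀ x y p → x * y * (p * p) ≡ x * p * (y * p)
        pair = ℕ-solve
      ...   | no p≰I = ≤-trans (begin
                1 * (suc (J div p) * suc (I div p))    ≡⟨ cong (λ x → 1 * (suc (J div p) * suc x)) I/p≡0 ⟩
                1 * (suc (J div p) * 1)                ≡⟨ trans (*-identityˡ _) (ℕ.*-identityʳ _) ⟩
                suc (J div p)                          ≤⟨ s≤s (*≤⇒≤div J (suc I) (J div p) (s≤s z≤n) (≤-trans (*-monoʳ-≤ (J div p) (≰⇒> p≰I)) (div-* J p))) ⟩
                suc (J div suc I)                      ∎) (m≤n+m _ _)
        where
        I/p≡0 : I div p ≡ 0
        I/p≡0 with I div p in eq
        ... | zero  = refl
        ... | suc q = contradiction (≤-trans (≤-trans (m≤m+n p (q * p)) (≤-reflexive (cong (_* p) (sym eq)))) (div-* I p)) p≰I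

    common-total : 8 * ∑ I (λ i → ∑ J (λ j → ∑ T (λ p → common p i j))) ≤ 2 * (I * J)
    common-total = begin
      8 * ∑ I (λ i → ∑ J (λ j → ∑ T (λ p → common p i j)))
        ≡⟨ cong (8 *_) (trans (∑-cong I λ i → ∑-swap J T (λ j p → common p i j)) (∑-swap I T (λ i p → ∑ J (common p i)))) ⟩
      8 * ∑ T (λ p → ∑ I (λ i → ∑ J (common p i)))
        ≤⟨ *-monoʳ-≤ 8 (∑-mono T λ p _ → common-bound p) ⟩
      8 * ∑ T (λ p → 4 * (large z p * ((I * J) div (p * p))) + suc q)
        ≡⟨ cong (8 *_) (trans (∑-+ T (λ p → 4 * (large z p * ((I * J) div (p * p)))) (λ _ → suc q)) (cong₂ _+_ (∑-* T 4 _) (∑-const T (suc q)))) ⟩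
      8 * (4 * S + T * suc q)
        ≡⟨ distribute S T q ⟩
      32 * S + 8 * (T * suc q)
        ≤⟨ +-mono-≤ (≤-trans (*-monoˡ-≤ S 32≤z) (∑-inverse-squares z 0<z (I * J) T))
             (*-monoʳ-≤ 8 (*-monoˡ-≤ (suc q) T≤)) ⟩
      I * J + 8 * (K * suc I * suc q)
        ≡⟨ cong (λ x → I * J + x) (regroup K I q) ⟩
      I * J + 8 * K * (q * suc I + suc I)
        ≤⟨ +-monoʳ-≤ (I * J) (*-monoʳ-≤ (8 * K) (+-mono-≤ (div-* J (suc I)) (+-mono-≤ 0<J I≤J))) ⟩
      I * J + 8 * K * (J + (J + J))
        ≡⟨ cong (λ x → I * J + x) (triple K J) ⟩
      I * J + 24 * K * J
        ≤⟨ +-monoʳ-≤ (I * J) (*-monoˡ-≤ J 24K≤I) ⟩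
      I * J + I * J
        ≡⟨ cong (λ x → I * J + x) (sym (+-identityʳ (I * J))) ⟩
      2 * (I * J) ∎
      where
      open ℕ.≤-Reasoning
      q S : ℕ
      q = J div suc I
      S = ∑ T (λ p → large z p * ((I * J) div (p * p)))
      0<J : 0 < J
      0<J = <-≤-trans 0<I I≤J
      distribute : ∀ S T q → 8 * (4 * S + T * suc q) ≡ 32 * S + 8 * (T * suc q)
      distribute = ℕ-solve
      regroup : ∀ K I q → 8 * (K * suc I * suc q) ≡ 8 * K * (q * suc I + suc I)
      regroup = ℕ-solve
      triple : ∀ K J → 8 * K * (J + (J + J)) ≡ 24 * K * J
      triple = ℕ-solve

    square-row : ∀ i → 8 * ∑ J (λ j → ∑ Y (λ p → square p i j)) ≤ 2 * J
    square-row i = begin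
      8 * ∑ J (λ j → ∑ Y (λ p → square p i j))
        ≡⟨ cong (8 *_) (∑-swap J Y (λ j p → square p i j)) ⟩
      8 * ∑ Y (λ p → ∑ J (square p i))
        ≤⟨ *-monoʳ-≤ 8 (∑-mono Y λ p _ → square-bound p) ⟩
      8 * ∑ Y (λ p → 2 * e * (large z p * (J div (p * p))) + 2 * e)
        ≡⟨ cong (8 *_) (trans (∑-+ Y (λ p → 2 * e * (large z p * (J div (p * p)))) (λ _ → 2 * e)) (cong₂ _+_ (∑-* Y (2 * e) _) (∑-const Y (2 * e)))) ⟩
      8 * (2 * e * S + Y * (2 * e))
        ≡⟨ distribute e S Y ⟩
      16 * e * S + 16 * e * Y
        ≤⟨ +-mono-≤ (≤-trans (*-monoˡ-≤ S 16e≤z) (∑-inverse-squares z 0<z J Y)) 16eY≤J ⟩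
      J + J
        ≡⟨ cong (λ x → J + x) (sym (+-identityʳ J)) ⟩
      2 * J ∎
      where
      open ℕ.≤-Reasoning
      S : ℕ
      S = ∑ Y (λ p → large z p * (J div (p * p)))
      distribute : ∀ e S Y → 8 * (2 * e * S + Y * (2 * e)) ≡ 16 * e * S + 16 * e * Y
      distribute = ℕ-solve
      square-bound : ∀ p → ∑ J (square p i) ≤ 2 * e * (large z p * (J div (p * p))) + 2 * e
      square-bound p = begin
        ∑ J (square p i)
          ≡⟨ trans (∑-* J (large z p) _) (cong (large z p *_) (∑-+ J _ _)) ⟩
        large z p * (∑ J (λ j → 𝟙 (squareDivides? e c p (v i) (b j))) + ∑ J (λ j → 𝟙 (squareDivides? e c p (ℤ.- v i) (b j))))
          ≤⟨ large-cases p (λ pr z<p → +-mono-≤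
               (count-square-divisors pr e c (v i) β N (p∤e p pr z<p) (p∤c p pr z<p) (p∤N p pr z<p) J)
               (count-square-divisors pr e c (ℤ.- v i) β N (p∤e p pr z<p) (p∤c p pr z<p) (p∤N p pr z<p) J)) ⟩
        large z p * (e * suc (J div (p * p)) + e * suc (J div (p * p)))
          ≡⟨ twice (large z p) e (J div (p * p)) ⟩
        2 * e * (large z p * (J div (p * p))) + large z p * (2 * e)
          ≤⟨ +-monoʳ-≤ (2 * e * (large z p * (J div (p * p)))) (≤-trans (*-monoˡ-≤ (2 * e) (𝟙≤1 (large? z p))) (≤-reflexive (*-identityˡ (2 * e)))) ⟩
        2 * e * (large z p * (J div (p * p))) + 2 * e ∎
        where
        twice : ∀ l e x → l * (e * suc x + e * suc x) ≡ 2 * e * (l * x) + l * (2 * e)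
        twice = ℕ-solve

    total : ℕ
    total = ∑ I (λ i → ∑ J (weight i))

    2*total≤ : 2 * total ≤ I * J
    2*total≤ = *-cancelˡ-≤ 4 (begin
      4 * (2 * total)
        ≡⟨ trans (sym (*-assoc 4 2 total)) (cong (8 *_) (trans (∑-cong I λ i → ∑-+ J _ _) (∑-+ I _ _))) ⟩
      8 * (∑ I (λ i → ∑ J (λ j → ∑ T (λ p → common p i j))) + ∑ I (λ i → ∑ J (λ j → ∑ Y (λ p → square p i j))))
        ≡⟨ *-distribˡ-+ 8 (∑ I (λ i → ∑ J (λ j → ∑ T (λ p → common p i j)))) _ ⟩
      8 * ∑ I (λ i → ∑ J (λ j → ∑ T (λ p → common p i j))) + 8 * ∑ I (λ i → ∑ J (λ j → ∑ Y (λ p → square p i j)))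
        ≤⟨ +-mono-≤ common-total (begin
             8 * ∑ I (λ i → ∑ J (λ j → ∑ Y (λ p → square p i j)))  ≡⟨ ∑-* I 8 _ ⟨
             ∑ I (λ i → 8 * ∑ J (λ j → ∑ Y (λ p → square p i j)))  ≤⟨ ∑-mono I (λ i _ → square-row i) ⟩
             ∑ I (λ _ → 2 * J)                                     ≡⟨ ∑-const I (2 * J) ⟩
             I * (2 * J)                                           ∎) ⟩
      2 * (I * J) + I * (2 * J)
        ≡⟨ collect I J ⟩
      4 * (I * J) ∎)
      where
      open ℕ.≤-Reasoning
      collect : ∀ I J → 2 * (I * J) + I * (2 * J) ≡ 4 * (I * J)
      collect = ℕ-solve

  -- A pair that does not survive has weight at least 1, and the weights sum to at most I J / 2.
  survivors : ∃ λ xs → Unique xs × All (λ (i , j) → weight i j ≡ 0 × i < I × j < J) xs × I * J ≤ 2 * length xs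
  survivors with unique-pairs (λ i j → weight i j ℕ.≟ 0) I J
  ... | xs , unique , good , eq = xs , unique , good , ℕ.+-cancelʳ-≤ (I * J) (I * J) (2 * length xs) (begin
    I * J + I * J                  ≤⟨ +-mono-≤ covered covered ⟩
    (G + total) + (G + total)      ≡⟨ double G total ⟩
    2 * G + 2 * total              ≤⟨ +-mono-≤ (≤-reflexive (cong (2 *_) eq)) 2*total≤ ⟩
    2 * length xs + I * J          ∎)
    where
    open ℕ.≤-Reasoning
    G : ℕ
    G = ∑ I (λ i → ∑ J (λ j → 𝟙 (weight i j ℕ.≟ 0)))
    double : ∀ g t → (g + t) + (g + t) ≡ 2 * g + 2 * t
    double = ℕ-solve
    one : ∀ w → 1 ≤ 𝟙 (w ℕ.≟ 0) + w
    one zero    = s≤s z≤n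
    one (suc w) = ≤-trans (s≤s z≤n) (m≤n+m (suc w) (𝟙 (suc w ℕ.≟ 0)))
    covered : I * J ≤ G + total
    covered = begin
      I * J
        ≡⟨ trans (∑-const I J) refl ⟨
      ∑ I (λ _ → J)
        ≡⟨ ∑-cong I (λ _ → trans (∑-const J 1) (ℕ.*-identityʳ J)) ⟨
      ∑ I (λ _ → ∑ J (λ _ → 1))
        ≤⟨ ∑-mono I (λ i _ → ∑-mono J λ j _ → one (weight i j)) ⟩
      ∑ I (λ i → ∑ J (λ j → 𝟙 (weight i j ℕ.≟ 0) + weight i j))
        ≡⟨ trans (∑-cong I λ i → ∑-+ J _ _) (∑-+ I _ _) ⟩
      G + total ∎

  survivor-coprime : ∀ {i j p} → weight i j ≡ 0 → Prime p → z < p → p < T → p ∣ a i → ¬ (p ∣ b j)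
  survivor-coprime {i} {j} {p} w≡0 pr z<p p<T p∣a p∣b = contradiction
    (≤-trans (*-mono-≤ (𝟙-yes (large? z p) (pr , z<p)) (*-mono-≤ (𝟙-yes (p ℕ∣.∣? a i) p∣a) (𝟙-yes (p ℕ∣.∣? b j) p∣b)))
      (≤-trans (∑-term T (λ p → common p i j) p<T) (≤-reflexive (ℕ.m+n≡0⇒m≡0 _ w≡0))))
    λ ()

  survivor-square⁺ : ∀ {i j p} → weight i j ≡ 0 → Prime p → z < p → p < Y → ¬ SquareDivides e c p (v i) (b j)
  survivor-square⁺ {i} {j} {p} w≡0 pr z<p p<Y h = contradiction
    (≤-trans (*-mono-≤ (𝟙-yes (large? z p) (pr , z<p)) (≤-trans (𝟙-yes (squareDivides? e c p (v i) (b j)) h) (m≤m+n _ _)))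
      (≤-trans (∑-term Y (λ p → square p i j) p<Y) (≤-reflexive (ℕ.m+n≡0⇒n≡0 (∑ T (λ p → common p i j)) w≡0))))
    λ ()

  survivor-square⁻ : ∀ {i j p} → weight i j ≡ 0 → Prime p → z < p → p < Y → ¬ SquareDivides e c p (ℤ.- v i) (b j)
  survivor-square⁻ {i} {j} {p} w≡0 pr z<p p<Y h = contradiction
    (≤-trans (*-mono-≤ (𝟙-yes (large? z p) (pr , z<p)) (≤-trans (𝟙-yes (squareDivides? e c p (ℤ.- v i) (b j)) h) (m≤n+m _ (𝟙 (squareDivides? e c p (v i) (b j))))))
      (≤-trans (∑-term Y (λ p → square p i j) p<Y) (≤-reflexive (ℕ.m+n≡0⇒n≡0 (∑ T (λ p → common p i j)) w≡0))))
    λ ()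

-- Real numbers and the abc inequality

fraction-< : ∀ {u v w x} → u * suc x < w * suc v → + u ℚ./ suc v ℚ.< + w ℚ./ suc x
fraction-< {u} {v} {w} {x} h = ℚ.toℚᵘ-cancel-< (ℚᵘ.<-respˡ-≃ (ℚᵘ.≃-sym (ℚ.toℚᵘ-fromℚᵘ (mkℚᵘ (+ u) v)))
  (ℚᵘ.<-respʳ-≃ (ℚᵘ.≃-sym (ℚ.toℚᵘ-fromℚᵘ (mkℚᵘ (+ w) x)))
    (ℚᵘ.*<* (subst₂ ℤ._<_ (ℤ.pos-* u (suc x)) (ℤ.pos-* w (suc v)) (ℤ.+<+ h)))))

fraction-<⁻¹ : ∀ {u v w x} → + u ℚ./ suc v ℚ.< + w ℚ./ suc x → u * suc x < w * suc v
fraction-<⁻¹ {u} {v} {w} {x} h with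
  ℚᵘ.<-respˡ-≃ (ℚ.toℚᵘ-fromℚᵘ (mkℚᵘ (+ u) v)) (ℚᵘ.<-respʳ-≃ (ℚ.toℚᵘ-fromℚᵘ (mkℚᵘ (+ w) x)) (ℚ.toℚᵘ-mono-< h))
... | ℚᵘ.*<* k = ℤ.drop‿+<+ (subst₂ ℤ._<_ (sym (ℤ.pos-* u (suc x))) (sym (ℤ.pos-* w (suc v))) k)

fromℚ : ℚ → ℝ
fromℚ q = record
  { lower      = ℚ._< q
  ; upper      = q ℚ.<_
  ; inhabitedˡ = q ℚ.- ℚ.1ℚ , below
  ; inhabitedᵘ = q ℚ.+ ℚ.1ℚ , above
  ; roundedˡ   = λ p → mk⇔ (λ p<q → let r , p<r , r<q = ℚ.<-dense p<q in r , p<r , r<q) (λ (r , p<r , r<q) → ℚ.<-trans p<r r<q)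
  ; roundedᵘ   = λ p → mk⇔ (λ q<p → let r , q<r , r<p = ℚ.<-dense q<p in r , r<p , q<r) (λ (r , r<p , q<r) → ℚ.<-trans q<r r<p)
  ; disjoint   = λ p p<q q<p → ℚ.<-asym p<q q<p
  ; located    = λ {p} {r} p<r → locate p r p<r
  }
  where
  above : q ℚ.< q ℚ.+ ℚ.1ℚ
  above = subst (ℚ._< q ℚ.+ ℚ.1ℚ) (ℚ.+-identityʳ q) (ℚ.+-monoʳ-< q {0ℚ} {ℚ.1ℚ} (fraction-< {0} {0} {1} {0} (s≤s z≤n)))
  below : q ℚ.- ℚ.1ℚ ℚ.< q
  below = subst (q ℚ.- ℚ.1ℚ ℚ.<_) (ℚ.+-identityʳ q) (ℚ.+-monoʳ-< q {ℚ.- ℚ.1ℚ} {0ℚ} (ℚ.negative⁻¹ (ℚ.- ℚ.1ℚ)))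
  locate : ∀ p r → p ℚ.< r → p ℚ.< q ⊎ q ℚ.< r
  locate p r p<r with ℚ.<-cmp p q
  ... | tri< p<q _ _  = inj₁ p<q
  ... | tri≈ _ refl _ = inj₂ p<r
  ... | tri> _ _ q<p  = inj₂ (ℚ.<-trans q<p p<r)

lower<upper : ∀ (x : ℝ) {p q} → lower x p → upper x q → p ℚ.< q
lower<upper x {p} {q} lp uq with ℚ.<-cmp p q
... | tri< p<q _ _  = p<q
... | tri≈ _ refl _ = ⊥-elim (disjoint x p lp uq)
... | tri> _ _ q<p  = ⊥-elim (disjoint x q (Equivalence.from (roundedˡ x q) (p , q<p , lp)) uq)

q<1+∣↥q∣ : ∀ q → q ℚ.< + suc ∣ ℚ.↥ q ∣ ℚ./ 1
q<1+∣↥q∣ q@(mkℚ n d _) = subst (ℚ._< + suc ∣ n ∣ ℚ./ 1) (ℚ.↥p/↧p≡p q)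
  (ℚ.toℚᵘ-cancel-< (ℚᵘ.<-respˡ-≃ (ℚᵘ.≃-sym (ℚ.toℚᵘ-fromℚᵘ (mkℚᵘ n d)))
    (ℚᵘ.<-respʳ-≃ (ℚᵘ.≃-sym (ℚ.toℚᵘ-fromℚᵘ (mkℚᵘ (+ suc ∣ n ∣) 0))) (ℚᵘ.*<* (numerators n)))))
  where
  numerators : ∀ n → n ℤ.* 1ℤ ℤ.< + suc ∣ n ∣ ℤ.* + suc d
  numerators (+ k) = subst₂ ℤ._<_ (sym (ℤ.*-identityʳ (+ k))) (ℤ.pos-* (suc k) (suc d))
    (ℤ.+<+ (<-≤-trans (n<1+n k) (m≤m*n (suc k) (suc d))))
  numerators ℤ.-[1+ k ] = subst (ℤ._< + suc (suc k) ℤ.* + suc d) (sym (ℤ.*-identityʳ ℤ.-[1+ k ])) ℤ.-<+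

natural-upper-bound : ∀ x → ∃ λ u → upper x (+ u ℚ./ 1)
natural-upper-bound x with inhabitedᵘ x
... | q , uq = suc ∣ ℚ.↥ q ∣ , Equivalence.from (roundedᵘ x _) (q , q<1+∣↥q∣ q , uq)

-- A positive rational with denominator d + 1 is at least 1 / (d + 1), hence exceeds 1 / (d + 2).
unit-lower-bound : ∀ x → Positive x → ∃ λ d → lower x (+ 1 ℚ./ suc (suc d))
unit-lower-bound x pos with Equivalence.to (roundedˡ x 0ℚ) pos
... | q@(mkℚ (+ suc n) d _) , _ , lq = d , Equivalence.from (roundedˡ x _) (q , subst (+ 1 ℚ./ suc (suc d) ℚ.<_) (ℚ.↥p/↧p≡p q)
        (fraction-< {1} {suc d} {suc n} {d} (≤-trans (≤-reflexive (cong suc (+-identityʳ (suc d)))) (m≤m+n (suc (suc d)) (n * suc (suc d))))) , lq)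
... | q@(mkℚ (+ zero) d _)   , 0<q , _ = contradiction (ℚ.drop-*<* 0<q) λ { (ℤ.+<+ ()) }
... | q@(mkℚ ℤ.-[1+ n ] d _) , 0<q , _ = contradiction (ℚ.drop-*<* 0<q) λ ()

*-^ : ∀ k x y → (x * y) ^ k ≡ x ^ k * y ^ k
*-^ zero    x y = refl
*-^ (suc k) x y = trans (cong (λ z → x * y * z) (*-^ k x y)) (interchange x y (x ^ k) (y ^ k))
  where
  interchange : ∀ a b c d → a * b * (c * d) ≡ a * c * (b * d)
  interchange = ℕ-solve

^-cancel-< : ∀ k {x y} → x ^ k < y ^ k → x < y
^-cancel-< k xᵏ<yᵏ = ≰⇒> λ y≤x → <⇒≱ xᵏ<yᵏ (^-monoˡ-≤ k y≤x)

-- A fraction 1 / D below δ replaces the real exponent once and for all: every rational p / (k + 1)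
-- > δ exceeds 1 / D, so A ^ (1 + 1 / D) < B, and this is raised to the power D.
uniform-exponent : ∀ δ → Positive δ → ∃ λ D → 0 < D × (∀ A B → 1 < A → A ^1+ δ < B → A ^ suc D < B ^ D)
uniform-exponent δ pos with unit-lower-bound δ pos
... | d , 1/D<δ = D , s≤s z≤n , bound
  where
  D : ℕ
  D = suc (suc d)
  bound : ∀ A B → 1 < A → A ^1+ δ < B → A ^ suc D < B ^ D
  bound A B 1<A (p , k , δ<p/k , h) = ^-cancel-< (suc k) (begin-strict
    (A ^ suc D) ^ suc k      ≡⟨ ^-*-assoc A (suc D) (suc k) ⟩
    A ^ (suc D * suc k)      ≤⟨ ^-monoʳ-≤ A {{>-nonZero (<-trans 0<1+n 1<A)}} exponents ⟩
    A ^ ((suc k + p) * D)    ≡⟨ ^-*-assoc A (suc k + p) D ⟨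
    (A ^ (suc k + p)) ^ D    <⟨ ℕ.^-monoˡ-< D h ⟩
    (B ^ suc k) ^ D          ≡⟨ trans (^-*-assoc B (suc k) D) (trans (cong (B ^_) (*-comm (suc k) D)) (sym (^-*-assoc B D (suc k)))) ⟩
    (B ^ D) ^ suc k          ∎)
    where
    open ℕ.≤-Reasoning
    k<pD : 1 * suc k < p * D
    k<pD = fraction-<⁻¹ {1} {suc d} {p} {k} (lower<upper δ 1/D<δ δ<p/k)
    exponents : suc D * suc k ≤ (suc k + p) * D
    exponents = begin
      suc D * suc k            ≡⟨ expand-left D (suc k) ⟩
      suc k * D + 1 * suc k    ≤⟨ +-monoʳ-≤ (suc k * D) (<⇒≤ k<pD) ⟩
      suc k * D + p * D        ≡⟨ ℕ.*-distribʳ-+ D (suc k) p ⟨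
      (suc k + p) * D          ∎
      where
      expand-left : ∀ D k → suc D * k ≡ k * D + 1 * k
      expand-left = ℕ-solve

prime∣product : ∀ {p} ps y → 0 < y → Unique (p ∷ ps) → All (λ p → Prime p × p ∣ y) (p ∷ ps) → product (p ∷ ps) ∣ y
prime∣product {p} ps y 0<y (p∉ps ∷ unique) ((pr , p∣y) ∷ hs) = step (rest ps unique hs)
  where
  rest : ∀ ps → Unique ps → All (λ p → Prime p × p ∣ y) ps → product ps ∣ y
  rest []       _      _  = ℕ∣.1∣ y
  rest (q ∷ qs) unique hs = prime∣product qs y 0<y unique hs
  step : product ps ∣ y → product (p ∷ ps) ∣ y
  step (divides q y≡) with euclidsLemma q (product ps) pr (subst (p ∣_) y≡ p∣y)
  ... | inj₁ (divides q′ q≡) = divides q′ (trans y≡ (trans (cong (_* product ps) q≡) (*-assoc q′ p (product ps))))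
  ... | inj₂ p∣ps = ⊥-elim (All.lookup p∉ps (factorisationHasAllPrimeFactors pr p∣ps (All.map proj₁ hs)) refl)

-- The radical is a product of distinct primes that all divide `y`, so it divides `y`.
radical-≤ : ∀ x y → 0 < y → (∀ p → Prime p → p ∣ x → p ∣ y) → radical x ≤ y
radical-≤ x y 0<y h = ℕ∣.∣⇒≤ {{>-nonZero 0<y}} (go _ (Unique.filter⁺ P? (Unique.upTo⁺ (suc x)))
  (All.map (λ (pr , p∣x) → pr , h _ pr p∣x) (All.all-filter P? (upTo (suc x)))))
  where
  P? : ∀ p → Dec (Prime p × p ∣ x)
  P? p = prime? p ×-dec (p ℕ∣.∣? x)
  go : ∀ ps → Unique ps → All (λ p → Prime p × p ∣ y) ps → product ps ∣ y
  go []       _      _  = ℕ∣.1∣ y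
  go (p ∷ ps) unique hs = prime∣product ps y 0<y unique hs

abc-power : ABC → ∀ E → 0 < E → ∃ λ u → ∀ a b c → 0 < a → 0 < b → 0 < c →
  Coprime a b → Coprime a c → Coprime b c → a + b ≡ c → c ^ E ≤ u ^ E * radical (a * b * c) ^ suc E
-- The approximations in `_≤_·_^1+_` lie strictly above the exponent. Taking ε = 1 / (E + 1) makes 1
-- / E admissible, and 1 + 1 / E becomes the pair of powers E and E + 1.
abc-power abc E@(suc k) _ with abc (fromℚ (+ 1 ℚ./ suc E)) (fraction-< {0} {0} {1} {E} (s≤s z≤n))
... | C , bound with natural-upper-bound C
...   | u , C<u = u , λ a b c 0<a 0<b 0<c ab ac bc eq →
  subst₂ (λ x y → x ^ E ≤ u ^ E * radical (a * b * c) ^ y) (*-identityˡ c) (cong suc (+-comm k 1))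
    (bound a b c 0<a 0<b 0<c ab ac bc eq u 0 1 k C<u (fraction-< {1} {E} {1} {k} (ℕ.*-monoʳ-< 1 (n<1+n E))))

coprime-by-primes : ∀ {x y} → 0 < x → (∀ l → Prime l → l ∣ x → l ∣ y → ⊥) → Coprime x y
coprime-by-primes {x} {y} 0<x h {zero} (0∣x , _) = contradiction (ℕ∣.0∣⇒≡0 0∣x) (<⇒≢ 0<x ∘ sym)
coprime-by-primes {x} {y} 0<x h {suc zero} _ = refl
coprime-by-primes {x} {y} 0<x h {suc (suc d)} (d∣x , d∣y) with prime-divisor {suc (suc d)} (s≤s (s≤s z≤n))
... | l , pr , l∣d = ⊥-elim (h l pr (ℕ∣.∣-trans l∣d d∣x) (ℕ∣.∣-trans l∣d d∣y))

prime∣square : ∀ {l} x → Prime l → l ∣ x * x → l ∣ x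
prime∣square x pr h = [ id , id ]′ (euclidsLemma x x pr h)

-- The abc inequality for y² + (x + y)(x - y) = x², with x = y + d, when both
-- x + y and x - y have a square factor.
module DifferenceOfSquares {E u : ℕ} (0<E : 0 < E)
  (abc : ∀ a b c → 0 < a → 0 < b → 0 < c → Coprime a b → Coprime a c → Coprime b c → a + b ≡ c →
    c ^ E ≤ u ^ E * radical (a * b * c) ^ suc E)
  {y d r p q g h : ℕ} (0<y : 0 < y) (0<d : 0 < d) (x⊥y : Coprime (y + d) y)
  (0<r : 0 < r) (primes∣r : ∀ l → Prime l → (l ∣ (y + d)) ⊎ (l ∣ y) → l ∣ r)
  (x+y≡ : y + d + y ≡ g * (p * p)) (d≡ : d ≡ h * (q * q)) where

  private
    x R : ℕ
    x = y + d
    R = radical (y * y * ((x + y) * d) * (x * x))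

    0<x : 0 < x
    0<x = <-≤-trans 0<y (m≤m+n y d)

    identity : y * y + (x + y) * d ≡ x * x
    identity = lemma y d
      where
      lemma : ∀ y d → y * y + (y + d + y) * d ≡ (y + d) * (y + d)
      lemma = ℕ-solve

    no-common : ∀ l → Prime l → l ∣ x → l ∣ y → ⊥
    no-common l pr l∣x l∣y = ¬prime[1] (subst Prime (x⊥y (l∣x , l∣y)) pr)

    y²⊥x² : Coprime (y * y) (x * x)
    y²⊥x² = coprime-by-primes (*-mono-≤ 0<y 0<y) λ l pr l∣y² l∣x² → no-common l pr (prime∣square x pr l∣x²) (prime∣square y pr l∣y²)

    factor-cases : ∀ l → Prime l → l ∣ (x + y) * d → (l ∣ x + y) ⊎ (l ∣ d)
    factor-cases l pr = euclidsLemma (x + y) d pr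

    y²⊥ : Coprime (y * y) ((x + y) * d)
    y²⊥ = coprime-by-primes (*-mono-≤ 0<y 0<y) λ l pr l∣y² l∣ → let l∣y = prime∣square y pr l∣y² in
      [ (λ l∣x+y → no-common l pr (ℕ∣.∣m+n∣m⇒∣n (subst (l ∣_) (+-comm x y) l∣x+y) l∣y) l∣y)
      , (λ l∣d → no-common l pr (ℕ∣.∣m∣n⇒∣m+n l∣y l∣d) l∣y) ]′ (factor-cases l pr l∣)

    ⊥x² : Coprime ((x + y) * d) (x * x)
    ⊥x² = coprime-by-primes (*-mono-≤ (<-≤-trans 0<x (m≤m+n x y)) 0<d) λ l pr l∣ l∣x² → let l∣x = prime∣square x pr l∣x² in
      [ (λ l∣x+y → no-common l pr l∣x (ℕ∣.∣m+n∣m⇒∣n l∣x+y l∣x))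
      , (λ l∣d → no-common l pr l∣x (ℕ∣.∣m+n∣m⇒∣n (subst (l ∣_) (+-comm y d) l∣x) l∣d)) ]′ (factor-cases l pr l∣)

    bound : (x * x) ^ E ≤ u ^ E * R ^ suc E
    bound = abc (y * y) ((x + y) * d) (x * x) (*-mono-≤ 0<y 0<y)
      (*-mono-≤ (<-≤-trans 0<x (m≤m+n x y)) 0<d) (*-mono-≤ 0<x 0<x) y²⊥ y²⊥x² ⊥x² identity

    positive-factor : ∀ {m n} a → 0 < m → m ≡ n * (a * a) → 0 < n * a
    positive-factor {m} {n} a 0<m m≡ = n≢0⇒n>0 λ na≡0 → <⇒≢ 0<m (sym (trans m≡ (trans (sym (*-assoc n a a)) (cong (_* a) na≡0))))

    square-prime : ∀ {m n} a l → Prime l → m ≡ n * (a * a) → l ∣ m → l ∣ n * a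
    square-prime {m} {n} a l pr m≡ l∣m = [ id , ℕ∣.∣n⇒∣m*n n ]′
      (euclidsLemma (n * a) a pr (subst (l ∣_) (trans m≡ (sym (*-assoc n a a))) l∣m))

    -- The primes of x + y = g p² all divide g p, and those of d = h q² divide h q: each square
    -- saves one factor. The squares of x and y contribute only primes of `r`.
    R≤ : R ≤ r * ((g * p) * (h * q))
    R≤ = radical-≤ _ _ (*-mono-≤ 0<r (*-mono-≤ (positive-factor {n = g} p 0<x+y x+y≡) (positive-factor {n = h} q 0<d d≡))) λ l pr l∣ →
      [ (λ l∣₁ → [ (λ l∣y² → from-r (primes∣r l pr (inj₂ (prime∣square y pr l∣y²))))
                 , (λ l∣₂ → ℕ∣.∣n⇒∣m*n r ([ (λ l∣x+y → ℕ∣.∣m⇒∣m*n (h * q) (square-prime {n = g} p l pr x+y≡ l∣x+y))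
                                          , (λ l∣d → ℕ∣.∣n⇒∣m*n (g * p) (square-prime {n = h} q l pr d≡ l∣d)) ]′ (factor-cases l pr l∣₂))) ]′
                 (euclidsLemma (y * y) ((x + y) * d) pr l∣₁))
      , (λ l∣x² → from-r (primes∣r l pr (inj₁ (prime∣square x pr l∣x²)))) ]′ (euclidsLemma (y * y * ((x + y) * d)) (x * x) pr l∣)
      where
      0<x+y : 0 < x + y
      0<x+y = <-≤-trans 0<x (m≤m+n x y)
      from-r : ∀ {l} → l ∣ r → l ∣ r * ((g * p) * (h * q))
      from-r = ℕ∣.∣m⇒∣m*n ((g * p) * (h * q))

    Rpq≤ : R * (p * q) ≤ r * (x * x)
    Rpq≤ = begin
      R * (p * q)                            ≤⟨ *-monoˡ-≤ (p * q) R≤ ⟩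
      r * ((g * p) * (h * q)) * (p * q)      ≡⟨ regroup r g p h q ⟩
      r * ((g * (p * p)) * (h * (q * q)))    ≡⟨ cong₂ (λ s t → r * (s * t)) x+y≡ d≡ ⟨
      r * ((x + y) * d)                      ≤⟨ *-monoʳ-≤ r (≤-trans (m≤n+m ((x + y) * d) (y * y)) (≤-reflexive identity)) ⟩
      r * (x * x)                            ∎
      where
      open ℕ.≤-Reasoning
      regroup : ∀ r g p h q → r * ((g * p) * (h * q)) * (p * q) ≡ r * ((g * (p * p)) * (h * (q * q)))
      regroup = ℕ-solve

  -- By `Rpq≤` the factor (p q) ^ (E + 1) turns the power of the radical in the abc bound into (r
  -- x²) ^ (E + 1). Cancelling (x²) ^ E leaves a single factor x², negligible when E is large.
  square-factors-≤ : (p * q) ^ suc E ≤ u ^ E * r ^ suc E * (x * x)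
  square-factors-≤ = *-cancelˡ-≤ ((x * x) ^ E) {{m^n≢0 (x * x) E {{>-nonZero (*-mono-≤ 0<x 0<x)}}}} (begin
    (x * x) ^ E * (p * q) ^ suc E
      ≤⟨ *-monoˡ-≤ ((p * q) ^ suc E) bound ⟩
    u ^ E * R ^ suc E * (p * q) ^ suc E
      ≡⟨ trans (*-assoc (u ^ E) (R ^ suc E) _) (cong (u ^ E *_) (sym (*-^ (suc E) R (p * q)))) ⟩
    u ^ E * (R * (p * q)) ^ suc E
      ≤⟨ *-monoʳ-≤ (u ^ E) (^-monoˡ-≤ (suc E) Rpq≤) ⟩
    u ^ E * (r * (x * x)) ^ suc E
      ≡⟨ cong (u ^ E *_) (*-^ (suc E) r (x * x)) ⟩
    u ^ E * (r ^ suc E * (x * x * (x * x) ^ E))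
      ≡⟨ regroup (u ^ E) (r ^ suc E) (x * x) ((x * x) ^ E) ⟩
    (x * x) ^ E * (u ^ E * r ^ suc E * (x * x)) ∎)
    where
    open ℕ.≤-Reasoning
    regroup : ∀ a b c d → a * (b * (c * d)) ≡ d * (a * b * c)
    regroup = ℕ-solve

-- Choosing the residue classes

square-factor? : ∀ x → 0 < x → (∀ d → d * d ∣ x → d ≡ 1) ⊎ (∃ λ p → Prime p × p * p ∣ x)
square-factor? x 0<x = decide (Fin.any? {suc x} λ i → ¬? (toℕ i ℕ.≟ 1) ×-dec (toℕ i * toℕ i ℕ∣.∣? x))
  where
  0<d : ∀ d → d * d ∣ x → 0 < d
  0<d zero    0∣x = contradiction (ℕ∣.0∣⇒≡0 0∣x) (<⇒≢ 0<x ∘ sym)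
  0<d (suc d) _   = s≤s z≤n
  from-prime : ∀ {d} → d * d ∣ x → (∃ λ p → Prime p × p ∣ d) → ∃ λ p → Prime p × p * p ∣ x
  from-prime dd∣x (p , pr , p∣d) = p , pr , ℕ∣.∣-trans (ℕ∣.*-pres-∣ p∣d p∣d) dd∣x
  decide : Dec (∃ λ (i : Fin (suc x)) → toℕ i ≢ 1 × toℕ i * toℕ i ∣ x) → (∀ d → d * d ∣ x → d ≡ 1) ⊎ (∃ λ p → Prime p × p * p ∣ x)
  decide (yes (i , i≢1 , ii∣x)) = inj₂ (from-prime ii∣x (prime-divisor (ℕ.≤∧≢⇒< (0<d (toℕ i) ii∣x) (i≢1 ∘ sym))))
  decide (no none) = inj₁ squarefree
    where
    squarefree : ∀ d → d * d ∣ x → d ≡ 1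
    squarefree d dd∣x = by-cases (d ℕ.≟ 1)
      where
      d<1+x : d < suc x
      d<1+x = s≤s (≤-trans (m≤m*n d d {{>-nonZero (0<d d dd∣x)}}) (ℕ∣.∣⇒≤ {{>-nonZero 0<x}} dd∣x))
      by-cases : Dec (d ≡ 1) → d ≡ 1
      by-cases (yes d≡1) = d≡1
      by-cases (no d≢1) = contradiction (Fin.fromℕ< d<1+x ,
        subst (λ k → k ≢ 1 × k * k ∣ x) (sym (Fin.toℕ-fromℕ< d<1+x)) (d≢1 , dd∣x)) none

-- Only its set of prime factors matters: the primes up to the second argument that do not divide
-- `m`.
coprimeProduct : ℕ → ℕ → ℕ
coprimeProduct m zero    = 1
coprimeProduct m (suc k) with coprime? (suc k) m
... | yes _ = suc k * coprimeProduct m k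
... | no _  = coprimeProduct m k

coprimeProduct>0 : ∀ m k → 0 < coprimeProduct m k
coprimeProduct>0 m zero    = s≤s z≤n
coprimeProduct>0 m (suc k) with coprime? (suc k) m
... | yes _ = *-mono-≤ (s≤s (z≤n {k})) (coprimeProduct>0 m k)
... | no _  = coprimeProduct>0 m k

coprimeProduct-coprime : ∀ m k → Coprime m (coprimeProduct m k)
coprimeProduct-coprime m zero    (_ , d∣1) = ℕ∣.∣1⇒≡1 d∣1
coprimeProduct-coprime m (suc k) with coprime? (suc k) m
... | yes c = coprime-*ʳ {m} {suc k} (Coprime.sym c) (coprimeProduct-coprime m k)
... | no _  = coprimeProduct-coprime m k

∣-coprimeProduct : ∀ m k {q} → 0 < q → q ≤ k → Coprime q m → q ∣ coprimeProduct m k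
∣-coprimeProduct m zero    0<q q≤0 _ = contradiction 0<q (≤⇒≯ q≤0)
∣-coprimeProduct m (suc k) {q} 0<q q≤1+k c with coprime? (suc k) m | m≤n⇒m<n∨m≡n q≤1+k
... | yes _ | inj₁ q≤k  = ℕ∣.∣n⇒∣m*n (suc k) (∣-coprimeProduct m k 0<q (≤-pred q≤k) c)
... | yes _ | inj₂ refl = ℕ∣.m∣m*n (coprimeProduct m k)
... | no _  | inj₁ q≤k  = ∣-coprimeProduct m k 0<q (≤-pred q≤k) c
... | no ¬c | inj₂ refl = ⊥-elim (¬c c)

prime∣coprimeProduct : ∀ m k {p} → Prime p → p ∣ coprimeProduct m k → p ≤ k
prime∣coprimeProduct m zero    pr p∣1 = contradiction (subst Prime (ℕ∣.∣1⇒≡1 p∣1) pr) ¬prime[1]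
prime∣coprimeProduct m (suc k) pr p∣ with coprime? (suc k) m
... | no _  = m≤n⇒m≤1+n (prime∣coprimeProduct m k pr p∣)
... | yes _ with euclidsLemma (suc k) (coprimeProduct m k) pr p∣
...   | inj₁ p∣1+k = ℕ∣.∣⇒≤ p∣1+k
...   | inj₂ p∣rest = m≤n⇒m≤1+n (prime∣coprimeProduct m k pr p∣rest)

prime∣^ : ∀ {p} → Prime p → ∀ x k → p ∣ x ^ k → p ∣ x
prime∣^ pr x zero    p∣1 = contradiction (subst Prime (ℕ∣.∣1⇒≡1 p∣1) pr) ¬prime[1]
prime∣^ pr x (suc k) p∣  = [ id , prime∣^ pr x k ]′ (euclidsLemma x (x ^ k) pr p∣)

-- The progression `first` + N i inside the interval from A to 2 A. Starting at the multiple of N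
-- above A costs one step and the residue r ≤ N another; these are the 2 taken off `size`.
module Window (N A r : ℕ) (0<N : 0 < N) (r≤N : r ≤ N) where

  first size : ℕ
  first = r + N * suc (A div N)
  size  = A div N ∸ 2

  window-≥ : ∀ i → A ≤ first + N * i
  window-≥ i = begin
    A                       ≤⟨ <⇒≤ (<-suc-div A N 0<N) ⟩
    suc (A div N) * N       ≡⟨ *-comm (suc (A div N)) N ⟩
    N * suc (A div N)       ≤⟨ m≤n+m (N * suc (A div N)) r ⟩
    first                   ≤⟨ m≤m+n first (N * i) ⟩
    first + N * i           ∎
    where open ℕ.≤-Reasoning

  window-≤ : ∀ i → i < size → first + N * i ≤ 2 * A
  window-≤ i i<size = begin
    r + N * suc k + N * i   ≤⟨ +-monoˡ-≤ (N * i) (+-monoˡ-≤ (N * suc k) r≤N) ⟩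
    N + N * suc k + N * i   ≡⟨ collect N k i ⟩
    N * (k + (2 + i))       ≤⟨ *-monoʳ-≤ N (+-monoʳ-≤ k 2+i≤k) ⟩
    N * (k + k)             ≡⟨ double N k ⟩
    2 * (k * N)             ≤⟨ *-monoʳ-≤ 2 (div-* A N) ⟩
    2 * A                   ∎
    where
    open ℕ.≤-Reasoning
    k : ℕ
    k = A div N
    below : ∀ k i → i < k ∸ 2 → 2 + i ≤ k
    below (suc (suc k)) i i<k = s≤s (s≤s (<⇒≤ i<k))
    2+i≤k : 2 + i ≤ k
    2+i≤k = below k i i<size
    collect : ∀ N k i → N + N * suc k + N * i ≡ N * (k + (2 + i))
    collect = ℕ-solve
    double : ∀ N k → N * (k + k) ≡ 2 * (k * N)
    double = ℕ-solve

  A<N*[size+3] : A < N * (size + 3)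
  A<N*[size+3] = <-≤-trans (<-suc-div A N 0<N) (≤-trans (≤-reflexive (*-comm (suc (A div N)) N))
    (*-monoʳ-≤ N (≤-trans (s≤s (≤-trans (ℕ.m≤n+m∸n (A div N) 2) (≤-reflexive (+-comm 2 size)))) (≤-reflexive (sym (+-suc size 2))))))

-- E is chosen so that, after A ^ (D + 1) ≤ B ^ D has removed A, all powers of B
-- but one cancel.
module Exponents (n D Q u r₁ k₂ : ℕ) where

  E κ : ℕ
  E = 2 * n * suc D
  κ = (Q * Q) ^ suc E * (u ^ E * r₁ ^ suc E * (k₂ * k₂))

  -- From B² ≤ Q² p q one gets B ^ (E + 1) ≤ κ A ^ (E + 1) B ^ (2 n). In the power D + 1 of this, B
  -- ^ (2 n) becomes B ^ E by the choice of `E`, and A is replaced by B. The exponent (E + 1) (D +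
  -- 1) on the left exceeds D (E + 1) + E on the right by exactly 1.
  B-bounded : ∀ {A B p q r x} → 0 < B → A ^ suc D ≤ B ^ D → B ≤ Q * p → B ≤ Q * q →
    (p * q) ^ suc E ≤ u ^ E * r ^ suc E * (x * x) → r ≤ r₁ * (A * B) → x ≤ k₂ * B ^ n → B ≤ κ ^ suc D
  B-bounded {A} {B} {p} {q} {r} {x} 0<B A^≤B^ B≤Qp B≤Qq pq≤ r≤ x≤ =
    ℕ.*-cancelʳ-≤ B (κ ^ suc D) (B ^ (D * suc E) * B ^ E)
      {{m*n≢0 (B ^ (D * suc E)) (B ^ E) {{m^n≢0 B (D * suc E)}} {{m^n≢0 B E}}}} (begin
      B * (B ^ (D * suc E) * B ^ E)
        ≡⟨ trans (assoc B (B ^ (D * suc E)) (B ^ E)) (sym (^-distribˡ-+-* B (suc E) (D * suc E))) ⟩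
      B ^ (suc E + D * suc E)
        ≡⟨ trans (cong (B ^_) (*-comm (suc D) (suc E))) (sym (^-*-assoc B (suc E) (suc D))) ⟩
      (B ^ suc E) ^ suc D
        ≤⟨ ^-monoˡ-≤ (suc D) one-power ⟩
      (κ * (A ^ suc E * B ^ (2 * n))) ^ suc D
        ≡⟨ trans (*-^ (suc D) κ (A ^ suc E * B ^ (2 * n))) (cong (κ ^ suc D *_) (*-^ (suc D) (A ^ suc E) (B ^ (2 * n)))) ⟩
      κ ^ suc D * ((A ^ suc E) ^ suc D * (B ^ (2 * n)) ^ suc D)
        ≡⟨ cong₂ (λ s t → κ ^ suc D * (s * t))
             (trans (^-*-assoc A (suc E) (suc D)) (trans (cong (A ^_) (*-comm (suc E) (suc D))) (sym (^-*-assoc A (suc D) (suc E)))))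
             (^-*-assoc B (2 * n) (suc D)) ⟩
      κ ^ suc D * ((A ^ suc D) ^ suc E * B ^ E)
        ≤⟨ *-monoʳ-≤ (κ ^ suc D) (*-monoˡ-≤ (B ^ E) (^-monoˡ-≤ (suc E) A^≤B^)) ⟩
      κ ^ suc D * ((B ^ D) ^ suc E * B ^ E)
        ≡⟨ cong (λ s → κ ^ suc D * (s * B ^ E)) (^-*-assoc B D (suc E)) ⟩
      κ ^ suc D * (B ^ (D * suc E) * B ^ E) ∎)
    where
    open ℕ.≤-Reasoning
    instance
      B≢0 : NonZero B
      B≢0 = >-nonZero 0<B
    assoc : ∀ b s t → b * (s * t) ≡ (b * t) * s
    assoc = ℕ-solve
    pair : ∀ Q p q → Q * p * (Q * q) ≡ Q * Q * (p * q)
    pair = ℕ-solve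
    B^2n : B ^ (2 * n) ≡ B ^ n * B ^ n
    B^2n = trans (^-distribˡ-+-* B n (n + 0)) (cong (λ k → B ^ n * B ^ k) (+-identityʳ n))
    regroup : ∀ s u t a b k c → s * (u * (t * (a * b)) * (k * c * (k * c))) ≡ b * (s * (u * t * (k * k)) * (a * (c * c)))
    regroup = ℕ-solve
    one-power : B ^ suc E ≤ κ * (A ^ suc E * B ^ (2 * n))
    one-power = *-cancelˡ-≤ (B ^ suc E) {{m^n≢0 B (suc E)}} (begin
      B ^ suc E * B ^ suc E
        ≡⟨ *-^ (suc E) B B ⟨
      (B * B) ^ suc E
        ≤⟨ ^-monoˡ-≤ (suc E) (≤-trans (*-mono-≤ B≤Qp B≤Qq) (≤-reflexive (pair Q p q))) ⟩
      (Q * Q * (p * q)) ^ suc E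
        ≡⟨ *-^ (suc E) (Q * Q) (p * q) ⟩
      (Q * Q) ^ suc E * (p * q) ^ suc E
        ≤⟨ *-monoʳ-≤ ((Q * Q) ^ suc E) (≤-trans pq≤ (*-mono-≤ (*-monoʳ-≤ (u ^ E) (^-monoˡ-≤ (suc E) r≤)) (*-mono-≤ x≤ x≤))) ⟩
      (Q * Q) ^ suc E * (u ^ E * (r₁ * (A * B)) ^ suc E * (k₂ * B ^ n * (k₂ * B ^ n)))
        ≡⟨ cong (λ s → (Q * Q) ^ suc E * (u ^ E * s * (k₂ * B ^ n * (k₂ * B ^ n))))
             (trans (*-^ (suc E) r₁ (A * B)) (cong (r₁ ^ suc E *_) (*-^ (suc E) A B))) ⟩
      (Q * Q) ^ suc E * (u ^ E * (r₁ ^ suc E * (A ^ suc E * B ^ suc E)) * (k₂ * B ^ n * (k₂ * B ^ n)))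
        ≡⟨ regroup ((Q * Q) ^ suc E) (u ^ E) (r₁ ^ suc E) (A ^ suc E) (B ^ suc E) k₂ (B ^ n) ⟩
      B ^ suc E * (κ * (A ^ suc E * (B ^ n * B ^ n)))
        ≡⟨ cong (λ s → B ^ suc E * (κ * (A ^ suc E * s))) B^2n ⟨
      B ^ suc E * (κ * (A ^ suc E * B ^ (2 * n))) ∎)

infix 4 _∣ℤ_
_∣ℤ_ : ℕ → ℤ → Set
p ∣ℤ x = + p ℤ∣.∣ x

square∣⇒∣ : ∀ {p x} → p * p ∣ x → p ∣ x
square∣⇒∣ {p} = ℕ∣.∣-trans (ℕ∣.m∣m*n p)

-- The residue classes a ≡ m and b ≡ c₀ modulo N = m M′ in which no prime up to
-- z divides both a and b, or divides D = n ^ n b ^ e ± e ^ e a ^ n.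
module Residues (q : ℕ) (0<q : 0 < q) (nonresidues : PowerNonresidues (suc (4 * q))) where

  open PowerNonresidues nonresidues

  e n z M′ N : ℕ
  e  = 4 * q
  n  = suc e
  -- The first two summands meet the sieve's conditions on z; together with `m` they place all prime
  -- factors of n, e and m at or below z.
  z  = 32 + 16 * n + m
  M′ = coprimeProduct m z
  N  = m * M′

  1<e : 1 < e
  1<e = ≤-trans (s≤s (s≤s z≤n)) (*-monoʳ-≤ 4 0<q)
  0<e : 0 < e
  0<e = <-trans 0<1+n 1<e
  even : -1ℤ ℤ.^ e ≡ 1ℤ
  even = trans (cong (-1ℤ ℤ.^_) (double q)) (-1^even (2 * q))
    where
    double : ∀ q → 4 * q ≡ 2 * (2 * q)
    double = ℕ-solve

  0<M′ : 0 < M′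
  0<M′ = coprimeProduct>0 m z
  0<N : 0 < N
  0<N = *-mono-≤ 0<m 0<M′
  m≤N : m ≤ N
  m≤N = m≤m*n m M′ {{>-nonZero 0<M′}}
  m≤z : m ≤ z
  m≤z = m≤n+m m (32 + 16 * n)
  16n≤z : 16 * n ≤ z
  16n≤z = ≤-trans (m≤n+m (16 * n) 32) (m≤m+n (32 + 16 * n) m)
  n≤z : n ≤ z
  n≤z = ≤-trans (ℕ.m≤n*m n 16) 16n≤z
  e≤m : e ≤ m
  e≤m = ℕ∣.∣⇒≤ {{>-nonZero 0<m}} pred∣m

  -- A prime of m divides a but not b, because `β` is a unit modulo m. Any other prime up to z
  -- divides M′ and hence b, but not a ≡ m. In either case just one of the two terms of the
  -- discriminant is divisible by it.
  residue : ∃ λ c → c < N × + c ≋ + β [ + m ] × + c ≋ + 0 [ + M′ ]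
  residue = chinese-remainder {m} {M′} {{>-nonZero 0<m}} {{>-nonZero 0<M′}} (coprimeProduct-coprime m z) β 0
  c₀ : ℕ
  c₀ = proj₁ residue
  M′∣c₀ : M′ ∣ c₀
  M′∣c₀ = ℤ∣.∣⇒∣ᵤ (≋0⇒∣ (proj₂ (proj₂ (proj₂ residue))))

  small-prime : ∀ {p} → Prime p → p ≤ z → ¬ (p ∣ m) → p ∣ M′
  small-prime {p} pr p≤z p∤m = ∣-coprimeProduct m z (>-nonZero⁻¹ p {{prime⇒nonZero pr}}) p≤z (prime∤⇒coprime pr p∤m)

  p∤e : ∀ p → Prime p → z < p → ¬ (p ∣ e)
  p∤e p pr z<p p∣e = <⇒≱ z<p (≤-trans (ℕ∣.∣⇒≤ {{>-nonZero 0<e}} p∣e) (≤-trans e≤m m≤z))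
  p∤n : ∀ p → Prime p → z < p → ¬ (p ∣ n)
  p∤n p pr z<p p∣n = <⇒≱ z<p (≤-trans (ℕ∣.∣⇒≤ p∣n) n≤z)
  p∤N : ∀ p → Prime p → z < p → ¬ (p ∣ N)
  p∤N p pr z<p p∣N = <⇒≱ z<p ([ (λ p∣m → ≤-trans (ℕ∣.∣⇒≤ {{>-nonZero 0<m}} p∣m) m≤z) , prime∣coprimeProduct m z pr ]′ (euclidsLemma m M′ pr p∣N))
  p∤nⁿ : ∀ p → Prime p → z < p → ¬ (p ∣ℤ (+ n) ℤ.^ n)
  p∤nⁿ p pr z<p h = p∤n p pr z<p (prime∣^ pr n n (ℤ∣.∣⇒∣ᵤ (subst (p ∣ℤ_) (sym (pos-^ n n)) h)))

  module _ {a b s t : ℕ} (a≡ : a ≡ m + N * s) (b≡ : b ≡ c₀ + N * t) where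

    m∣a : m ∣ a
    m∣a = subst (m ∣_) (sym a≡) (ℕ∣.∣m∣n⇒∣m+n ℕ∣.∣-refl (ℕ∣.∣m⇒∣m*n s (ℕ∣.m∣m*n M′)))

    b≋β : + b ≋ + β [ + m ]
    b≋β = ≋-trans (≋-reflexive (trans (cong +_ b≡) (ℤ.pos-+ c₀ (N * t))))
      (≋-trans (≋-+ {y = + (N * t)} (proj₁ (proj₂ (proj₂ residue))) (∣⇒≋0 (ℤ∣.∣ᵤ⇒∣ (ℕ∣.∣m⇒∣m*n t (ℕ∣.m∣m*n M′))))) (≋-reflexive (ℤ.+-identityʳ (+ β))))

    M′∣b : M′ ∣ b
    M′∣b = subst (M′ ∣_) (sym b≡) (ℕ∣.∣m∣n⇒∣m+n M′∣c₀ (ℕ∣.∣m⇒∣m*n t (ℕ∣.n∣m*n m)))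

    small-coprime : ∀ {p} → Prime p → p ≤ z → p ∣ a → ¬ (p ∣ b)
    small-coprime {p} pr p≤z p∣a p∣b = by-cases (p ℕ∣.∣? m)
      where
      by-cases : Dec (p ∣ m) → ⊥
      by-cases (yes p∣m) = ¬prime[1] (subst Prime (β⊥m (≋-common-divisor b β b≋β p∣m p∣b , p∣m)) pr)
      by-cases (no p∤m)  = p∤m (ℕ∣.∣m+n∣m⇒∣n (subst (p ∣_) (trans a≡ (+-comm m (N * s))) p∣a)
        (ℕ∣.∣m⇒∣m*n s (ℕ∣.∣n⇒∣m*n m (small-prime pr p≤z p∤m))))

    module _ (a⊥b : ∀ p → Prime p → p ∣ a → ¬ (p ∣ b)) {w : ℤ}
      (w⇒ : ∀ p → Prime p → p ∣ℤ w → (p ∣ e) ⊎ (p ∣ a)) (w⇐ : ∀ p → p ∣ a → p ∣ℤ w) where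

      private
        D : ℤ
        D = (+ n) ℤ.^ n ℤ.* (+ b) ℤ.^ e ℤ.+ w

        b∣term : ∀ {p} → p ∣ b → p ∣ℤ (+ n) ℤ.^ n ℤ.* (+ b) ℤ.^ e
        b∣term {p} p∣b = ℤ∣.∣n⇒∣m*n ((+ n) ℤ.^ n) (power e 0<e)
          where
          power : ∀ k → 0 < k → p ∣ℤ (+ b) ℤ.^ k
          power (suc k) _ = ℤ∣.∣m⇒∣m*n {+ _} {+ b} ((+ b) ℤ.^ k) (ℤ∣.∣ᵤ⇒∣ p∣b)

        term⇒ : ∀ {p} → Prime p → p ∣ℤ (+ n) ℤ.^ n ℤ.* (+ b) ℤ.^ e → (p ∣ n) ⊎ (p ∣ b)
        term⇒ {p} pr h = [ (λ k → inj₁ (prime∣^ pr n n (ℤ∣.∣⇒∣ᵤ (subst (p ∣ℤ_) (sym (pos-^ n n)) k))))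
                         , (λ k → inj₂ (prime∣^ pr b e (ℤ∣.∣⇒∣ᵤ (subst (p ∣ℤ_) (sym (pos-^ b e)) k)))) ]′
                         (euclid-ℤ pr ((+ n) ℤ.^ n) ((+ b) ℤ.^ e) h)

      -- If p divides m, it divides a, and D is congruent to n ^ n b ^ e, a unit modulo p. If p does
      -- not divide m but divides b, it divides w and therefore e or a: the first is excluded as e
      -- divides m, the second by `a⊥b`. A prime up to z outside m would divide M′ and so b.
      discriminant-prime : ∀ {p} → Prime p → p ∣ ∣ D ∣ → z < p × ¬ (p ∣ b)
      discriminant-prime {p} pr p∣D = z<p , p∤b
        where
        p∣ℤD : p ∣ℤ D
        p∣ℤD = ℤ∣.∣ᵤ⇒∣ p∣D
        dividing-m : p ∣ m → ⊥
        dividing-m p∣m = [ (λ p∣n → ¬prime[1] (subst Prime (m⊥n (p∣m , p∣n)) pr)) , a⊥b p pr p∣a ]′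
          (term⇒ pr (ℤ∣.∣m+n∣n⇒∣m p∣ℤD (w⇐ p p∣a)))
          where
          p∣a : p ∣ a
          p∣a = ℕ∣.∣-trans p∣m m∣a
        dividing-b : ¬ (p ∣ m) → ¬ (p ∣ b)
        dividing-b p∤m p∣b = [ (λ p∣e → p∤m (ℕ∣.∣-trans p∣e pred∣m)) , (λ p∣a → a⊥b p pr p∣a p∣b) ]′
          (w⇒ p pr (ℤ∣.∣m+n∣m⇒∣n p∣ℤD (b∣term p∣b)))
        z<p : z < p
        z<p = ≰⇒> λ p≤z → dividing-b dividing-m (ℕ∣.∣-trans (small-prime pr p≤z dividing-m) M′∣b)
        p∤b : ¬ (p ∣ b)
        p∤b = dividing-b dividing-m

-- The choice of the sign of a

neg-∣ : ∀ {p x} → p ∣ℤ ℤ.- x → p ∣ℤ x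
neg-∣ {p} {x} h = subst (p ∣ℤ_) (ℤ.neg-involutive x) (ℤ∣.∣m⇒∣-m h)

neg-odd-power : ∀ e x → -1ℤ ℤ.^ e ≡ 1ℤ → (ℤ.- x) ℤ.^ suc e ≡ ℤ.- (x ℤ.^ suc e)
neg-odd-power e x even = begin
  (ℤ.- x) ℤ.^ suc e                     ≡⟨ cong (ℤ._^ suc e) (ℤ.-1*i≡-i x) ⟨
  (-1ℤ ℤ.* x) ℤ.^ suc e                 ≡⟨ ^-distribʳ-* -1ℤ x (suc e) ⟩
  -1ℤ ℤ.* -1ℤ ℤ.^ e ℤ.* x ℤ.^ suc e     ≡⟨ cong (λ s → -1ℤ ℤ.* s ℤ.* x ℤ.^ suc e) even ⟩
  -1ℤ ℤ.* x ℤ.^ suc e                   ≡⟨ ℤ.-1*i≡-i (x ℤ.^ suc e) ⟩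
  ℤ.- (x ℤ.^ suc e)                     ∎
  where open ≡-Reasoning

module Choice (q : ℕ) (0<q : 0 < q) (nonresidues : PowerNonresidues (suc (4 * q))) where

  open Residues q 0<q nonresidues
  open PowerNonresidues nonresidues

  Q r₁ k₂ : ℕ
  -- Chosen for B ≤ Q Y, where Y is the limit of the sieve by squares: B < N (J + 3) ≤ 4 N J and J <
  -- 16 e (Y + 1) ≤ 32 e Y.
  Q  = 128 * N * e
  -- For a ≤ 2 A, b ≤ 2 B and A ≤ B, the product n e a b is at most `r₁` A B, and both U and V are
  -- at most `k₂` B ^ n.
  r₁ = 4 * (n * n)
  k₂ = n ^ n * 2 ^ n

  positive negative : ℕ → ℕ → ℤ
  positive a b = (+ n) ℤ.^ n ℤ.* (+ b) ℤ.^ e ℤ.+ (+ e) ℤ.^ e ℤ.* (+ a) ℤ.^ n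
  negative a b = (+ n) ℤ.^ n ℤ.* (+ b) ℤ.^ e ℤ.+ ℤ.- ((+ e) ℤ.^ e ℤ.* (+ a) ℤ.^ n)

  discriminant-positive : ∀ a b → discriminant n (trinomial n (+ a) (+ b)) ≡ positive a b
  discriminant-positive a b = discriminant-trinomial q 0<q (+ a) (+ b)

  discriminant-negative : ∀ a b → discriminant n (trinomial n (ℤ.- (+ a)) (+ b)) ≡ negative a b
  discriminant-negative a b = trans (discriminant-trinomial q 0<q (ℤ.- (+ a)) (+ b))
    (cong (λ x → (+ n) ℤ.^ n ℤ.* (+ b) ℤ.^ e ℤ.+ x)
      (trans (cong (λ x → (+ e) ℤ.^ e ℤ.* x) (neg-odd-power e (+ a) even)) (sym (ℤ.neg-distribʳ-* ((+ e) ℤ.^ e) ((+ a) ℤ.^ n)))))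

  term-prime : ∀ a p → Prime p → p ∣ℤ (+ e) ℤ.^ e ℤ.* (+ a) ℤ.^ n → (p ∣ e) ⊎ (p ∣ a)
  term-prime a p pr h = [ (λ k → inj₁ (prime∣^ pr e e (ℤ∣.∣⇒∣ᵤ (subst (p ∣ℤ_) (sym (pos-^ e e)) k))))
                        , (λ k → inj₂ (prime∣^ pr a n (ℤ∣.∣⇒∣ᵤ (subst (p ∣ℤ_) (sym (pos-^ a n)) k)))) ]′
                        (euclid-ℤ pr ((+ e) ℤ.^ e) ((+ a) ℤ.^ n) h)

  prime-term : ∀ a p → p ∣ a → p ∣ℤ (+ e) ℤ.^ e ℤ.* (+ a) ℤ.^ n
  prime-term a p p∣a = ℤ∣.∣n⇒∣m*n ((+ e) ℤ.^ e) (ℤ∣.∣m⇒∣m*n {+ p} {+ a} ((+ a) ℤ.^ e) (ℤ∣.∣ᵤ⇒∣ p∣a))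

  module _ (D u : ℕ)
    (abc : ∀ a b c → 0 < a → 0 < b → 0 < c → Coprime a b → Coprime a c → Coprime b c → a + b ≡ c →
      c ^ (2 * n * suc D) ≤ u ^ (2 * n * suc D) * radical (a * b * c) ^ suc (2 * n * suc D))
    {A B : ℕ} (A^≤B^ : A ^ suc D ≤ B ^ D) (A≤B : A ≤ B) (0<B : 0 < B) (κ<B : Exponents.κ n D Q u r₁ k₂ ^ suc D < B)
    {a b s t : ℕ} (a≡ : a ≡ m + N * s) (b≡ : b ≡ c₀ + N * t) (0<a : 0 < a) (0<b : 0 < b)
    (a≤2A : a ≤ 2 * A) (b≤2B : b ≤ 2 * B) (a⊥b : ∀ p → Prime p → p ∣ a → ¬ (p ∣ b))
    (large⁺ : ∀ p → Prime p → p * p ∣ ∣ positive a b ∣ → B ≤ Q * p)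
    (large⁻ : ∀ p → Prime p → p * p ∣ ∣ negative a b ∣ → B ≤ Q * p) where

    open Exponents n D Q u r₁ k₂ using (E; B-bounded)

    Result : Set
    Result = ∃ λ a′ → ∣ a′ ∣ ≡ a × Squarefree (discriminant n (trinomial n a′ (+ b)))

    private
      U V r : ℕ
      U = n ^ n * b ^ e
      V = e ^ e * a ^ n
      r = n * e * (a * b)

      pos-product : ∀ x k y l → (+ x) ℤ.^ k ℤ.* (+ y) ℤ.^ l ≡ + (x ^ k * y ^ l)
      pos-product x k y l = trans (cong₂ ℤ._*_ (sym (pos-^ x k)) (sym (pos-^ y l))) (sym (ℤ.pos-* (x ^ k) (y ^ l)))

      abs-positive : ∣ positive a b ∣ ≡ U + V
      abs-positive = cong ∣_∣ (cong₂ ℤ._+_ (pos-product n n b e) (pos-product e e a n))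

      abs-negative : ∣ negative a b ∣ ≡ ∣ U ℤ.⊖ V ∣
      abs-negative = cong ∣_∣ (trans (cong₂ (λ x y → x ℤ.+ ℤ.- y) (pos-product n n b e) (pos-product e e a n)) (ℤ.m-n≡m⊖n U V))

      0<U : 0 < U
      0<U = *-mono-≤ (m^n>0 n n) (m^n>0 b {{>-nonZero 0<b}} e)
      0<V : 0 < V
      0<V = *-mono-≤ (m^n>0 e {{>-nonZero 0<e}} e) (m^n>0 a {{>-nonZero 0<a}} n)
      1<U : 1 < U
      1<U = <-≤-trans (<-≤-trans (m<n⇒m<1+n 1<e) (m≤m*n n (n ^ e) {{m^n≢0 n e}})) (m≤m*n (n ^ n) (b ^ e) {{m^n≢0 b e {{>-nonZero 0<b}}}})

      U-prime : ∀ l → Prime l → l ∣ U → (l ∣ n) ⊎ (l ∣ b)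
      U-prime l pr h = [ (λ k → inj₁ (prime∣^ pr n n k)) , (λ k → inj₂ (prime∣^ pr b e k)) ]′ (euclidsLemma (n ^ n) (b ^ e) pr h)
      V-prime : ∀ l → Prime l → l ∣ V → (l ∣ e) ⊎ (l ∣ a)
      V-prime l pr h = [ (λ k → inj₁ (prime∣^ pr e e k)) , (λ k → inj₂ (prime∣^ pr a n k)) ]′ (euclidsLemma (e ^ e) (a ^ n) pr h)

      -- Primes of e divide m and so a; primes of n divide M′ and so b. A common prime of U and V
      -- would thus divide both a and b.
      U⊥V : Coprime U V
      U⊥V = coprime-by-primes 0<U λ l pr l∣U l∣V → cases l pr (U-prime l pr l∣U) (V-prime l pr l∣V)
        where
        e⇒a : ∀ {l} → l ∣ e → l ∣ a
        e⇒a l∣e = ℕ∣.∣-trans l∣e (ℕ∣.∣-trans pred∣m (m∣a a≡ b≡))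
        n⇒b : ∀ {l} → Prime l → l ∣ n → l ∣ b
        n⇒b {l} pr l∣n = ℕ∣.∣-trans (small-prime pr (≤-trans (ℕ∣.∣⇒≤ l∣n) n≤z)
          (λ l∣m → ¬prime[1] (subst Prime (m⊥n (l∣m , l∣n)) pr))) (M′∣b a≡ b≡)
        cases : ∀ l → Prime l → (l ∣ n) ⊎ (l ∣ b) → (l ∣ e) ⊎ (l ∣ a) → ⊥
        cases l pr x y = a⊥b l pr ([ e⇒a , id ]′ y) ([ n⇒b pr , id ]′ x)

      U-prime∣r : ∀ l → Prime l → l ∣ U → l ∣ r
      U-prime∣r l pr h = [ (λ l∣n → ℕ∣.∣m⇒∣m*n (a * b) (ℕ∣.∣m⇒∣m*n e l∣n)) , (λ l∣b → ℕ∣.∣n⇒∣m*n (n * e) (ℕ∣.∣n⇒∣m*n a l∣b)) ]′ (U-prime l pr h)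
      V-prime∣r : ∀ l → Prime l → l ∣ V → l ∣ r
      V-prime∣r l pr h = [ (λ l∣e → ℕ∣.∣m⇒∣m*n (a * b) (ℕ∣.∣n⇒∣m*n n l∣e)) , (λ l∣a → ℕ∣.∣n⇒∣m*n (n * e) (ℕ∣.∣m⇒∣m*n b l∣a)) ]′ (V-prime l pr h)

      r≤ : r ≤ r₁ * (A * B)
      r≤ = ≤-trans (*-mono-≤ (*-monoʳ-≤ n (n≤1+n e)) (*-mono-≤ a≤2A b≤2B)) (≤-reflexive (regroup (n * n) A B))
        where
        regroup : ∀ x A B → x * (2 * A * (2 * B)) ≡ 4 * x * (A * B)
        regroup = ℕ-solve

      [2B]^n : n ^ n * (2 * B) ^ n ≡ k₂ * B ^ n
      [2B]^n = trans (cong (n ^ n *_) (*-^ n 2 B)) (sym (*-assoc (n ^ n) (2 ^ n) (B ^ n)))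

      U≤ : U ≤ k₂ * B ^ n
      U≤ = ≤-trans (*-monoʳ-≤ (n ^ n) (≤-trans (^-monoˡ-≤ e b≤2B)
        (^-monoʳ-≤ (2 * B) {{m*n≢0 2 B {{_}} {{>-nonZero 0<B}}}} (n≤1+n e)))) (≤-reflexive [2B]^n)
      V≤ : V ≤ k₂ * B ^ n
      V≤ = ≤-trans (*-mono-≤ (≤-trans (^-monoˡ-≤ e (n≤1+n e)) (^-monoʳ-≤ n (n≤1+n e)))
        (^-monoˡ-≤ n (≤-trans a≤2A (*-monoʳ-≤ 2 A≤B)))) (≤-reflexive [2B]^n)

      0<E : 0 < E
      0<E = *-mono-≤ (*-mono-≤ (s≤s (z≤n {1})) (s≤s (z≤n {e}))) (s≤s (z≤n {D}))

      impossible : ∀ {y d p₁ p₂} → 0 < y → 0 < d → Coprime (y + d) y → (∀ l → Prime l → (l ∣ y + d) ⊎ (l ∣ y) → l ∣ r) →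
        y + d ≤ k₂ * B ^ n → p₁ * p₁ ∣ y + d + y → p₂ * p₂ ∣ d → B ≤ Q * p₁ → B ≤ Q * p₂ → ⊥
      impossible {y} {d} {p₁} {p₂} 0<y 0<d x⊥y primes∣r x≤ (divides g x+y≡) (divides h d≡) B≤₁ B≤₂ = <⇒≱ κ<B
        (B-bounded {A} {B} {p₁} {p₂} {r} {y + d} 0<B A^≤B^ B≤₁ B≤₂
          (DifferenceOfSquares.square-factors-≤ {E} {u} 0<E abc {y} {d} {r} {p₁} {p₂} {g} {h} 0<y 0<d x⊥y
            (*-mono-≤ (*-mono-≤ (s≤s (z≤n {e})) 0<e) (*-mono-≤ 0<a 0<b)) primes∣r x+y≡ d≡)
          r≤ x≤)

      -- Either of U and V can be the larger. With y the smaller and y + d the larger, the absolute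
      -- discriminants are y + d + y and d in both cases, and one of them must be squarefree.
      choose : ∀ {y d} → ∣ positive a b ∣ ≡ y + d + y → ∣ negative a b ∣ ≡ d → 0 < y → 0 < d → Coprime (y + d) y →
        (∀ l → Prime l → (l ∣ y + d) ⊎ (l ∣ y) → l ∣ r) → y + d ≤ k₂ * B ^ n → Result
      choose {y} {d} pos≡ neg≡ 0<y 0<d x⊥y primes∣r x≤ = decide (square-factor? (y + d + y) (<-≤-trans 0<y (m≤n+m y (y + d)))) (square-factor? d 0<d)
        where
        decide : (∀ k → k * k ∣ y + d + y → k ≡ 1) ⊎ (∃ λ p → Prime p × p * p ∣ y + d + y) →
          (∀ k → k * k ∣ d → k ≡ 1) ⊎ (∃ λ p → Prime p × p * p ∣ d) → Result
        decide (inj₁ squarefree) _ = + a , refl ,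
          λ k h → squarefree k (subst (k * k ∣_) (trans (cong ∣_∣ (discriminant-positive a b)) pos≡) h)
        decide (inj₂ _) (inj₁ squarefree) = ℤ.- (+ a) , ℤ.∣-i∣≡∣i∣ (+ a) ,
          λ k h → squarefree k (subst (k * k ∣_) (trans (cong ∣_∣ (discriminant-negative a b)) neg≡) h)
        decide (inj₂ (p₁ , pr₁ , h₁)) (inj₂ (p₂ , pr₂ , h₂)) = ⊥-elim (impossible 0<y 0<d x⊥y primes∣r x≤ h₁ h₂
          (large⁺ p₁ pr₁ (subst (p₁ * p₁ ∣_) (sym pos≡) h₁)) (large⁻ p₂ pr₂ (subst (p₂ * p₂ ∣_) (sym neg≡) h₂)))

      order-⊥ : ∀ {x y} → x ≡ y → Coprime x y → 1 < x → ⊥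
      order-⊥ refl c 1<x = <⇒≢ 1<x (sym (c (ℕ∣.∣-refl , ℕ∣.∣-refl)))

    squarefree-choice : Result
    squarefree-choice = by-order (ℕ.<-cmp U V)
      where
      by-order : _ → Result
      by-order (tri≈ _ U≡V _) = ⊥-elim (order-⊥ U≡V U⊥V 1<U)
      by-order (tri> _ _ V<U) = choose {V} {U ∸ V}
        (trans abs-positive (cong (λ x → x + V) (sym V+d)))
        (trans abs-negative (cong ∣_∣ (ℤ.⊖-≥ (<⇒≤ V<U))))
        0<V (m<n⇒0<n∸m V<U) (subst (λ x → Coprime x V) (sym V+d) U⊥V)
        (λ l pr → [ (λ h → U-prime∣r l pr (subst (l ∣_) V+d h)) , V-prime∣r l pr ]′) (subst (_≤ k₂ * B ^ n) (sym V+d) U≤)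
        where
        V+d : V + (U ∸ V) ≡ U
        V+d = m+[n∸m]≡n (<⇒≤ V<U)
      by-order (tri< U<V _ _) = choose {U} {V ∸ U}
        (trans abs-positive (trans (+-comm U V) (cong (λ x → x + U) (sym U+d))))
        (trans abs-negative (trans (cong ∣_∣ (ℤ.⊖-≤ (<⇒≤ U<V))) (ℤ.∣-i∣≡∣i∣ (+ (V ∸ U)))))
        0<U (m<n⇒0<n∸m U<V) (subst (λ x → Coprime x U) (sym U+d) (Coprime.sym U⊥V))
        (λ l pr → [ (λ h → V-prime∣r l pr (subst (l ∣_) U+d h)) , U-prime∣r l pr ]′) (subst (_≤ k₂ * B ^ n) (sym U+d) V≤)
        where
        U+d : U + (V ∸ U) ≡ V
        U+d = m+[n∸m]≡n (<⇒≤ U<V)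

-- The final count

-- The sign of a is found separately for each surviving pair of indices, so the images come from a
-- relation; distinctness holds because the absolute values determine the indices.
choose-image : ∀ {X Y : Set} {R : X → Y → Set} {P : Y → Set} → (∀ {x x′ y} → R x y → R x′ y → x ≡ x′) →
  ∀ {xs} → Unique xs → All (λ x → ∃ λ y → R x y × P y) xs → ∃ λ ys → Unique ys × All P ys × length ys ≡ length xs
choose-image {X} {Y} {R} {P} injective unique hs = proj₁ (images hs) , distinct unique (proj₁ (proj₂ (images hs))) ,
  proj₂ (proj₂ (images hs)) , sym (PW.Pointwise-length (proj₁ (proj₂ (images hs))))
  where
  images : ∀ {xs} → All (λ x → ∃ λ y → R x y × P y) xs → ∃ λ ys → Pointwise R xs ys × All P ys
  images [] = [] , [] , []
  images ((y , r , p) ∷ hs) = y ∷ proj₁ (images hs) , r ∷ proj₁ (proj₂ (images hs)) , p ∷ proj₂ (proj₂ (images hs))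
  fresh : ∀ {x y xs ys} → R x y → All (x ≢_) xs → Pointwise R xs ys → All (y ≢_) ys
  fresh r []           []         = []
  fresh r (x≢x′ ∷ x≢) (r′ ∷ rs) = (λ { refl → x≢x′ (injective r r′) }) ∷ fresh r x≢ rs
  distinct : ∀ {xs ys} → Unique xs → Pointwise R xs ys → Unique ys
  distinct []             []       = []
  distinct (x∉xs ∷ unique) (r ∷ rs) = fresh r x∉xs rs ∷ distinct unique rs

progression-cancel : ∀ s N {i j} → 0 < N → s + N * i ≡ s + N * j → i ≡ j
progression-cancel s N {i} {j} 0<N eq = ℕ.*-cancelˡ-≡ i j N {{>-nonZero 0<N}} (ℕ.+-cancelˡ-≡ s (N * i) (N * j) eq)

module Counting (q : ℕ) (0<q : 0 < q) (nonresidues : PowerNonresidues (suc (4 * q))) (D u : ℕ)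
  (abc : ∀ a b c → 0 < a → 0 < b → 0 < c → Coprime a b → Coprime a c → Coprime b c → a + b ≡ c →
    c ^ (2 * suc (4 * q) * suc D) ≤ u ^ (2 * suc (4 * q) * suc D) * radical (a * b * c) ^ suc (2 * suc (4 * q) * suc D)) where

  open PowerNonresidues nonresidues
  open Residues q 0<q nonresidues
  open Choice q 0<q nonresidues

  κ A₀ : ℕ
  κ  = Exponents.κ n D Q u r₁ k₂
  -- The first summand makes B exceed the bound of `B-bounded`, the second makes A div N - 2 at
  -- least 144 N, where 144 N = 24 K.
  A₀ = suc (κ ^ suc D) + (144 * N + 2) * N

  module _ {A B : ℕ} (1<A : 1 < A) (A₀≤A : A₀ ≤ A) (A^<B^ : A ^ suc D < B ^ D) where

    private
      c₀≤N : c₀ ≤ N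
      c₀≤N = <⇒≤ (proj₁ (proj₂ residue))

      module WA = Window N A m 0<N m≤N
      module WB = Window N B c₀ 0<N c₀≤N

      I J Y T K : ℕ
      I = WA.size
      J = WB.size
      -- The largest limit that the rounding condition `16eY≤J` of the sieve permits.
      Y = J div (16 * e)
      -- A common prime of a and b is at most a ≤ 2 A, so no such prime escapes the sieve.
      T = suc (2 * A)
      -- From 2 A + 1 < 2 N (I + 3) ≤ 6 N (I + 1).
      K = 6 * N

      0<A : 0 < A
      0<A = <-trans 0<1+n 1<A

      A<B : A < B
      A<B = ≰⇒> λ B≤A → <⇒≱ A^<B^ (≤-trans (^-monoˡ-≤ D B≤A) (^-monoʳ-≤ A {{>-nonZero 0<A}} (n≤1+n D)))

      0<B : 0 < B
      0<B = <-trans 0<A A<B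

      κ<B : κ ^ suc D < B
      κ<B = ≤-<-trans (≤-trans (n≤1+n (κ ^ suc D)) (≤-trans (m≤m+n (suc (κ ^ suc D)) ((144 * N + 2) * N)) A₀≤A)) A<B

      144N≤I : 144 * N ≤ I
      144N≤I = ≤-trans (≤-reflexive (sym (ℕ.m+n∸n≡m (144 * N) 2)))
        (ℕ.∸-monoˡ-≤ 2 (*≤⇒≤div A N (144 * N + 2) 0<N (≤-trans (m≤n+m ((144 * N + 2) * N) (suc (κ ^ suc D))) A₀≤A)))

      0<I : 0 < I
      0<I = <-≤-trans (*-mono-≤ (s≤s (z≤n {143})) 0<N) 144N≤I

      I≤J : I ≤ J
      I≤J = ℕ.∸-monoˡ-≤ 2 (*≤⇒≤div B N (A div N) 0<N (≤-trans (div-* A N) (<⇒≤ A<B)))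

      0<J : 0 < J
      0<J = <-≤-trans 0<I I≤J

      size+3 : ∀ {k} → 0 < k → k + 3 ≤ 4 * k
      size+3 {k} 0<k = +-monoʳ-≤ k (*-monoʳ-≤ 3 0<k)

      T≤ : T ≤ K * suc I
      T≤ = begin
        suc (2 * A)            ≤⟨ m≤n+m (suc (2 * A)) 1 ⟩
        suc (suc (2 * A))      ≡⟨ double A ⟩
        2 * suc A              ≤⟨ *-monoʳ-≤ 2 WA.A<N*[size+3] ⟩
        2 * (N * (I + 3))      ≤⟨ *-monoʳ-≤ 2 (*-monoʳ-≤ N (≤-trans (+-monoˡ-≤ 3 (ℕ.m≤n*m I 3)) (≤-reflexive (triple I)))) ⟩
        2 * (N * (3 * suc I))  ≡⟨ regroup N (suc I) ⟩
        K * suc I              ∎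
        where
        open ℕ.≤-Reasoning
        double : ∀ A → suc (suc (2 * A)) ≡ 2 * suc A
        double = ℕ-solve
        triple : ∀ I → 3 * I + 3 ≡ 3 * suc I
        triple = ℕ-solve
        regroup : ∀ N x → 2 * (N * (3 * x)) ≡ 6 * N * x
        regroup = ℕ-solve

      24K≤I : 24 * K ≤ I
      24K≤I = ≤-trans (≤-reflexive (sym (*-assoc 24 6 N))) 144N≤I

      16eY≤J : 16 * e * Y ≤ J
      16eY≤J = ≤-trans (≤-reflexive (*-comm (16 * e) Y)) (div-* J (16 * e))

      0<16e : 0 < 16 * e
      0<16e = *-mono-≤ (s≤s (z≤n {15})) 0<e

      0<Y : 0 < Y
      0<Y = *≤⇒≤div J (16 * e) 1 0<16e (begin
        1 * (16 * e)    ≡⟨ *-identityˡ (16 * e) ⟩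
        16 * e          ≤⟨ *-mono-≤ (m≤m+n 16 128) (≤-trans e≤m m≤N) ⟩
        144 * N         ≤⟨ ≤-trans 144N≤I I≤J ⟩
        J               ∎)
        where open ℕ.≤-Reasoning

      16e≤z : 16 * e ≤ z
      16e≤z = ≤-trans (*-monoʳ-≤ 16 (n≤1+n e)) 16n≤z

      32≤z : 32 ≤ z
      32≤z = ≤-trans (m≤m+n 32 (16 * n)) (m≤m+n (32 + 16 * n) m)

      B≤Q* : ∀ {p} → Y ≤ p → B ≤ Q * p
      B≤Q* {p} Y≤p = begin
        B                                ≤⟨ <⇒≤ WB.A<N*[size+3] ⟩
        N * (J + 3)                      ≤⟨ *-monoʳ-≤ N (size+3 0<J) ⟩
        N * (4 * J)                      ≤⟨ *-monoʳ-≤ N (*-monoʳ-≤ 4 (<⇒≤ (<-suc-div J (16 * e) 0<16e))) ⟩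
        N * (4 * (suc Y * (16 * e)))     ≤⟨ *-monoʳ-≤ N (*-monoʳ-≤ 4 (*-monoˡ-≤ (16 * e) (+-mono-≤ 0<Y (m≤m+n Y 0)))) ⟩
        N * (4 * (2 * Y * (16 * e)))     ≡⟨ regroup N Y e ⟩
        128 * N * e * Y                  ≤⟨ *-monoʳ-≤ Q Y≤p ⟩
        Q * p                            ∎
        where
        open ℕ.≤-Reasoning
        regroup : ∀ N Y e → N * (4 * (2 * Y * (16 * e))) ≡ 128 * N * e * Y
        regroup = ℕ-solve

      v : ℕ → ℤ
      v i = (+ e) ℤ.^ e ℤ.* (+ (WA.first + N * i)) ℤ.^ n

      module S = Sieve e N z WA.first WB.first I J Y T K ((+ n) ℤ.^ n) v p∤e p∤nⁿ p∤N
        32≤z 16e≤z 0<I I≤J T≤ 24K≤I 16eY≤J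

      Represents : ℕ × ℕ → ℤ × ℤ → Set
      Represents (i , j) (a , b) = ∣ a ∣ ≡ S.a i × ∣ b ∣ ≡ S.b j

      represents-injective : ∀ {x x′ y} → Represents x y → Represents x′ y → x ≡ x′
      represents-injective (a≡ , b≡) (a≡′ , b≡′) = cong₂ _,_
        (progression-cancel WA.first N 0<N (trans (sym a≡) a≡′)) (progression-cancel WB.first N 0<N (trans (sym b≡) b≡′))

      module _ {i j : ℕ} (w≡0 : S.weight i j ≡ 0) (i<I : i < I) (j<J : j < J) where

        a b : ℕ
        a = S.a i
        b = S.b j

        a≡ : a ≡ m + N * (suc (A div N) + i)
        a≡ = trans (+-assoc m _ _) (cong (λ x → m + x) (sym (*-distribˡ-+ N (suc (A div N)) i)))

        b≡ : b ≡ c₀ + N * (suc (B div N) + j)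
        b≡ = trans (+-assoc c₀ _ _) (cong (λ x → c₀ + x) (sym (*-distribˡ-+ N (suc (B div N)) j)))

        A≤a : A ≤ a
        A≤a = WA.window-≥ i
        B≤b : B ≤ b
        B≤b = WB.window-≥ j
        a≤2A : a ≤ 2 * A
        a≤2A = WA.window-≤ i i<I
        b≤2B : b ≤ 2 * B
        b≤2B = WB.window-≤ j j<J
        0<a : 0 < a
        0<a = <-≤-trans 0<A A≤a
        0<b : 0 < b
        0<b = <-≤-trans 0<B B≤b

        -- Primes up to z are settled by the residue classes, those from z to 2 A by the sieve.
        a⊥b : ∀ p → Prime p → p ∣ a → ¬ (p ∣ b)
        a⊥b p pr p∣a = by-size (z ℕ.<? p)
          where
          by-size : Dec (z < p) → ¬ (p ∣ b)
          by-size (yes z<p) = S.survivor-coprime w≡0 pr z<p (s≤s (≤-trans (ℕ∣.∣⇒≤ {{>-nonZero 0<a}} p∣a) a≤2A)) p∣a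
          by-size (no z≮p)  = small-coprime a≡ b≡ pr (≮⇒≥ z≮p) p∣a

        -- Such a p exceeds z and does not divide b, so the sieve would have caught it below Y;
        -- hence p ≥ Y, and B ≤ Q Y.
        large⁺ : ∀ p → Prime p → p * p ∣ ∣ positive a b ∣ → B ≤ Q * p
        large⁺ p pr h = use (discriminant-prime a≡ b≡ a⊥b (term-prime a) (prime-term a) pr (square∣⇒∣ {p} h))
          where
          use : z < p × ¬ (p ∣ b) → B ≤ Q * p
          use (z<p , p∤b) = B≤Q* (≮⇒≥ λ p<Y → S.survivor-square⁺ w≡0 pr z<p p<Y (p∤b , h))

        large⁻ : ∀ p → Prime p → p * p ∣ ∣ negative a b ∣ → B ≤ Q * p
        large⁻ p pr h = use (discriminant-prime a≡ b≡ a⊥b (λ p pr k → term-prime a p pr (neg-∣ k)) (λ p k → ℤ∣.∣m⇒∣-m (prime-term a p k)) pr (square∣⇒∣ {p} h))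
          where
          use : z < p × ¬ (p ∣ b) → B ≤ Q * p
          use (z<p , p∤b) = B≤Q* (≮⇒≥ λ p<Y → S.survivor-square⁻ w≡0 pr z<p p<Y (p∤b , h))

        irreducible : ∀ a′ → ∣ a′ ∣ ≡ a → IrreducibleOverℚ (trinomial n a′ (+ b))
        irreducible a′ a′≡ = trinomial-irreducible 1<e even {+ m} {a′} {+ b} (ℤ∣.∣ᵤ⇒∣ (subst (m ∣_) (sym a′≡) (m∣a a≡ b≡)))
          λ k γ 0<k k<n h → nonresidue k γ 0<k k<n (≋-trans h (≋-^ k (b≋β a≡ b≡)))

        member : ∃ λ y → Represents (i , j) y × 𝓜 n A B y
        member = package (squarefree-choice D u abc (<⇒≤ A^<B^) (<⇒≤ A<B) 0<B κ<B a≡ b≡ 0<a 0<b a≤2A b≤2B a⊥b large⁺ large⁻)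
          where
          package : (∃ λ a′ → ∣ a′ ∣ ≡ a × Squarefree (discriminant n (trinomial n a′ (+ b)))) → ∃ λ y → Represents (i , j) y × 𝓜 n A B y
          package (a′ , a′≡ , squarefree) = (a′ , + b) , (a′≡ , refl) ,
            (subst (A ≤_) (sym a′≡) A≤a , subst (_≤ 2 * A) (sym a′≡) a≤2A) , (B≤b , b≤2B) , irreducible a′ a′≡ , squarefree

      A*B≤ : A * B ≤ 16 * N * N * (I * J)
      A*B≤ = begin
        A * B                                ≤⟨ *-mono-≤ (<⇒≤ WA.A<N*[size+3]) (<⇒≤ WB.A<N*[size+3]) ⟩
        N * (I + 3) * (N * (J + 3))          ≤⟨ *-mono-≤ (*-monoʳ-≤ N (size+3 0<I)) (*-monoʳ-≤ N (size+3 0<J)) ⟩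
        N * (4 * I) * (N * (4 * J))          ≡⟨ regroup N I J ⟩
        16 * N * N * (I * J)                 ∎
        where
        open ℕ.≤-Reasoning
        regroup : ∀ N I J → N * (4 * I) * (N * (4 * J)) ≡ 16 * N * N * (I * J)
        regroup = ℕ-solve

    many-members : ∃ λ ys → Unique ys × All (𝓜 n A B) ys × A * B ≤ 32 * N * N * length ys
    many-members = from-survivors S.survivors
      where
      from-survivors : (∃ λ xs → Unique xs × All (λ (i , j) → S.weight i j ≡ 0 × i < I × j < J) xs × I * J ≤ 2 * length xs) →
        ∃ λ ys → Unique ys × All (𝓜 n A B) ys × A * B ≤ 32 * N * N * length ys
      from-survivors (xs , unique , good , IJ≤) = from-image
        (choose-image {R = Represents} {P = 𝓜 n A B} (λ {x} {x′} {y} → represents-injective {x} {x′} {y}) unique (All.map (λ (w≡0 , i<I , j<J) → member w≡0 i<I j<J) good))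
        where
        from-image : (∃ λ ys → Unique ys × All (𝓜 n A B) ys × length ys ≡ length xs) →
          ∃ λ ys → Unique ys × All (𝓜 n A B) ys × A * B ≤ 32 * N * N * length ys
        from-image (ys , unique′ , members , length≡) = ys , unique′ , members , (begin
          A * B                              ≤⟨ A*B≤ ⟩
          16 * N * N * (I * J)               ≤⟨ *-monoʳ-≤ (16 * N * N) (subst (λ l → I * J ≤ 2 * l) (sym length≡) IJ≤) ⟩
          16 * N * N * (2 * length ys)       ≡⟨ regroup N (length ys) ⟩
          32 * N * N * length ys             ∎)
          where
          open ℕ.≤-Reasoning
          regroup : ∀ N l → 16 * N * N * (2 * l) ≡ 32 * N * N * l
          regroup = ℕ-solve

Conclusion : ℕ → ℝ → Set₁
Conclusion n δ₀ = Σ[ c ∈ ℝ ] Positive c × (Σ[ A₀ ∈ ℕ ]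
  ((A B : ℕ) → 1 < A → 1 < B → A₀ ≤ A → A ^1+ δ₀ < B → c · (A * B) ≤# 𝓜 n A B))

conclusion-4q+1 : ABC → ∀ q → 0 < q → ∀ δ₀ → Positive δ₀ → Conclusion (suc (4 * q)) δ₀
conclusion-4q+1 abc q 0<q δ₀ positive = from-exponent (uniform-exponent δ₀ positive)
  where
  n : ℕ
  n = suc (4 * q)
  nonresidues : PowerNonresidues n
  nonresidues = power-nonresidues (4 * q) (s≤s (*-mono-≤ (s≤s (z≤n {3})) 0<q))

  from-exponent : (∃ λ D → 0 < D × (∀ A B → 1 < A → A ^1+ δ₀ < B → A ^ suc D < B ^ D)) → Conclusion n δ₀
  from-exponent (D , _ , exponent) = from-constant (abc-power abc (2 * n * suc D) (s≤s z≤n))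
    where
    from-constant : (∃ λ u → ∀ a b c → 0 < a → 0 < b → 0 < c → Coprime a b → Coprime a c → Coprime b c → a + b ≡ c →
      c ^ (2 * n * suc D) ≤ u ^ (2 * n * suc D) * radical (a * b * c) ^ suc (2 * n * suc D)) → Conclusion n δ₀
    from-constant (u , abc-bound) = fromℚ (+ 1 ℚ./ suc w) , fraction-< {0} {0} {1} {w} (s≤s z≤n) , A₀ ,
      λ A B 1<A _ A₀≤A A^<B → package (many-members 1<A A₀≤A (exponent A B 1<A A^<B))
      where
      open Counting q 0<q nonresidues D u abc-bound
      N w : ℕ
      N = Residues.N q 0<q nonresidues
      -- A factor 4 N is lost in each coordinate on passing from A and B to the index ranges I and
      -- J, and a factor 2 in the sieve. The constant is 1 / (w + 1).
      w = 32 * N * N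
      package : ∀ {A B} → (∃ λ ys → Unique ys × All (𝓜 n A B) ys × A * B ≤ w * length ys) → fromℚ (+ 1 ℚ./ suc w) · (A * B) ≤# 𝓜 n A B
      package {A} {B} (ys , unique , members , AB≤) = ys , unique , members , λ x k h → begin
        x * (A * B)           ≤⟨ *-monoʳ-≤ x AB≤ ⟩
        x * (w * length ys)   ≡⟨ *-assoc x w (length ys) ⟨
        x * w * length ys     ≤⟨ *-monoˡ-≤ (length ys) (≤-trans (*-monoʳ-≤ x (n≤1+n w)) (≤-trans (<⇒≤ (fraction-<⁻¹ {x} {k} {1} {w} h)) (≤-reflexive (*-identityˡ (suc k))))) ⟩
        suc k * length ys     ∎
        where open ℕ.≤-Reasoning

theorem1 : ABC →
    (n : ℕ) → 5 ≤ n → ¬ (2 ∣ n) → n % 4 ≡ 1 →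
    (δ₀ : ℝ) → Positive δ₀ →
    Σ[ c ∈ ℝ ] Positive c × (Σ[ A₀ ∈ ℕ ]
    ((A B : ℕ) → 1 < A → 1 < B → A₀ ≤ A → A ^1+ δ₀ < B →
    c · (A * B) ≤# 𝓜 n A B))
theorem1 abc n 5≤n _ n%4≡1 δ₀ positive = subst (λ n → Conclusion n δ₀) (sym n≡) (conclusion-4q+1 abc (n / 4) 0<q δ₀ positive)
  where
  n≡ : n ≡ suc (4 * (n / 4))
  n≡ = trans (m≡m%n+[m/n]*n n 4) (cong₂ _+_ n%4≡1 (*-comm (n / 4) 4))
  0<q : 0 < n / 4
  0<q = n≢0⇒n>0 λ q≡0 → <⇒≱ 5≤n (≤-trans (≤-reflexive (trans n≡ (cong (λ q → suc (4 * q)) q≡0))) (s≤s z≤n))
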